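{- Let $L$ be any fixed graph with at least one edge, and let $k=k(n)$. If $k=o(n)$, then $$\lim_{n\to\infty}\frac{\log M_{k\cdot L}(n)}{\binom{n}{2}}=\frac{1}{\chi(L)-1}.$$ If $k=cn$ for some constant $c>0$, then $$\lim_{n\to\infty}\frac{\log M_{k\cdot L}(n)}{\binom{n}{2}}\leq \frac{(1-c)^{2}}{\chi(L)-1}.$$
   Context: Logarithms are base 2. $\chi(L)$ is the chromatic number of $L$. For graphs $G,G'$ on the same vertex set $[n]$, their symmetric difference $G\oplus G'$ is the graph on $[n]$ whose edge set consists of all edges belonging to exactly one of $G,G'$. $M_{k\cdot L}(n)$ denotes the largest cardinality of a family $\mathcal{G}$ of graphs on vertex set $[n]$ such that for any two distinct members $G,G'\in\mathcal{G}$, the graph $G\oplus G'$ contains at least $k$ pairwise vertex-disjoint copies of $L$. -}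

module Defs where

open import Data.Bool.Base using (Bool; false; true; T; _xor_)
open import Data.Fin.Base using (Fin)
open import Data.Integer.Base as ℤ using (+_)
import Data.Integer.Properties as ℤ
open import Data.Nat.Base as ℕ using (ℕ; zero; suc)
import Data.Nat.Properties as ℕ
open import Data.Nat.Induction using (<-wellFounded)
open import Data.Nat.Logarithm using (⌊log₂_⌋; ⌊log₂⌋-mono-≤; ⌊log₂[2^n]⌋≡n)
open import Data.Nat.Logarithm.Core using (⌊log2⌋)
open import Data.Nat.Combinatorics using (_C_)
open import Data.Product.Base using (∃; ∃₂; _×_; _,_; proj₁; proj₂)
open import Data.Rational.Base as ℚ using (ℚ; 0ℚ; 1ℚ; ½; ∣_∣)
import Data.Rational.Properties as ℚ
open import Data.Rational.Solver using (module +-*-Solver)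
import Data.Rational.Unnormalised.Base as ℚᵘ
import Data.Rational.Unnormalised.Properties as ℚᵘ
open import Data.Sum.Base using (inj₁; inj₂)
open import Function.Definitions using (Injective)
open import Induction.WellFounded using (Acc; acc)
open import Relation.Binary.PropositionalEquality
  using (_≡_; _≢_; refl; sym; trans; cong; cong₂; subst)
open import Relation.Nullary using (¬_; yes; no; contradiction)

IsCauchy : (ℕ → ℚ) → Set
IsCauchy x = ∀ ε → 0ℚ ℚ.< ε →
  ∃ λ N → ∀ m n → N ℕ.≤ m → N ℕ.≤ n → ∣ x m ℚ.- x n ∣ ℚ.≤ ε

-- Sequences with the same limit are not identified by _≡_; equality of
-- reals is x ≤ʳ y together with y ≤ʳ x.
record ℝ : Set where
  constructor mkℝ
  field
    seq    : ℕ → ℚ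
    cauchy : IsCauchy seq

open ℝ public

infix 4 _≤ʳ_ _<ʳ_

_≤ʳ_ : ℝ → ℝ → Set
x ≤ʳ y = ∀ ε → 0ℚ ℚ.< ε →
  ∃ λ N → ∀ n → N ℕ.≤ n → seq x n ℚ.≤ seq y n ℚ.+ ε

_<ʳ_ : ℝ → ℝ → Set
x <ʳ y = ∃ λ ε → 0ℚ ℚ.< ε ×
  ∃ λ N → ∀ n → N ℕ.≤ n → seq x n ℚ.+ ε ℚ.≤ seq y n

module RationalLemmas where
  module S = +-*-Solver

  ∣p-p∣≤ε : ∀ p {ε} → 0ℚ ℚ.< ε → ∣ p ℚ.- p ∣ ℚ.≤ ε
  ∣p-p∣≤ε p 0<ε rewrite ℚ.+-inverseʳ p = ℚ.<⇒≤ 0<ε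

  ∣p∣≤ : ∀ p {q} → p ℚ.≤ q → ℚ.- p ℚ.≤ q → ∣ p ∣ ℚ.≤ q
  ∣p∣≤ p p≤q -p≤q with ℚ.∣p∣≡p∨∣p∣≡-p p
  ... | inj₁ eq rewrite eq = p≤q
  ... | inj₂ eq rewrite eq = -p≤q

  halve-pos : ∀ {ε} → 0ℚ ℚ.< ε → 0ℚ ℚ.< ½ ℚ.* ε
  halve-pos {ε} 0<ε = ℚ.positive⁻¹ (½ ℚ.* ε)
    {{ℚ.pos*pos⇒pos ½ ε {{ℚ.positive 0<ε}}}}

  halves : ∀ ε → ½ ℚ.* ε ℚ.+ ½ ℚ.* ε ≡ ε
  halves = S.solve 1 (λ e → S.con ½ S.:* e S.:+ S.con ½ S.:* e S.:= e) refl

open RationalLemmas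

fromℚ : ℚ → ℝ
fromℚ q .seq _ = q
fromℚ q .cauchy ε 0<ε = 0 , λ _ _ _ _ → ∣p-p∣≤ε q 0<ε

fromℕ : ℕ → ℝ
fromℕ n = fromℚ (+ n ℚ./ 1)

infix  8 -ʳ_
infixl 7 _*ʳ_
infixl 6 _+ʳ_ _-ʳ_

_+ʳ_ : ℝ → ℝ → ℝ
(x +ʳ y) .seq n = seq x n ℚ.+ seq y n
(x +ʳ y) .cauchy ε 0<ε
  with cauchy x (½ ℚ.* ε) (halve-pos 0<ε) | cauchy y (½ ℚ.* ε) (halve-pos 0<ε)
... | M , hx | N , hy = M ℕ.⊔ N , λ m n p q → begin
  ∣ (seq x m ℚ.+ seq y m) ℚ.- (seq x n ℚ.+ seq y n) ∣
    ≡⟨ cong ∣_∣ (S.solve 4 (λ a b c d →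
         (a S.:+ b) S.:- (c S.:+ d) S.:= (a S.:- c) S.:+ (b S.:- d)) refl
         (seq x m) (seq y m) (seq x n) (seq y n)) ⟩
  ∣ (seq x m ℚ.- seq x n) ℚ.+ (seq y m ℚ.- seq y n) ∣
    ≤⟨ ℚ.∣p+q∣≤∣p∣+∣q∣ (seq x m ℚ.- seq x n) (seq y m ℚ.- seq y n) ⟩
  ∣ seq x m ℚ.- seq x n ∣ ℚ.+ ∣ seq y m ℚ.- seq y n ∣
    ≤⟨ ℚ.+-mono-≤
         (hx m n (ℕ.m⊔n≤o⇒m≤o M N p) (ℕ.m⊔n≤o⇒m≤o M N q))
         (hy m n (ℕ.m⊔n≤o⇒n≤o M N p) (ℕ.m⊔n≤o⇒n≤o M N q)) ⟩
  ½ ℚ.* ε ℚ.+ ½ ℚ.* ε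
    ≡⟨ halves ε ⟩
  ε ∎
  where open ℚ.≤-Reasoning

-ʳ_ : ℝ → ℝ
(-ʳ x) .seq n = ℚ.- seq x n
(-ʳ x) .cauchy ε 0<ε with cauchy x ε 0<ε
... | N , h = N , λ m n p q → subst (ℚ._≤ ε)
  (trans (sym (ℚ.∣-p∣≡∣p∣ (seq x m ℚ.- seq x n)))
    (cong ∣_∣ (S.solve 2 (λ a b → S.:- (a S.:- b) S.:= (S.:- a) S.:- (S.:- b))
      refl (seq x m) (seq x n))))
  (h m n p q)

_-ʳ_ : ℝ → ℝ → ℝ
x -ʳ y = x +ʳ (-ʳ y)

module ProductLemmas where
  bounded : ∀ (x : ℝ) → ∃ λ B → 0ℚ ℚ.< B ×
    ∃ λ N → ∀ n → N ℕ.≤ n → ∣ seq x n ∣ ℚ.≤ B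
  bounded x with cauchy x 1ℚ (ℚ.positive⁻¹ 1ℚ)
  ... | N , h = ∣ seq x N ∣ ℚ.+ 1ℚ
    , ℚ.+-mono-≤-< (ℚ.0≤∣p∣ (seq x N)) (ℚ.positive⁻¹ 1ℚ)
    , N , λ n p → begin
      ∣ seq x n ∣
        ≡⟨ cong ∣_∣ (S.solve 2 (λ a b → a S.:= b S.:+ (a S.:- b)) refl
             (seq x n) (seq x N)) ⟩
      ∣ seq x N ℚ.+ (seq x n ℚ.- seq x N) ∣
        ≤⟨ ℚ.∣p+q∣≤∣p∣+∣q∣ (seq x N) (seq x n ℚ.- seq x N) ⟩
      ∣ seq x N ∣ ℚ.+ ∣ seq x n ℚ.- seq x N ∣
        ≤⟨ ℚ.+-monoʳ-≤ ∣ seq x N ∣ (h n N p ℕ.≤-refl) ⟩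
      ∣ seq x N ∣ ℚ.+ 1ℚ ∎
    where open ℚ.≤-Reasoning

  scale : ∀ B ε → 0ℚ ℚ.< B → 0ℚ ℚ.< ε →
    ∃ λ δ → 0ℚ ℚ.< δ × B ℚ.* δ ≡ ½ ℚ.* ε
  scale B ε 0<B 0<ε = 1/B ℚ.* (½ ℚ.* ε)
    , ℚ.positive⁻¹ _ {{ℚ.pos*pos⇒pos 1/B {{ℚ.1/pos⇒pos B}} (½ ℚ.* ε)
        {{ℚ.positive (halve-pos 0<ε)}}}}
    , trans (sym (ℚ.*-assoc B 1/B (½ ℚ.* ε)))
        (trans (cong (ℚ._* (½ ℚ.* ε)) (ℚ.*-inverseʳ B)) (ℚ.*-identityˡ (½ ℚ.* ε)))
    where
    instance
      B-pos : ℚ.Positive B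
      B-pos = ℚ.positive 0<B
      B-nz : ℚ.NonZero B
      B-nz = ℚ.pos⇒nonZero B
    1/B : ℚ
    1/B = ℚ.1/ B

  *-bound : ∀ a b {B δ} → 0ℚ ℚ.≤ B → ∣ a ∣ ℚ.≤ B → ∣ b ∣ ℚ.≤ δ →
    ∣ a ℚ.* b ∣ ℚ.≤ B ℚ.* δ
  *-bound a b {B} {δ} 0≤B a≤B b≤δ = begin
    ∣ a ℚ.* b ∣     ≡⟨ ℚ.∣p*q∣≡∣p∣*∣q∣ a b ⟩
    ∣ a ∣ ℚ.* ∣ b ∣  ≤⟨ ℚ.*-monoʳ-≤-nonNeg ∣ b ∣ {{ℚ.∣-∣-nonNeg b}} a≤B ⟩
    B ℚ.* ∣ b ∣     ≤⟨ ℚ.*-monoˡ-≤-nonNeg B {{ℚ.nonNegative 0≤B}} b≤δ ⟩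
    B ℚ.* δ        ∎
    where open ℚ.≤-Reasoning

  *-diff : ∀ a b c d {A B α β} → 0ℚ ℚ.≤ A → 0ℚ ℚ.≤ B →
    ∣ a ∣ ℚ.≤ A → ∣ d ∣ ℚ.≤ B → ∣ b ℚ.- d ∣ ℚ.≤ α → ∣ a ℚ.- c ∣ ℚ.≤ β →
    ∣ a ℚ.* b ℚ.- c ℚ.* d ∣ ℚ.≤ A ℚ.* α ℚ.+ B ℚ.* β
  *-diff a b c d {A} {B} {α} {β} 0≤A 0≤B a≤A d≤B b-d≤α a-c≤β = begin
    ∣ a ℚ.* b ℚ.- c ℚ.* d ∣
      ≡⟨ cong ∣_∣ (S.solve 4 (λ a b c d →
           a S.:* b S.:- c S.:* d S.:= a S.:* (b S.:- d) S.:+ d S.:* (a S.:- c))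
           refl a b c d) ⟩
    ∣ a ℚ.* (b ℚ.- d) ℚ.+ d ℚ.* (a ℚ.- c) ∣
      ≤⟨ ℚ.∣p+q∣≤∣p∣+∣q∣ (a ℚ.* (b ℚ.- d)) (d ℚ.* (a ℚ.- c)) ⟩
    ∣ a ℚ.* (b ℚ.- d) ∣ ℚ.+ ∣ d ℚ.* (a ℚ.- c) ∣
      ≤⟨ ℚ.+-mono-≤ (*-bound a (b ℚ.- d) 0≤A a≤A b-d≤α)
                    (*-bound d (a ℚ.- c) 0≤B d≤B a-c≤β) ⟩
    A ℚ.* α ℚ.+ B ℚ.* β ∎
    where open ℚ.≤-Reasoning

  *-cauchy : ∀ x y → IsCauchy (λ n → seq x n ℚ.* seq y n)
  *-cauchy x y ε 0<ε =
    let A , 0<A , N₁ , hA = bounded x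
        B , 0<B , N₂ , hB = bounded y
        α , 0<α , eqα = scale A ε 0<A 0<ε
        β , 0<β , eqβ = scale B ε 0<B 0<ε
        N₃ , hy = cauchy y α 0<α
        N₄ , hx = cauchy x β 0<β
        N₁₂ = N₁ ℕ.⊔ N₂
        N₃₄ = N₃ ℕ.⊔ N₄
    in N₁₂ ℕ.⊔ N₃₄ , λ m n p q →
      let N₁₂≤m = ℕ.m⊔n≤o⇒m≤o N₁₂ N₃₄ p
          N₁₂≤n = ℕ.m⊔n≤o⇒m≤o N₁₂ N₃₄ q
          N₃₄≤m = ℕ.m⊔n≤o⇒n≤o N₁₂ N₃₄ p
          N₃₄≤n = ℕ.m⊔n≤o⇒n≤o N₁₂ N₃₄ q
      in ℚ.≤-trans
        (*-diff (seq x m) (seq y m) (seq x n) (seq y n) (ℚ.<⇒≤ 0<A) (ℚ.<⇒≤ 0<B)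
          (hA m (ℕ.m⊔n≤o⇒m≤o N₁ N₂ N₁₂≤m))
          (hB n (ℕ.m⊔n≤o⇒n≤o N₁ N₂ N₁₂≤n))
          (hy m n (ℕ.m⊔n≤o⇒m≤o N₃ N₄ N₃₄≤m) (ℕ.m⊔n≤o⇒m≤o N₃ N₄ N₃₄≤n))
          (hx m n (ℕ.m⊔n≤o⇒n≤o N₃ N₄ N₃₄≤m) (ℕ.m⊔n≤o⇒n≤o N₃ N₄ N₃₄≤n)))
        (ℚ.≤-reflexive (trans (cong₂ ℚ._+_ eqα eqβ) (halves ε)))

open ProductLemmas

_*ʳ_ : ℝ → ℝ → ℝ
(x *ʳ y) .seq n  = seq x n ℚ.* seq y n
(x *ʳ y) .cauchy = *-cauchy x y

-- Division of a real by a natural number; the value at divisor 0 is a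
-- convention.
infixl 7 _÷ʳ_
_÷ʳ_ : ℝ → ℕ → ℝ
x ÷ʳ zero  = fromℚ 0ℚ
x ÷ʳ suc d = x *ʳ fromℚ (+ 1 ℚ./ suc d)

module LogLemmas where
  2*suc⌊n/2⌋≤2+n : ∀ n → 2 ℕ.* suc ℕ.⌊ n /2⌋ ℕ.≤ suc (suc n)
  2*suc⌊n/2⌋≤2+n zero          = ℕ.≤-refl
  2*suc⌊n/2⌋≤2+n (suc zero)    = ℕ.s≤s (ℕ.s≤s ℕ.z≤n)
  2*suc⌊n/2⌋≤2+n (suc (suc n)) rewrite ℕ.+-suc ℕ.⌊ n /2⌋ (suc (ℕ.⌊ n /2⌋ ℕ.+ 0)) =
    ℕ.s≤s (ℕ.s≤s (2*suc⌊n/2⌋≤2+n n))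

  2^⌊log2⌋≤ : ∀ n (a : Acc ℕ._<_ (suc n)) → 2 ℕ.^ ⌊log2⌋ (suc n) a ℕ.≤ suc n
  2^⌊log2⌋≤ zero    _        = ℕ.≤-refl
  2^⌊log2⌋≤ (suc n) (acc rs) = ℕ.≤-trans
    (ℕ.*-monoʳ-≤ 2 (2^⌊log2⌋≤ ℕ.⌊ n /2⌋ _)) (2*suc⌊n/2⌋≤2+n n)

  2^⌊log₂⌋≤ : ∀ n .{{_ : ℕ.NonZero n}} → 2 ℕ.^ ⌊log₂ n ⌋ ℕ.≤ n
  2^⌊log₂⌋≤ (suc n) = 2^⌊log2⌋≤ n (<-wellFounded (suc n))

  <2^1+⌊log₂⌋ : ∀ n → n ℕ.< 2 ℕ.^ suc ⌊log₂ n ⌋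
  <2^1+⌊log₂⌋ n with 2 ℕ.^ suc ⌊log₂ n ⌋ ℕ.≤? n
  ... | no  ≰n = ℕ.≰⇒> ≰n
  ... | yes ≤n = contradiction
    (subst (ℕ._≤ ⌊log₂ n ⌋) (⌊log₂[2^n]⌋≡n (suc ⌊log₂ n ⌋)) (⌊log₂⌋-mono-≤ ≤n))
    ℕ.1+n≰n

  2^-cancel : ∀ {a b} → 2 ℕ.^ a ℕ.≤ 2 ℕ.^ b → a ℕ.≤ b
  2^-cancel {a} {b} le with a ℕ.≤? b
  ... | yes a≤b = a≤b
  ... | no  a≰b = contradiction le
    (ℕ.<⇒≱ (ℕ.^-monoʳ-< 2 (ℕ.s≤s (ℕ.s≤s ℕ.z≤n)) (ℕ.≰⇒> a≰b)))

  log-cross : ∀ m i j →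
    ⌊log₂ m ℕ.^ suc i ⌋ ℕ.* suc j ℕ.≤ suc ⌊log₂ m ℕ.^ suc j ⌋ ℕ.* suc i
  log-cross zero      i j = ℕ.z≤n
  log-cross m@(suc _) i j = 2^-cancel (begin
    2 ℕ.^ (a ℕ.* suc j)          ≡⟨ sym (ℕ.^-*-assoc 2 a (suc j)) ⟩
    (2 ℕ.^ a) ℕ.^ suc j          ≤⟨ ℕ.^-monoˡ-≤ (suc j)
                                     (2^⌊log₂⌋≤ (m ℕ.^ suc i) {{ℕ.m^n≢0 m (suc i)}}) ⟩
    (m ℕ.^ suc i) ℕ.^ suc j      ≡⟨ ℕ.^-*-assoc m (suc i) (suc j) ⟩
    m ℕ.^ (suc i ℕ.* suc j)      ≡⟨ cong (m ℕ.^_) (ℕ.*-comm (suc i) (suc j)) ⟩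
    m ℕ.^ (suc j ℕ.* suc i)      ≡⟨ sym (ℕ.^-*-assoc m (suc j) (suc i)) ⟩
    (m ℕ.^ suc j) ℕ.^ suc i      ≤⟨ ℕ.^-monoˡ-≤ (suc i) (ℕ.<⇒≤ (<2^1+⌊log₂⌋ (m ℕ.^ suc j))) ⟩
    (2 ℕ.^ suc b) ℕ.^ suc i      ≡⟨ ℕ.^-*-assoc 2 (suc b) (suc i) ⟩
    2 ℕ.^ (suc b ℕ.* suc i)      ∎)
    where
    open ℕ.≤-Reasoning
    a = ⌊log₂ m ℕ.^ suc i ⌋
    b = ⌊log₂ m ℕ.^ suc j ⌋

  /-mono : ∀ a b c d → a ℕ.* suc d ℕ.≤ c ℕ.* suc b →
    + a ℚ./ suc b ℚ.≤ + c ℚ./ suc d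
  /-mono a b c d le = ℚ.toℚᵘ-cancel-≤ (begin
    ℚ.toℚᵘ (+ a ℚ./ suc b)  ≃⟨ ℚ.toℚᵘ-fromℚᵘ (ℚᵘ.mkℚᵘ (+ a) b) ⟩
    ℚᵘ.mkℚᵘ (+ a) b         ≤⟨ ℚᵘ.*≤* (begin′ a b c d le) ⟩
    ℚᵘ.mkℚᵘ (+ c) d         ≃⟨ ℚᵘ.≃-sym (ℚ.toℚᵘ-fromℚᵘ (ℚᵘ.mkℚᵘ (+ c) d)) ⟩
    ℚ.toℚᵘ (+ c ℚ./ suc d)  ∎)
    where
    open ℚᵘ.≤-Reasoning
    begin′ : ∀ a b c d → a ℕ.* suc d ℕ.≤ c ℕ.* suc b →
      + a ℤ.* + suc d ℤ.≤ + c ℤ.* + suc b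
    begin′ a b c d le
      rewrite sym (ℤ.pos-* a (suc d)) | sym (ℤ.pos-* c (suc b)) = ℤ.+≤+ le

  suc/ : ∀ b j → + suc b ℚ./ suc j ≡ + b ℚ./ suc j ℚ.+ + 1 ℚ./ suc j
  suc/ b j = ℚ.toℚᵘ-injective (ℚᵘ.≃-trans
    (ℚ.toℚᵘ-fromℚᵘ (ℚᵘ.mkℚᵘ (+ suc b) j))
    (ℚᵘ.≃-trans (ℚᵘ.*≡* eq)
    (ℚᵘ.≃-trans
      (ℚᵘ.+-cong (ℚᵘ.≃-sym (ℚ.toℚᵘ-fromℚᵘ (ℚᵘ.mkℚᵘ (+ b) j)))
                 (ℚᵘ.≃-sym (ℚ.toℚᵘ-fromℚᵘ (ℚᵘ.mkℚᵘ (+ 1) j))))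
      (ℚᵘ.≃-sym (ℚ.toℚᵘ-homo-+ (+ b ℚ./ suc j) (+ 1 ℚ./ suc j))))))
    where
    J = + suc j
    eq : + suc b ℤ.* + (suc j ℕ.* suc j) ≡ (+ b ℤ.* J ℤ.+ + 1 ℤ.* J) ℤ.* J
    eq = trans (cong (+ suc b ℤ.*_) (ℤ.pos-* (suc j) (suc j)))
      (trans (sym (ℤ.*-assoc (+ suc b) J J))
        (cong (ℤ._* J) (trans (cong (λ t → + t ℤ.* J) (ℕ.+-comm 1 b))
          (ℤ.*-distribʳ-+ J (+ b) (+ 1)))))

  archimedean : ∀ ε → 0ℚ ℚ.< ε →
    ∃ λ N → ∀ n → N ℕ.≤ n → + 1 ℚ./ suc n ℚ.≤ ε
  archimedean ε@(ℚ.mkℚ (+ zero) _ _)      0<ε = contradiction (ℚ.positive 0<ε) λ ()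
  archimedean ε@(ℚ.mkℚ ℤ.-[1+ _ ] _ _)    0<ε = contradiction (ℚ.positive 0<ε) λ ()
  archimedean ε@(ℚ.mkℚ (+ suc a) d _)     _   = d , λ n d≤n →
    subst (+ 1 ℚ./ suc n ℚ.≤_) (ℚ.↥p/↧p≡p ε)
      (/-mono 1 n (suc a) d (ℕ.*-mono-≤ (ℕ.s≤s {n = a} ℕ.z≤n) (ℕ.s≤s d≤n)))

  /-diff : ∀ a b i j → a ℕ.* suc j ℕ.≤ suc b ℕ.* suc i →
    + a ℚ./ suc i ℚ.- + b ℚ./ suc j ℚ.≤ + 1 ℚ./ suc j
  /-diff a b i j le = begin
    + a ℚ./ suc i ℚ.- q      ≤⟨ ℚ.+-monoˡ-≤ (ℚ.- q) (/-mono a i (suc b) j le) ⟩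
    + suc b ℚ./ suc j ℚ.- q  ≡⟨ cong (ℚ._- q) (suc/ b j) ⟩
    q ℚ.+ r ℚ.- q            ≡⟨ S.solve 2 (λ x y → x S.:+ y S.:- x S.:= y) refl q r ⟩
    r                        ∎
    where
    open ℚ.≤-Reasoning
    q = + b ℚ./ suc j
    r = + 1 ℚ./ suc j

  /-cauchy : (a : ℕ → ℕ) → (∀ i j → a i ℕ.* suc j ℕ.≤ suc (a j) ℕ.* suc i) →
    IsCauchy (λ i → + a i ℚ./ suc i)
  /-cauchy a cross ε 0<ε =
    let N , h = archimedean ε 0<ε
    in N , λ i j N≤i N≤j →
      let p = + a i ℚ./ suc i
          q = + a j ℚ./ suc j
      in ∣p∣≤ (p ℚ.- q)
        (ℚ.≤-trans (/-diff (a i) (a j) i j (cross i j)) (h j N≤j))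
        (subst (ℚ._≤ ε)
          (S.solve 2 (λ x y → y S.:- x S.:= S.:- (x S.:- y)) refl p q)
          (ℚ.≤-trans (/-diff (a j) (a i) j i (cross j i)) (h i N≤i)))

open LogLemmas

-- log₂ m is the limit of ⌊log₂ (mⁱ)⌋ / i, which is within 1 / i of it for
-- m > 0.  With this formula log₂ 0 is 0.
log₂ : ℕ → ℝ
log₂ m .seq i = + ⌊log₂ m ℕ.^ suc i ⌋ ℚ./ suc i
log₂ m .cauchy  = /-cauchy (λ i → ⌊log₂ m ℕ.^ suc i ⌋) (log-cross m)

infix 4 _⟶_

_⟶_ : (ℕ → ℝ) → ℝ → Set
x ⟶ a = ∀ ε → 0ℚ ℚ.< ε →
  ∃ λ N → ∀ n → N ℕ.≤ n → x n ≤ʳ a +ʳ fromℚ ε × a ≤ʳ x n +ʳ fromℚ ε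

LimSup≤ : (ℕ → ℝ) → ℝ → Set
LimSup≤ x b = ∀ ε → 0ℚ ℚ.< ε →
  ∃ λ N → ∀ n → N ℕ.≤ n → x n ≤ʳ b +ʳ fromℚ ε

_isLittleO[n] : (ℕ → ℕ) → Set
k isLittleO[n] = (λ n → fromℕ (k n) ÷ʳ n) ⟶ fromℚ 0ℚ

-- c n need not be an integer, so "k = c n" is read as ∣ k n - c n ∣ < 1: this
-- admits both ⌈c n⌉ and ⌊c n⌋, and any choice between them for each n.
_isRoundingOf_·n : (ℕ → ℕ) → ℝ → Set
k isRoundingOf c ·n = ∀ n →
  fromℕ (k n) <ʳ c *ʳ fromℕ n +ʳ fromℕ 1 ×
  c *ʳ fromℕ n <ʳ fromℕ (k n) +ʳ fromℕ 1

record Graph (n : ℕ) : Set where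
  field
    edge?  : Fin n → Fin n → Bool
    symm   : ∀ u v → edge? u v ≡ edge? v u
    irrefl : ∀ v → edge? v v ≡ false

  Edge : Fin n → Fin n → Set
  Edge u v = T (edge? u v)

open Graph public

HasEdge : ∀ {n} → Graph n → Set
HasEdge G = ∃₂ λ u v → Edge G u v

-- Without function extensionality, graphs with the same edges need not be
-- equal by _≡_.
infix 4 _≈ᴳ_
_≈ᴳ_ : ∀ {n} → Graph n → Graph n → Set
G ≈ᴳ H = ∀ u v → edge? G u v ≡ edge? H u v

infixl 6 _⊕_
_⊕_ : ∀ {n} → Graph n → Graph n → Graph n
(G ⊕ H) .edge? u v = edge? G u v xor edge? H u v
(G ⊕ H) .symm u v  = cong₂ _xor_ (symm G u v) (symm H u v)
(G ⊕ H) .irrefl v  = cong₂ _xor_ (irrefl G v) (irrefl H v)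

Colorable : ∀ {n} → Graph n → ℕ → Set
Colorable {n} G c = ∃ λ (col : Fin n → Fin c) → ∀ u v → Edge G u v → col u ≢ col v

IsChromaticNumber : ∀ {n} → Graph n → ℕ → Set
IsChromaticNumber G χ = Colorable G χ × (∀ c → Colorable G c → χ ℕ.≤ c)

-- k pairwise vertex-disjoint copies of L in G, as subgraphs (not
-- necessarily induced): copy i sends vertex u of L to f (i , u), and
-- injectivity of f says both that each copy is injective and that
-- distinct copies share no vertex.
ContainsDisjointCopies : ∀ {l n} → ℕ → Graph l → Graph n → Set
ContainsDisjointCopies {l} {n} k L G =
  ∃ λ (f : Fin k × Fin l → Fin n) →
    Injective _≡_ _≡_ f ×
    (∀ i u v → Edge L u v → Edge G (f (i , u)) (f (i , v)))

-- A family of m graphs on [n], listed without repetition, any two distinct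
-- members of which have a symmetric difference containing k disjoint copies
-- of L.
HasCodeOfSize : ∀ {l} → ℕ → Graph l → ℕ → ℕ → Set
HasCodeOfSize k L n m =
  ∃ λ (𝒢 : Fin m → Graph n) →
    (∀ i j → i ≢ j → ¬ 𝒢 i ≈ᴳ 𝒢 j) ×
    (∀ i j → i ≢ j → ContainsDisjointCopies k L (𝒢 i ⊕ 𝒢 j))

-- M_{k·L}(n) as a relation: M is the largest size of such a family.
IsMaxCodeSize : ∀ {l} → ℕ → Graph l → ℕ → ℕ → Set
IsMaxCodeSize k L n M =
  HasCodeOfSize k L n M × (∀ m → HasCodeOfSize k L n m → m ℕ.≤ M)

rate : (ℕ → ℕ) → ℕ → ℝ
rate M n = log₂ (M n) ÷ʳ (n C 2)

module Submission where

-- Upper bound.  Let H be the join of k − 1 vertices and a balanced complete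
-- (χ − 1)-partite graph.  Every copy of L in H uses one of the k − 1 vertices,
-- so two members of the family differ outside H, and the family has at most
-- 2 ^ e members, where e, the number of non-edges of H, is about
-- (n − k)² / (2 (χ − 1)).
--
-- Lower bound.  By maximality (Gilbert–Varshamov) every graph is Gᵢ ⊕ F for a
-- member Gᵢ and a graph F whose lack of k disjoint copies of L forces it to
-- have o(n^χ) copies of K_χ.  Hence it suffices that there are only
-- 2 ^ ((1 − 1/(χ − 1) + o(1)) n² / 2) such F.  Regularity is not needed: F is
-- contained, up to o(n²) edges, in a graph C that has o(n^χ) copies of K_χ and
-- is a union of boxes of a partition of the vertices according to their
-- adjacencies to boundedly many sampled vertices.  There are 2 ^ O(n) such C,
-- and by Moon–Moser each has at most (1 − 1/(χ − 1) + o(1)) n² / 2 edges.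

open import Defs
open RationalLemmas using (module S; halve-pos; halves)
open LogLemmas using (/-mono; archimedean; 2^-cancel; <2^1+⌊log₂⌋)
open import Data.Bool.Base using (Bool; true; false; T; _∧_; _∨_; not; _xor_; if_then_else_)
open import Data.Bool.Properties using (T?; ∧-comm; ∨-comm; ∨-identityʳ; xor-same; xor-comm)
open import Data.Empty using (⊥; ⊥-elim)
open import Data.Fin.Base as Fin using (Fin; zero; suc; toℕ; funToFin; finToFun)
import Data.Fin.Properties as Fin
open import Data.Integer.Base as ℤ using () renaming (+_ to pos)
import Data.Integer.Properties as ℤ
open import Data.List.Base as List using (List; []; _∷_; _++_; length; allFin)
import Data.List.Properties as List
open import Data.List.Membership.Propositional using (_∈_)
import Data.List.Membership.Propositional.Properties as ∈
open import Data.List.Relation.Unary.All as All using (All; []; _∷_)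
import Data.List.Relation.Unary.All.Properties as All
open import Data.List.Relation.Unary.AllPairs using ([]; _∷_)
open import Data.List.Relation.Unary.Unique.Propositional using (Unique)
import Data.List.Relation.Unary.Unique.Propositional.Properties as Unique
open import Data.List.Relation.Unary.Any as Any using (here; there)
import Data.List.Relation.Unary.Any.Properties as Any
open import Data.Maybe.Base using (Maybe; just; nothing)
open import Data.Nat.Base
open import Data.Nat.Combinatorics using (nC1≡n; nCk+nC[k+1]≡[n+1]C[k+1]) renaming (_C_ to binomial)
open import Data.Nat.DivMod using (_/_; m*n/n≡m; m/n*n≤m; /-monoˡ-≤)
open import Data.Nat.Logarithm using (⌊log₂_⌋; ⌊log₂⌋-mono-≤; ⌊log₂[2^n]⌋≡n)
open import Data.Nat.Properties
open import Data.Nat.Tactic.RingSolver using (solve-∀)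
open import Data.Product.Base using (∃; _×_; _,_; proj₁; proj₂)
open import Data.Rational.Base as ℚ using (ℚ; 0ℚ; 1ℚ; ½)
import Data.Rational.Properties as ℚ
import Data.Rational.Unnormalised.Base as ℚᵘ
import Data.Rational.Unnormalised.Properties as ℚᵘ
open import Data.Sum.Base using (inj₁; inj₂)
open import Data.Vec.Base as Vec using (Vec; []; _∷_; lookup; insertAt; removeAt; _[_]≔_)
import Data.Vec.Properties as Vec
open import Function.Base using (_∘_; id)
open import Function.Definitions using (Injective)
open import Relation.Binary.Definitions using (tri<; tri≈; tri>)
open import Relation.Binary.PropositionalEquality
open import Relation.Nullary using (¬_; Dec; yes; no; does; contradiction)
open import Relation.Nullary.Decidable using (_×-dec_)

-- The graphs `F` agree with subgraphs of a container only up to exceptional pairs, so what has to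
-- be counted is the number of graphs that differ from a member of the family inside a container
-- with few exceptions. The exceptions must cost only O(n²/j) bits, where the integer `j` is the
-- accuracy: it stays fixed through all counting and is chosen large only in the passage to the
-- limit. A weighted count takes the place of an entropy estimate. The condition k = o(n) enters
-- through a greedy packing: fewer than `k` copies of `L` cover o(n) vertices, these meet o(n^χ)
-- tuples, and hence a graph with a positive density of χ-cliques has room for one more copy. A
-- container must be readable from the adjacencies to the sample. This is why the edges of the
-- pattern K_χ are replaced singly: each other edge has an endpoint outside the pair under test, so
-- testing the pair against a sampled tuple uses only adjacencies to that tuple. Probabilities are
-- counts over all tuples, and estimates are integer inequalities with denominators cleared. In the
-- code χ = p + 2.

private variable
  A B : Set
  n : ℕ

-- Finite sums and products

∑ : List A → (A → ℕ) → ℕ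
∑ []       f = 0
∑ (x ∷ xs) f = f x + ∑ xs f

𝟙 : Bool → ℕ
𝟙 b = if b then 1 else 0

𝟙-∧ : ∀ a b → 𝟙 (a ∧ b) ≡ 𝟙 a * 𝟙 b
𝟙-∧ true  b = sym (+-identityʳ (𝟙 b))
𝟙-∧ false b = refl

𝟙≤1 : ∀ b → 𝟙 b ≤ 1
𝟙≤1 true  = ≤-refl
𝟙≤1 false = z≤n

𝟙-mono : ∀ {a b} → (T a → T b) → 𝟙 a ≤ 𝟙 b
𝟙-mono {true}  {true}  _ = ≤-refl
𝟙-mono {true}  {false} h = ⊥-elim (h _)
𝟙-mono {false}         _ = z≤n

𝟙-pos : ∀ b → 0 < 𝟙 b → T b
𝟙-pos true _ = _

T⇒≡true : ∀ {b} → T b → b ≡ true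
T⇒≡true {true} _ = refl

𝟙-true : ∀ {b} → T b → 𝟙 b ≡ 1
𝟙-true t = cong 𝟙 (T⇒≡true t)

𝟙-false : ∀ {b} → ¬ T b → 𝟙 b ≡ 0
𝟙-false {true}  h = ⊥-elim (h _)
𝟙-false {false} h = refl

T-ext : ∀ {a b} → (T a → T b) → (T b → T a) → a ≡ b
T-ext {true}  {true}  f g = refl
T-ext {true}  {false} f g = ⊥-elim (f _)
T-ext {false} {true}  f g = ⊥-elim (g _)
T-ext {false} {false} f g = refl

∧-intro : ∀ {a b} → T a → T b → T (a ∧ b)
∧-intro {true} _ t = t

∧-fst : ∀ {a b} → T (a ∧ b) → T a
∧-fst {true} _ = _

∧-snd : ∀ {a b} → T (a ∧ b) → T b
∧-snd {true} t = t

not-elim : ∀ {a} → T (not a) → ¬ T a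
not-elim {false} _ ()

does⇒ : ∀ {P : Set} (d : Dec P) → T (does d) → P
does⇒ (yes p) _ = p

⇒does : ∀ {P : Set} (d : Dec P) → P → T (does d)
⇒does (yes _) p = _
⇒does (no ¬p) p = ¬p p

∑-cong : ∀ (xs : List A) {f g : A → ℕ} → (∀ x → f x ≡ g x) → ∑ xs f ≡ ∑ xs g
∑-cong []       h = refl
∑-cong (x ∷ xs) h = cong₂ _+_ (h x) (∑-cong xs h)

∑-mono : ∀ (xs : List A) {f g : A → ℕ} → (∀ x → f x ≤ g x) → ∑ xs f ≤ ∑ xs g
∑-mono []       h = z≤n
∑-mono (x ∷ xs) h = +-mono-≤ (h x) (∑-mono xs h)

interchange : ∀ a b c d → (a + b) + (c + d) ≡ (a + c) + (b + d)
interchange = solve-∀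

∑-+ : ∀ (xs : List A) (f g : A → ℕ) → ∑ xs (λ x → f x + g x) ≡ ∑ xs f + ∑ xs g
∑-+ []       f g = refl
∑-+ (x ∷ xs) f g = trans (cong (f x + g x +_) (∑-+ xs f g))
  (interchange (f x) (g x) (∑ xs f) (∑ xs g))

∑-*ˡ : ∀ (xs : List A) c (f : A → ℕ) → ∑ xs (λ x → c * f x) ≡ c * ∑ xs f
∑-*ˡ []       c f = sym (*-zeroʳ c)
∑-*ˡ (x ∷ xs) c f = trans (cong (c * f x +_) (∑-*ˡ xs c f))
  (sym (*-distribˡ-+ c (f x) (∑ xs f)))

∑-*ʳ : ∀ (xs : List A) c (f : A → ℕ) → ∑ xs (λ x → f x * c) ≡ ∑ xs f * c
∑-*ʳ xs c f = trans (∑-cong xs (λ x → *-comm (f x) c)) (trans (∑-*ˡ xs c f) (*-comm c (∑ xs f)))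

∑-const : ∀ (xs : List A) c → ∑ xs (λ _ → c) ≡ length xs * c
∑-const []       c = refl
∑-const (x ∷ xs) c = cong (c +_) (∑-const xs c)

∑-zero : ∀ (xs : List A) → ∑ xs (λ _ → 0) ≡ 0
∑-zero xs = trans (∑-const xs 0) (*-zeroʳ (length xs))

∑-swap : ∀ (xs : List A) (ys : List B) (f : A → B → ℕ) →
  ∑ xs (λ x → ∑ ys (f x)) ≡ ∑ ys (λ y → ∑ xs (λ x → f x y))
∑-swap []       ys f = sym (∑-zero ys)
∑-swap (x ∷ xs) ys f = trans (cong (∑ ys (f x) +_) (∑-swap xs ys f))
  (sym (∑-+ ys (f x) (λ y → ∑ xs (λ z → f z y))))

∑-++ : ∀ (xs ys : List A) f → ∑ (xs ++ ys) f ≡ ∑ xs f + ∑ ys f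
∑-++ []       ys f = refl
∑-++ (x ∷ xs) ys f = trans (cong (f x +_) (∑-++ xs ys f)) (sym (+-assoc (f x) _ _))

∑-map : ∀ (g : A → B) xs (f : B → ℕ) → ∑ (List.map g xs) f ≡ ∑ xs (f ∘ g)
∑-map g []       f = refl
∑-map g (x ∷ xs) f = cong (f (g x) +_) (∑-map g xs f)

∑-concatMap : ∀ (g : A → List B) xs (f : B → ℕ) →
  ∑ (List.concatMap g xs) f ≡ ∑ xs (λ x → ∑ (g x) f)
∑-concatMap g []       f = refl
∑-concatMap g (x ∷ xs) f = trans (∑-++ (g x) _ f) (cong (∑ (g x) f +_) (∑-concatMap g xs f))

∑-filter : ∀ (p : A → Bool) xs (f : A → ℕ) →
  ∑ (List.filter (T? ∘ p) xs) f ≡ ∑ xs (λ x → 𝟙 (p x) * f x)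
∑-filter p []       f = refl
∑-filter p (x ∷ xs) f with p x
... | true  = cong₂ _+_ (sym (+-identityʳ (f x))) (∑-filter p xs f)
... | false = ∑-filter p xs f

length-filter : ∀ (p : A → Bool) xs → length (List.filter (T? ∘ p) xs) ≡ ∑ xs (𝟙 ∘ p)
length-filter p []       = refl
length-filter p (x ∷ xs) with p x
... | true  = cong suc (length-filter p xs)
... | false = length-filter p xs

≤∑ : ∀ {xs : List A} {x} (f : A → ℕ) → x ∈ xs → f x ≤ ∑ xs f
≤∑ f (here refl)          = m≤m+n _ _
≤∑ f (there {x = y} x∈xs) = ≤-trans (≤∑ f x∈xs) (m≤n+m _ (f y))

∑-pos : ∀ (xs : List A) (f : A → ℕ) → 0 < ∑ xs f → ∃ λ x → 0 < f x
∑-pos (x ∷ xs) f 0<∑ with f x in eq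
... | zero  = ∑-pos xs f 0<∑
... | suc _ = x , subst (0 <_) (sym eq) z<s

average≤ : ∀ (xs : List A) f b → 0 < length xs → ∑ xs f ≤ length xs * b → ∃ λ y → f y ≤ b
average≤ (x ∷ xs) f b _ h with f x ≤? b
... | yes fx≤b = x , fx≤b
average≤ (x ∷ [])     f b _ h | no fx≰b = contradiction
  (subst₂ _≤_ (+-identityʳ _) (+-identityʳ _) h) fx≰b
average≤ (x ∷ y ∷ xs) f b _ h | no fx≰b = average≤ (y ∷ xs) f b z<s
  (+-cancelˡ-≤ b _ _ (≤-trans (+-monoˡ-≤ _ (<⇒≤ (≰⇒> fx≰b))) h))

average≥ : ∀ (xs : List A) f → 0 < ∑ xs f → ∃ λ y → ∑ xs f ≤ length xs * f y
average≥ (x ∷ xs) f 0<∑ with ∑ xs f in eq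
... | zero  = x , +-monoʳ-≤ (f x) z≤n
... | suc s with average≥ xs f (subst (0 <_) (sym eq) z<s)
...   | y , q with subst (_≤ length xs * f y) eq q | ≤-total (f x) (f y)
...     | q′ | inj₁ fx≤fy = y , +-mono-≤ fx≤fy q′
...     | q′ | inj₂ fy≤fx = x , +-monoʳ-≤ (f x) (≤-trans q′ (*-monoʳ-≤ (length xs) fy≤fx))

2mn≤m²+n² : ∀ m n → 2 * (m * n) ≤ m * m + n * n
2mn≤m²+n² m n with ≤-total m n
... | inj₁ m≤n with m≤n⇒∃[o]m+o≡n m≤n
...   | d , refl = subst₂ _≤_ refl (sq m d) (m≤m+n (2 * (m * (m + d))) (d * d))
  where
  sq : ∀ m d → 2 * (m * (m + d)) + d * d ≡ m * m + (m + d) * (m + d)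
  sq = solve-∀
2mn≤m²+n² m n | inj₂ n≤m with m≤n⇒∃[o]m+o≡n n≤m
...   | d , refl = subst₂ _≤_ refl (sq n d) (m≤m+n (2 * ((n + d) * n)) (d * d))
  where
  sq : ∀ n d → 2 * ((n + d) * n) + d * d ≡ (n + d) * (n + d) + n * n
  sq = solve-∀

-- Summing (B d − A)² ≥ 0 against w, where B = ∑ w and A = ∑ w d.
cauchy-schwarz : ∀ (xs : List A) (w d : A → ℕ) →
  ∑ xs (λ x → w x * d x) * ∑ xs (λ x → w x * d x) ≤
  ∑ xs w * ∑ xs (λ x → w x * (d x * d x))
cauchy-schwarz {A} xs w d with ∑ xs w in eqB
... | zero = ≤-reflexive (cong (λ t → t * t) A≡0)
  where
  null : ∀ (ys : List A) → ∑ ys w ≡ 0 → ∑ ys (λ x → w x * d x) ≡ 0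
  null []       _ = refl
  null (y ∷ ys) e = cong₂ _+_ (cong (_* d y) (m+n≡0⇒m≡0 (w y) e)) (null ys (m+n≡0⇒n≡0 (w y) e))
  A≡0 : ∑ xs (λ x → w x * d x) ≡ 0
  A≡0 = null xs eqB
... | B@(suc _) = *-cancelˡ-≤ B (+-cancelʳ-≤ (B * (a * a)) _ _ (begin
    B * (a * a) + B * (a * a)               ≡⟨ e₁ B a ⟩
    a * (2 * (B * a))                       ≡⟨ sym (∑-*ʳ xs _ _) ⟩
    ∑ xs (λ x → w x * d x * (2 * (B * a)))  ≤⟨ ∑-mono xs pointwise ⟩
    ∑ xs (λ x → B * B * (w x * (d x * d x)) + w x * (a * a))
      ≡⟨ ∑-+ xs _ _ ⟩
    ∑ xs (λ x → B * B * (w x * (d x * d x))) + ∑ xs (λ x → w x * (a * a))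
      ≡⟨ cong₂ _+_ (∑-*ˡ xs (B * B) _) (trans (∑-*ʳ xs (a * a) w) (cong (_* (a * a)) eqB)) ⟩
    B * B * c + B * (a * a)                 ≡⟨ cong (_+ B * (a * a)) (*-assoc B B c) ⟩
    B * (B * c) + B * (a * a)               ∎))
  where
  open ≤-Reasoning
  a = ∑ xs (λ x → w x * d x)
  c = ∑ xs (λ x → w x * (d x * d x))
  e₁ : ∀ B a → B * (a * a) + B * (a * a) ≡ a * (2 * (B * a))
  e₁ = solve-∀
  e₂ : ∀ B w d a → w * d * (2 * (B * a)) ≡ w * (2 * ((B * d) * a))
  e₂ = solve-∀
  e₃ : ∀ B w d a → w * ((B * d) * (B * d) + a * a) ≡ B * B * (w * (d * d)) + w * (a * a)
  e₃ = solve-∀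
  pointwise : ∀ x → w x * d x * (2 * (B * a)) ≤ B * B * (w x * (d x * d x)) + w x * (a * a)
  pointwise x = subst₂ _≤_ (sym (e₂ B (w x) (d x) a)) (e₃ B (w x) (d x) a)
    (*-monoʳ-≤ (w x) (2mn≤m²+n² (B * d x) a))

length-allFin : ∀ n → length (allFin n) ≡ n
length-allFin n = List.length-tabulate id

∑-tabulate : ∀ n (g : Fin n → A) f → ∑ (List.tabulate g) f ≡ ∑ (allFin n) (f ∘ g)
∑-tabulate n g f = trans (cong (λ xs → ∑ xs f) (sym (List.map-tabulate id g))) (∑-map g (allFin n) f)

∑-allFin-suc : ∀ n (f : Fin (suc n) → ℕ) →
  ∑ (allFin (suc n)) f ≡ f zero + ∑ (allFin n) (f ∘ suc)
∑-allFin-suc n f = cong (f zero +_) (∑-tabulate n suc f)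

∑-Fin-const : ∀ n c → ∑ (allFin n) (λ _ → c) ≡ n * c
∑-Fin-const n c = trans (∑-const (allFin n) c) (cong (_* c) (length-allFin n))

-- Sums over tuples, and products

vecs : List A → ∀ n → List (Vec A n)
vecs xs zero    = [] ∷ []
vecs xs (suc n) = List.concatMap (λ x → List.map (x ∷_) (vecs xs n)) xs

∑-vecs-suc : ∀ (xs : List A) n f →
  ∑ (vecs xs (suc n)) f ≡ ∑ xs (λ x → ∑ (vecs xs n) (λ y → f (x ∷ y)))
∑-vecs-suc xs n f = trans (∑-concatMap _ xs f) (∑-cong xs (λ x → ∑-map (x ∷_) (vecs xs n) f))

∑1≡length : ∀ (xs : List A) → ∑ xs (λ _ → 1) ≡ length xs
∑1≡length xs = trans (∑-const xs 1) (*-identityʳ (length xs))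

length-vecs : ∀ (xs : List A) n → length (vecs xs n) ≡ length xs ^ n
length-vecs xs zero    = refl
length-vecs xs (suc n) = begin
  length (vecs xs (suc n))                    ≡⟨ sym (∑1≡length (vecs xs (suc n))) ⟩
  ∑ (vecs xs (suc n)) (λ _ → 1)               ≡⟨ ∑-vecs-suc xs n _ ⟩
  ∑ xs (λ _ → ∑ (vecs xs n) (λ _ → 1))        ≡⟨ ∑-const xs _ ⟩
  length xs * ∑ (vecs xs n) (λ _ → 1)         ≡⟨ cong (length xs *_) (∑1≡length (vecs xs n)) ⟩
  length xs * length (vecs xs n)              ≡⟨ cong (length xs *_) (length-vecs xs n) ⟩
  length xs ^ suc n                           ∎
  where open ≡-Reasoning

∈-vecs : ∀ {xs : List A} → (∀ x → x ∈ xs) → ∀ (v : Vec A n) → v ∈ vecs xs n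
∈-vecs full []      = here refl
∈-vecs full (x ∷ v) = ∈.∈-concatMap⁺ _ (Any.map (λ { refl → ∈.∈-map⁺ (x ∷_) (∈-vecs full v) }) (full x))

∑-insertAt : ∀ (xs : List A) n (i : Fin (suc n)) f →
  ∑ (vecs xs (suc n)) f ≡ ∑ xs (λ u → ∑ (vecs xs n) (λ y → f (insertAt y i u)))
∑-insertAt xs n       zero    f = ∑-vecs-suc xs n f
∑-insertAt xs (suc n) (suc i) f = begin
  ∑ (vecs xs (suc (suc n))) f
    ≡⟨ ∑-vecs-suc xs (suc n) f ⟩
  ∑ xs (λ x → ∑ (vecs xs (suc n)) (λ y → f (x ∷ y)))
    ≡⟨ ∑-cong xs (λ x → ∑-insertAt xs n i (λ y → f (x ∷ y))) ⟩
  ∑ xs (λ x → ∑ xs (λ u → ∑ (vecs xs n) (λ y → f (x ∷ insertAt y i u))))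
    ≡⟨ ∑-swap xs xs _ ⟩
  ∑ xs (λ u → ∑ xs (λ x → ∑ (vecs xs n) (λ y → f (x ∷ insertAt y i u))))
    ≡⟨ ∑-cong xs (λ u → sym (∑-vecs-suc xs n _)) ⟩
  ∑ xs (λ u → ∑ (vecs xs (suc n)) (λ y → f (insertAt y (suc i) u)))
    ∎
  where open ≡-Reasoning

-- Overwriting a coordinate forgets its old value, so each vector arises `length xs` times. Hence a
-- random tuple in which an entry is replaced by a random vertex is again uniform.
∑-update : ∀ (xs : List A) n (i : Fin n) f →
  ∑ xs (λ u → ∑ (vecs xs n) (λ z → f (z [ i ]≔ u))) ≡ length xs * ∑ (vecs xs n) f
∑-update xs (suc n) zero f = begin
  ∑ xs (λ u → ∑ (vecs xs (suc n)) (λ z → f (z [ zero ]≔ u)))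
    ≡⟨ ∑-cong xs (λ u → ∑-vecs-suc xs n _) ⟩
  ∑ xs (λ u → ∑ xs (λ x → ∑ (vecs xs n) (λ z → f (u ∷ z))))
    ≡⟨ ∑-cong xs (λ u → ∑-const xs _) ⟩
  ∑ xs (λ u → length xs * ∑ (vecs xs n) (λ z → f (u ∷ z)))
    ≡⟨ ∑-*ˡ xs (length xs) _ ⟩
  length xs * ∑ xs (λ u → ∑ (vecs xs n) (λ z → f (u ∷ z)))
    ≡⟨ cong (length xs *_) (sym (∑-vecs-suc xs n f)) ⟩
  length xs * ∑ (vecs xs (suc n)) f ∎
  where open ≡-Reasoning
∑-update xs (suc n) (suc i) f = begin
  ∑ xs (λ u → ∑ (vecs xs (suc n)) (λ z → f (z [ suc i ]≔ u)))
    ≡⟨ ∑-cong xs (λ u → ∑-vecs-suc xs n _) ⟩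
  ∑ xs (λ u → ∑ xs (λ x → ∑ (vecs xs n) (λ z → f (x ∷ (z [ i ]≔ u)))))
    ≡⟨ ∑-swap xs xs _ ⟩
  ∑ xs (λ x → ∑ xs (λ u → ∑ (vecs xs n) (λ z → f (x ∷ (z [ i ]≔ u)))))
    ≡⟨ ∑-cong xs (λ x → ∑-update xs n i (λ z → f (x ∷ z))) ⟩
  ∑ xs (λ x → length xs * ∑ (vecs xs n) (λ z → f (x ∷ z)))
    ≡⟨ ∑-*ˡ xs (length xs) _ ⟩
  length xs * ∑ xs (λ x → ∑ (vecs xs n) (λ z → f (x ∷ z)))
    ≡⟨ cong (length xs *_) (sym (∑-vecs-suc xs n f)) ⟩
  length xs * ∑ (vecs xs (suc n)) f ∎
  where open ≡-Reasoning

∏ : ∀ n → (Fin n → ℕ) → ℕ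
∏ zero    f = 1
∏ (suc n) f = f zero * ∏ n (f ∘ suc)

∏-cong : ∀ n {f g : Fin n → ℕ} → (∀ i → f i ≡ g i) → ∏ n f ≡ ∏ n g
∏-cong zero    h = refl
∏-cong (suc n) h = cong₂ _*_ (h zero) (∏-cong n (h ∘ suc))

∏-mono : ∀ n {f g : Fin n → ℕ} → (∀ i → f i ≤ g i) → ∏ n f ≤ ∏ n g
∏-mono zero    h = ≤-refl
∏-mono (suc n) h = *-mono-≤ (h zero) (∏-mono n (h ∘ suc))

∏-* : ∀ n (f g : Fin n → ℕ) → ∏ n (λ i → f i * g i) ≡ ∏ n f * ∏ n g
∏-* zero    f g = refl
∏-* (suc n) f g = trans (cong (f zero * g zero *_) (∏-* n (f ∘ suc) (g ∘ suc)))
  (*-interchange (f zero) (g zero) _ _)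
  where
  *-interchange : ∀ a b c d → (a * b) * (c * d) ≡ (a * c) * (b * d)
  *-interchange = solve-∀

∏-const : ∀ n c → ∏ n (λ _ → c) ≡ c ^ n
∏-const zero    c = refl
∏-const (suc n) c = cong (c *_) (∏-const n c)

^-distribʳ-* : ∀ a b k → (a * b) ^ k ≡ a ^ k * b ^ k
^-distribʳ-* a b zero    = refl
^-distribʳ-* a b (suc k) = trans (cong (a * b *_) (^-distribʳ-* a b k)) (rearrange a b (a ^ k) (b ^ k))
  where
  rearrange : ∀ a b c d → (a * b) * (c * d) ≡ (a * c) * (b * d)
  rearrange = solve-∀

∏-^ : ∀ n f k → ∏ n f ^ k ≡ ∏ n (λ i → f i ^ k)
∏-^ zero    f k = ^-zeroˡ k
∏-^ (suc n) f k = trans (^-distribʳ-* (f zero) (∏ n (f ∘ suc)) k) (cong (f zero ^ k *_) (∏-^ n (f ∘ suc) k))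

∏-base^ : ∀ n b (e : Fin n → ℕ) → ∏ n (λ i → b ^ e i) ≡ b ^ ∑ (allFin n) e
∏-base^ zero    b e = refl
∏-base^ (suc n) b e = begin
  b ^ e zero * ∏ n (λ i → b ^ e (suc i))        ≡⟨ cong (b ^ e zero *_) (∏-base^ n b (e ∘ suc)) ⟩
  b ^ e zero * b ^ ∑ (allFin n) (e ∘ suc)       ≡⟨ sym (^-distribˡ-+-* b (e zero) _) ⟩
  b ^ (e zero + ∑ (allFin n) (e ∘ suc))         ≡⟨ cong (b ^_) (sym (∑-allFin-suc n e)) ⟩
  b ^ ∑ (allFin (suc n)) e                      ∎
  where open ≡-Reasoning

-- Distributivity, read as independence of the coordinates; it makes the weighted count of matrices
-- factorise.
∑-∏ : ∀ (xs : List A) n (f : Fin n → A → ℕ) →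
  ∑ (vecs xs n) (λ v → ∏ n (λ i → f i (lookup v i))) ≡ ∏ n (λ i → ∑ xs (f i))
∑-∏ xs zero    f = refl
∑-∏ xs (suc n) f = begin
  ∑ (vecs xs (suc n)) (λ v → ∏ (suc n) (λ i → f i (lookup v i)))
    ≡⟨ ∑-vecs-suc xs n _ ⟩
  ∑ xs (λ x → ∑ (vecs xs n) (λ v → f zero x * ∏ n (λ i → f (suc i) (lookup v i))))
    ≡⟨ ∑-cong xs (λ x → trans (∑-*ˡ (vecs xs n) (f zero x) _)
         (cong (f zero x *_) (∑-∏ xs n (f ∘ suc)))) ⟩
  ∑ xs (λ x → f zero x * ∏ n (λ i → ∑ xs (f (suc i))))
    ≡⟨ ∑-*ʳ xs _ (f zero) ⟩
  ∑ xs (f zero) * ∏ n (λ i → ∑ xs (f (suc i))) ∎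
  where open ≡-Reasoning

-- Cliques and the Moon–Moser inequalities

allᵛ : (A → Bool) → Vec A n → Bool
allᵛ p []      = true
allᵛ p (x ∷ v) = p x ∧ allᵛ p v

allᵛ-lookup : ∀ {p : A → Bool} (v : Vec A n) → T (allᵛ p v) → ∀ i → T (p (lookup v i))
allᵛ-lookup (x ∷ v) t zero    = ∧-fst t
allᵛ-lookup {p = p} (x ∷ v) t (suc i) = allᵛ-lookup v (∧-snd {p x} t) i

allᵛ-intro : ∀ {p : A → Bool} (v : Vec A n) → (∀ i → T (p (lookup v i))) → T (allᵛ p v)
allᵛ-intro []      h = _
allᵛ-intro (x ∷ v) h = ∧-intro (h zero) (allᵛ-intro v (h ∘ suc))

clique : (A → A → Bool) → Vec A n → Bool
clique E []      = true
clique E (x ∷ v) = allᵛ (E x) v ∧ clique E v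

clique-lookup : ∀ {E : A → A → Bool} (v : Vec A n) → T (clique E v) →
  ∀ i j → i Fin.< j → T (E (lookup v i) (lookup v j))
clique-lookup {E = E} (x ∷ v) t zero    (suc j) _         = allᵛ-lookup v (∧-fst t) j
clique-lookup {E = E} (x ∷ v) t (suc i) (suc j) (s≤s i<j) =
  clique-lookup v (∧-snd {allᵛ (E x) v} t) i j i<j

clique-intro : ∀ {E : A → A → Bool} (v : Vec A n) →
  (∀ i j → i Fin.< j → T (E (lookup v i) (lookup v j))) → T (clique E v)
clique-intro []      h = _
clique-intro (x ∷ v) h = ∧-intro (allᵛ-intro v (λ j → h zero (suc j) z<s))
  (clique-intro v (λ i j i<j → h (suc i) (suc j) (s≤s i<j)))

Symm : (A → A → Bool) → Set
Symm E = ∀ x y → E x y ≡ E y x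

clique-≢ : ∀ {E : A → A → Bool} → Symm E → ∀ (v : Vec A n) → T (clique E v) →
  ∀ i j → i ≢ j → T (E (lookup v i) (lookup v j))
clique-≢ sym-E v t i j i≢j with Fin.<-cmp i j
... | tri< i<j _ _ = clique-lookup v t i j i<j
... | tri≈ _ i≡j _ = contradiction i≡j i≢j
... | tri> _ _ j<i = subst T (sym-E _ _) (clique-lookup v t j i j<i)

allᵛ-insertAt : ∀ (p : A → Bool) (y : Vec A n) i u → allᵛ p (insertAt y i u) ≡ p u ∧ allᵛ p y
allᵛ-insertAt p y        zero    u = refl
allᵛ-insertAt p (x ∷ y) (suc i) u rewrite allᵛ-insertAt p y i u with p x | p u
... | true  | _     = refl
... | false | true  = refl
... | false | false = refl

∧-interchange : ∀ a b c d → (a ∧ b) ∧ (c ∧ d) ≡ (a ∧ c) ∧ (b ∧ d)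
∧-interchange false b c     d = refl
∧-interchange true  b true  d = refl
∧-interchange true  false false d = refl
∧-interchange true  true  false d = refl

clique-insertAt : ∀ {E : A → A → Bool} → Symm E → ∀ (y : Vec A n) i u →
  clique E (insertAt y i u) ≡ allᵛ (E u) y ∧ clique E y
clique-insertAt sym-E y       zero    u = refl
clique-insertAt {E = E} sym-E (x ∷ y) (suc i) u
  rewrite allᵛ-insertAt (E x) y i u | clique-insertAt sym-E y i u | sym-E x u
  = ∧-interchange (E u x) (allᵛ (E x) y) (allᵛ (E u) y) (clique E y)

-- Cliques are ordered tuples, and `E` is any relation: containers may have loops, in which case
-- entries of a tuple can repeat.
#cliques : (Fin n → Fin n → Bool) → ℕ → ℕ
#cliques {n} E j = ∑ (vecs (allFin n) j) (𝟙 ∘ clique E)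

#pairs : (Fin n → Fin n → Bool) → ℕ
#pairs {n} E = ∑ (allFin n) (λ u → ∑ (allFin n) (λ v → 𝟙 (E u v)))

-- One failing entry is cured by omitting it, two are not; so a tuple that fails `p` has at most one
-- successful omission.
omit-one : ∀ {j} (p : A → Bool) (x : Vec A (suc j)) →
  ∑ (allFin (suc j)) (λ i → 𝟙 (allᵛ p (removeAt x i))) ≤ 1 + j * 𝟙 (allᵛ p x)
omit-one {j = zero}  p (x ∷ [])  = ≤-refl
omit-one {j = suc j} p (x ∷ v@(_ ∷ _)) = begin
  ∑ (allFin (suc (suc j))) (λ i → 𝟙 (allᵛ p (removeAt (x ∷ v) i)))
    ≡⟨ ∑-allFin-suc (suc j) (λ i → 𝟙 (allᵛ p (removeAt (x ∷ v) i))) ⟩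
  𝟙 (allᵛ p v) + ∑ (allFin (suc j)) (λ i → 𝟙 (p x ∧ allᵛ p (removeAt v i)))
    ≤⟨ bound (p x) ⟩
  1 + suc j * 𝟙 (p x ∧ allᵛ p v) ∎
  where
  open ≤-Reasoning
  bound : ∀ b → 𝟙 (allᵛ p v) + ∑ (allFin (suc j)) (λ i → 𝟙 (b ∧ allᵛ p (removeAt v i)))
    ≤ 1 + suc j * 𝟙 (b ∧ allᵛ p v)
  bound true  = ≤-trans (+-monoʳ-≤ (𝟙 (allᵛ p v)) (omit-one p v))
    (≤-reflexive (+-suc (𝟙 (allᵛ p v)) _))
  bound false = +-mono-≤ (𝟙≤1 (allᵛ p v)) (≤-trans (≤-reflexive (∑-zero (allFin (suc j)))) z≤n)

module _ {n} (E : Fin n → Fin n → Bool) where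
  private
    V = allFin n

  common : ∀ {j} → Vec (Fin n) j → ℕ
  common y = ∑ V (λ v → 𝟙 (allᵛ (E v) y))

  #cliques-suc : ∀ j → #cliques E (suc j) ≡ ∑ (vecs V j) (λ y → 𝟙 (clique E y) * common y)
  #cliques-suc j = begin
    #cliques E (suc j)
      ≡⟨ ∑-vecs-suc V j _ ⟩
    ∑ V (λ v → ∑ (vecs V j) (λ y → 𝟙 (allᵛ (E v) y ∧ clique E y)))
      ≡⟨ ∑-swap V (vecs V j) _ ⟩
    ∑ (vecs V j) (λ y → ∑ V (λ v → 𝟙 (allᵛ (E v) y ∧ clique E y)))
      ≡⟨ ∑-cong (vecs V j) (λ y → trans
           (∑-cong V (λ v → trans (𝟙-∧ (allᵛ (E v) y) _) (*-comm (𝟙 (allᵛ (E v) y)) _)))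
           (∑-*ˡ V (𝟙 (clique E y)) _)) ⟩
    ∑ (vecs V j) (λ y → 𝟙 (clique E y) * common y) ∎
    where open ≡-Reasoning

  #cliques-1 : #cliques E 1 ≡ n
  #cliques-1 = trans (∑-vecs-suc V 0 _) (trans (∑-Fin-const n 1) (*-identityʳ n))

  #cliques-2 : #cliques E 2 ≡ #pairs E
  #cliques-2 = begin
    #cliques E 2
      ≡⟨ ∑-vecs-suc V 1 _ ⟩
    ∑ V (λ x → ∑ (vecs V 1) (λ y → 𝟙 (allᵛ (E x) y ∧ clique E y)))
      ≡⟨ ∑-cong V (λ x → trans (∑-vecs-suc V 0 _) (∑-cong V (λ y → trans (+-identityʳ _)
           (edge (E x y))))) ⟩
    #pairs E ∎
    where
    open ≡-Reasoning
    edge : ∀ b → 𝟙 ((b ∧ true) ∧ true) ≡ 𝟙 b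
    edge true  = refl
    edge false = refl

  -- Count the pairs of a (j+1)-clique x and a vertex v adjacent to all of x but
  -- possibly one vertex: given v, all of x can be omitted in turn if v is
  -- adjacent to x, and at most one vertex of x otherwise.
  moon-moser : Symm E → ∀ j →
    suc j * (#cliques E (suc j) * #cliques E (suc j)) ≤
    #cliques E j * (n * #cliques E (suc j) + j * #cliques E (suc (suc j)))
  moon-moser sym-E j = begin
    suc j * (a₁ * a₁)
      ≡⟨ cong (λ t → suc j * (t * t)) (#cliques-suc j) ⟩
    suc j * (∑ Vⱼ (λ y → 𝟙 (clique E y) * common y) * ∑ Vⱼ (λ y → 𝟙 (clique E y) * common y))
      ≤⟨ *-monoʳ-≤ (suc j) (cauchy-schwarz Vⱼ (𝟙 ∘ clique E) common) ⟩
    suc j * (a₀ * s)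
      ≡⟨ move j a₀ s ⟩
    a₀ * (suc j * s)
      ≤⟨ *-monoʳ-≤ a₀ (≤-trans (≤-reflexive (sym total)) upper) ⟩
    a₀ * (n * a₁ + j * #cliques E (suc (suc j))) ∎
    where
    open ≤-Reasoning
    Vⱼ = vecs V j
    Vⱼ₊₁ = vecs V (suc j)
    a₀ = #cliques E j
    a₁ = #cliques E (suc j)
    s = ∑ Vⱼ (λ y → 𝟙 (clique E y) * (common y * common y))
    move : ∀ j a s → suc j * (a * s) ≡ a * (suc j * s)
    move = solve-∀
    -- A clique with its `i`-th vertex marked is a clique `y` with a common neighbour `u`; summing
    -- over `u` supplies the second factor `common y`.
    fibre : ∀ i → ∑ Vⱼ₊₁ (λ x → 𝟙 (clique E x) * common (removeAt x i)) ≡ s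
    fibre i = begin-equality
      ∑ Vⱼ₊₁ (λ x → 𝟙 (clique E x) * common (removeAt x i))
        ≡⟨ ∑-insertAt V j i _ ⟩
      ∑ V (λ u → ∑ Vⱼ (λ y → 𝟙 (clique E (insertAt y i u)) * common (removeAt (insertAt y i u) i)))
        ≡⟨ ∑-swap V Vⱼ _ ⟩
      ∑ Vⱼ (λ y → ∑ V (λ u → 𝟙 (clique E (insertAt y i u)) * common (removeAt (insertAt y i u) i)))
        ≡⟨ ∑-cong Vⱼ (λ y → begin-equality
             ∑ V (λ u → 𝟙 (clique E (insertAt y i u)) * common (removeAt (insertAt y i u) i))
               ≡⟨ ∑-cong V (λ u → cong₂ _*_
                    (trans (cong 𝟙 (clique-insertAt sym-E y i u)) (𝟙-∧ (allᵛ (E u) y) _))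
                    (cong common (Vec.removeAt-insertAt y i u))) ⟩
             ∑ V (λ u → 𝟙 (allᵛ (E u) y) * 𝟙 (clique E y) * common y)
               ≡⟨ trans (∑-cong V (λ u → *-assoc (𝟙 (allᵛ (E u) y)) _ _)) (∑-*ʳ V _ _) ⟩
             common y * (𝟙 (clique E y) * common y)
               ≡⟨ shuffle (common y) (𝟙 (clique E y)) ⟩
             𝟙 (clique E y) * (common y * common y) ∎) ⟩
      s ∎
      where
      shuffle : ∀ d c → d * (c * d) ≡ c * (d * d)
      shuffle = solve-∀
    total : ∑ Vⱼ₊₁ (λ x → 𝟙 (clique E x) * ∑ (allFin (suc j)) (λ i → common (removeAt x i))) ≡ suc j * s
    total = begin-equality
      ∑ Vⱼ₊₁ (λ x → 𝟙 (clique E x) * ∑ (allFin (suc j)) (λ i → common (removeAt x i)))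
        ≡⟨ ∑-cong Vⱼ₊₁ (λ x → sym (∑-*ˡ (allFin (suc j)) (𝟙 (clique E x)) _)) ⟩
      ∑ Vⱼ₊₁ (λ x → ∑ (allFin (suc j)) (λ i → 𝟙 (clique E x) * common (removeAt x i)))
        ≡⟨ ∑-swap Vⱼ₊₁ (allFin (suc j)) _ ⟩
      ∑ (allFin (suc j)) (λ i → ∑ Vⱼ₊₁ (λ x → 𝟙 (clique E x) * common (removeAt x i)))
        ≡⟨ trans (∑-cong (allFin (suc j)) fibre) (∑-Fin-const (suc j) s) ⟩
      suc j * s ∎
    omitted : ∀ x → ∑ (allFin (suc j)) (λ i → common (removeAt x i)) ≤ n + j * common x
    omitted x = begin
      ∑ (allFin (suc j)) (λ i → common (removeAt x i))
        ≡⟨ ∑-swap (allFin (suc j)) V _ ⟩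
      ∑ V (λ v → ∑ (allFin (suc j)) (λ i → 𝟙 (allᵛ (E v) (removeAt x i))))
        ≤⟨ ∑-mono V (λ v → omit-one (E v) x) ⟩
      ∑ V (λ v → 1 + j * 𝟙 (allᵛ (E v) x))
        ≡⟨ trans (∑-+ V (λ _ → 1) _) (cong₂ _+_
             (trans (∑-Fin-const n 1) (*-identityʳ n)) (∑-*ˡ V j _)) ⟩
      n + j * common x ∎
    expand : ∀ c n j d → c * (n + j * d) ≡ n * c + j * (c * d)
    expand = solve-∀
    upper : ∑ Vⱼ₊₁ (λ x → 𝟙 (clique E x) * ∑ (allFin (suc j)) (λ i → common (removeAt x i)))
      ≤ n * a₁ + j * #cliques E (suc (suc j))
    upper = begin
      ∑ Vⱼ₊₁ (λ x → 𝟙 (clique E x) * ∑ (allFin (suc j)) (λ i → common (removeAt x i)))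
        ≤⟨ ∑-mono Vⱼ₊₁ (λ x → *-monoʳ-≤ (𝟙 (clique E x)) (omitted x)) ⟩
      ∑ Vⱼ₊₁ (λ x → 𝟙 (clique E x) * (n + j * common x))
        ≡⟨ trans (∑-cong Vⱼ₊₁ (λ x → expand (𝟙 (clique E x)) n j (common x)))
             (trans (∑-+ Vⱼ₊₁ _ _) (cong₂ _+_ (∑-*ˡ Vⱼ₊₁ n _) (∑-*ˡ Vⱼ₊₁ j _))) ⟩
      n * a₁ + j * ∑ Vⱼ₊₁ (λ x → 𝟙 (clique E x) * common x)
        ≡⟨ cong (λ t → n * a₁ + j * t) (sym (#cliques-suc (suc j))) ⟩
      n * a₁ + j * #cliques E (suc (suc j)) ∎

  -- In terms of the clique densities ρⱼ = aⱼ₊₁ / (n aⱼ): 1 − ρⱼ ≤ j (s / t)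
  -- as soon as 1 − ρ₁ ≤ s / t.
  clique-ratio : Symm E → ∀ s t → t * (n * n) ≤ t * #pairs E + s * (n * n) → ∀ j →
    t * (n * #cliques E (suc j)) ≤ t * #cliques E (suc (suc j)) + suc j * (s * (n * #cliques E (suc j)))
  clique-ratio sym-E s t h zero
    rewrite #cliques-2 | #cliques-1 | +-identityʳ (s * (n * n)) = h
  clique-ratio sym-E s t h (suc i) = step (#cliques E (suc i)) (#cliques E (suc (suc i)))
    (#cliques E (suc (suc (suc i)))) (clique-ratio sym-E s t h i) (moon-moser sym-E (suc i))
    where
    step : ∀ a b c → t * (n * a) ≤ t * b + suc i * (s * (n * a)) →
      suc (suc i) * (b * b) ≤ a * (n * b + suc i * c) →
      t * (n * b) ≤ t * c + suc (suc i) * (s * (n * b))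
    step zero zero c _ _ = ≤-trans (≤-reflexive (trans (cong (t *_) (*-zeroʳ n)) (*-zeroʳ t))) z≤n
    -- Scaling `h₁` by (i + 2) b produces b², which Moon-Moser bounds; once the common term is
    -- cancelled, (i + 1) a divides both sides.
    step a@(suc _) b c h₁ h₂ = *-cancelˡ-≤ (suc i * a) (+-cancelʳ-≤ (t * (n * b) * a) _ _ (begin
      suc i * a * (t * (n * b)) + t * (n * b) * a
        ≡⟨ e₁ i a b t n ⟩
      suc (suc i) * b * (t * (n * a))
        ≤⟨ *-monoʳ-≤ (suc (suc i) * b) h₁ ⟩
      suc (suc i) * b * (t * b + suc i * (s * (n * a)))
        ≡⟨ e₂ i a b t n s ⟩
      t * (suc (suc i) * (b * b)) + suc i * a * (suc (suc i) * (s * (n * b)))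
        ≤⟨ +-monoˡ-≤ _ (*-monoʳ-≤ t h₂) ⟩
      t * (a * (n * b + suc i * c)) + suc i * a * (suc (suc i) * (s * (n * b)))
        ≡⟨ e₃ i a b c t n s ⟩
      suc i * a * (t * c + suc (suc i) * (s * (n * b))) + t * (n * b) * a ∎))
      where
      open ≤-Reasoning
      e₁ : ∀ i a b t n → suc i * a * (t * (n * b)) + t * (n * b) * a ≡ suc (suc i) * b * (t * (n * a))
      e₁ = solve-∀
      e₂ : ∀ i a b t n s → suc (suc i) * b * (t * b + suc i * (s * (n * a))) ≡
        t * (suc (suc i) * (b * b)) + suc i * a * (suc (suc i) * (s * (n * b)))
      e₂ = solve-∀
      e₃ : ∀ i a b c t n s → t * (a * (n * b + suc i * c)) + suc i * a * (suc (suc i) * (s * (n * b))) ≡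
        suc i * a * (t * c + suc (suc i) * (s * (n * b))) + t * (n * b) * a
      e₃ = solve-∀

  -- By `clique-ratio`, consecutive clique counts have ratio at least n (1 - j s/t) for some j ≤ p.
  -- As p s < t, the bracket is a positive multiple of 1/t.
  many-cliques : Symm E → ∀ p s t → p * s < t → t * (n * n) ≤ t * #pairs E + s * (n * n) →
    ∀ j → j ≤ p → n ^ suc j ≤ t ^ j * #cliques E (suc j)
  many-cliques sym-E p s t ps<t h zero    _   = ≤-reflexive (trans (*-identityʳ n)
    (sym (trans (*-identityˡ _) #cliques-1)))
  many-cliques sym-E p s t ps<t h (suc j) j<p = begin
    n * n ^ suc j             ≤⟨ *-monoʳ-≤ n (many-cliques sym-E p s t ps<t h j (<⇒≤ j<p)) ⟩
    n * (t ^ j * a)           ≡⟨ e₁ n (t ^ j) a ⟩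
    t ^ j * (n * a)           ≤⟨ *-monoʳ-≤ (t ^ j) ratio ⟩
    t ^ j * (t * b)           ≡⟨ e₂ (t ^ j) t b ⟩
    t * t ^ j * b             ∎
    where
    open ≤-Reasoning
    a = #cliques E (suc j)
    b = #cliques E (suc (suc j))
    e₁ : ∀ n u a → n * (u * a) ≡ u * (n * a)
    e₁ = solve-∀
    e₂ : ∀ u t b → u * (t * b) ≡ t * u * b
    e₂ = solve-∀
    e₃ : ∀ x y → x + y * x ≡ suc y * x
    e₃ = solve-∀
    ratio : n * a ≤ t * b
    ratio = +-cancelʳ-≤ (p * s * (n * a)) _ _ (begin
      n * a + p * s * (n * a)              ≡⟨ e₃ (n * a) (p * s) ⟩
      suc (p * s) * (n * a)                ≤⟨ *-monoˡ-≤ (n * a) ps<t ⟩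
      t * (n * a)                          ≤⟨ clique-ratio sym-E s t h j ⟩
      t * b + suc j * (s * (n * a))        ≤⟨ +-monoʳ-≤ (t * b) (≤-trans
                                                (*-monoˡ-≤ (s * (n * a)) j<p)
                                                (≤-reflexive (sym (*-assoc p s (n * a))))) ⟩
      t * b + p * s * (n * a)              ∎)

-- Sampled containers for cliques

∑ᵛ : (A → ℕ) → Vec A n → ℕ
∑ᵛ g []      = 0
∑ᵛ g (z ∷ v) = g z + ∑ᵛ g v

-- Linearity of expectation for `c` independent samples; the factor `length xs` avoids an exponent c
-- - 1.
∑-∑ᵛ : ∀ (xs : List A) c g →
  length xs * ∑ (vecs xs c) (∑ᵛ g) ≡ c * (length xs ^ c * ∑ xs g)
∑-∑ᵛ xs zero    g = *-zeroʳ (length xs)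
∑-∑ᵛ xs (suc c) g = begin
  t * ∑ (vecs xs (suc c)) (∑ᵛ g)
    ≡⟨ cong (t *_) (∑-vecs-suc xs c _) ⟩
  t * ∑ xs (λ z → ∑ (vecs xs c) (λ v → g z + ∑ᵛ g v))
    ≡⟨ cong (t *_) (∑-cong xs (λ z → trans (∑-+ (vecs xs c) _ _)
         (cong (_+ s) (trans (∑-const (vecs xs c) (g z)) (cong (_* g z) (length-vecs xs c)))))) ⟩
  t * ∑ xs (λ z → t ^ c * g z + s)
    ≡⟨ cong (t *_) (trans (∑-+ xs _ _) (cong₂ _+_ (∑-*ˡ xs (t ^ c) g) (∑-const xs s))) ⟩
  t * (t ^ c * ∑ xs g + t * s)
    ≡⟨ cong (λ u → t * (t ^ c * ∑ xs g + u)) (∑-∑ᵛ xs c g) ⟩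
  t * (t ^ c * ∑ xs g + c * (t ^ c * ∑ xs g))
    ≡⟨ e t (t ^ c) (∑ xs g) c ⟩
  suc c * (t * t ^ c * ∑ xs g) ∎
  where
  open ≡-Reasoning
  t = length xs
  s = ∑ (vecs xs c) (∑ᵛ g)
  e : ∀ t u g c → t * (u * g + c * (u * g)) ≡ suc c * (t * u * g)
  e = solve-∀

∑-allᵛ : ∀ (xs : List A) c (q : A → Bool) →
  ∑ (vecs xs c) (𝟙 ∘ allᵛ q) ≡ ∑ xs (𝟙 ∘ q) ^ c
∑-allᵛ xs zero    q = refl
∑-allᵛ xs (suc c) q = begin
  ∑ (vecs xs (suc c)) (𝟙 ∘ allᵛ q)
    ≡⟨ ∑-vecs-suc xs c _ ⟩
  ∑ xs (λ z → ∑ (vecs xs c) (λ v → 𝟙 (q z ∧ allᵛ q v)))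
    ≡⟨ ∑-cong xs (λ z → trans (∑-cong (vecs xs c) (λ v → 𝟙-∧ (q z) _)) (∑-*ˡ (vecs xs c) (𝟙 (q z)) _)) ⟩
  ∑ xs (λ z → 𝟙 (q z) * ∑ (vecs xs c) (𝟙 ∘ allᵛ q))
    ≡⟨ ∑-*ʳ xs _ _ ⟩
  ∑ xs (𝟙 ∘ q) * ∑ (vecs xs c) (𝟙 ∘ allᵛ q)
    ≡⟨ cong (∑ xs (𝟙 ∘ q) *_) (∑-allᵛ xs c q) ⟩
  ∑ xs (𝟙 ∘ q) ^ suc c ∎
  where open ≡-Reasoning

-- Two terms of the binomial expansion. As a probability: in c + 1 independent trials, `c` failures
-- followed by a success have probability at most 1/(c + 1), because the c + 1 positions of a sole
-- success are equally likely.
bernoulli : ∀ d e c → suc c * (d * e ^ c) + e ^ suc c ≤ (d + e) ^ suc c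
bernoulli d e zero    = ≤-reflexive (lhs d e)
  where
  lhs : ∀ d e → 1 * (d * 1) + e * 1 ≡ (d + e) * 1
  lhs = solve-∀
bernoulli d e (suc c) = begin
  suc (suc c) * (d * (e * e ^ c)) + e * (e * e ^ c)
    ≤⟨ m≤n+m _ (d * (suc c * (d * e ^ c))) ⟩
  d * (suc c * (d * e ^ c)) + (suc (suc c) * (d * (e * e ^ c)) + e * (e * e ^ c))
    ≡⟨ e₁ d e (e ^ c) c ⟩
  (d + e) * (suc c * (d * e ^ c) + e * e ^ c)
    ≤⟨ *-monoʳ-≤ (d + e) (bernoulli d e c) ⟩
  (d + e) ^ suc (suc c) ∎
  where
  open ≤-Reasoning
  e₁ : ∀ d e u c → d * (suc c * (d * u)) + (suc (suc c) * (d * (e * u)) + e * (e * u)) ≡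
    (d + e) * (suc c * (d * u) + e * u)
  e₁ = solve-∀

complement : ∀ (xs : List A) p → ∑ xs (𝟙 ∘ p) + ∑ xs (𝟙 ∘ not ∘ p) ≡ length xs
complement xs p = trans (sym (∑-+ xs _ _)) (trans (∑-cong xs (λ x → one (p x))) (∑1≡length xs))
  where
  one : ∀ b → 𝟙 b + 𝟙 (not b) ≡ 1
  one true  = refl
  one false = refl

Edges : ℕ → Set
Edges r = List (Fin r × Fin r)

Increasing : ∀ {r} → Fin r × Fin r → Set
Increasing (a , b) = a Fin.< b

sat : ∀ {r} → (A → A → Bool) → Edges r → Vec A r → Bool
sat E []             z = true
sat E ((a , b) ∷ es) z = E (lookup z a) (lookup z b) ∧ sat E es z

sat-mono : ∀ {r} {E F : A → A → Bool} → (∀ x y → T (E x y) → T (F x y)) →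
  ∀ (es : Edges r) z → T (sat E es z) → T (sat F es z)
sat-mono h []             z t = _
sat-mono {E = E} h ((a , b) ∷ es) z t = ∧-intro (h _ _ (∧-fst t))
  (sat-mono h es z (∧-snd {E (lookup z a) (lookup z b)} t))

clique⇒sat : ∀ {r} {E : A → A → Bool} (es : Edges r) → All Increasing es → ∀ z →
  T (clique E z) → T (sat E es z)
clique⇒sat []             _            z t = _
clique⇒sat ((a , b) ∷ es) (a<b ∷ incs) z t =
  ∧-intro (clique-lookup z t a b a<b) (clique⇒sat es incs z t)

sat-∈ : ∀ {r} {E : A → A → Bool} {es : Edges r} {a b} z → T (sat E es z) → (a , b) ∈ es →
  T (E (lookup z a) (lookup z b))
sat-∈ z t (here refl) = ∧-fst t
sat-∈ {E = E} {es = (a , b) ∷ _} z t (there e∈es) =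
  sat-∈ z (∧-snd {E (lookup z a) (lookup z b)} t) e∈es

increasing? : ∀ {r} → Fin r × Fin r → Bool
increasing? (a , b) = does (a Fin.<? b)

allEdges : ∀ r → Edges r
allEdges r = List.filter (T? ∘ increasing?) (List.cartesianProduct (allFin r) (allFin r))

∈-allEdges : ∀ {r} (a b : Fin r) → a Fin.< b → (a , b) ∈ allEdges r
∈-allEdges a b a<b = ∈.∈-filter⁺ (T? ∘ increasing?)
  (∈.∈-cartesianProduct⁺ (∈.∈-allFin a) (∈.∈-allFin b)) (⇒does (a Fin.<? b) a<b)

allEdges-increasing : ∀ r → All Increasing (allEdges r)
allEdges-increasing r = All.map (λ {e} t → does⇒ (proj₁ e Fin.<? proj₂ e) t)
  (All.all-filter (T? ∘ increasing?) (List.cartesianProduct (allFin r) (allFin r)))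

allEdges-unique : ∀ r → Unique (allEdges r)
allEdges-unique r = Unique.filter⁺ (T? ∘ increasing?)
  (Unique.cartesianProduct⁺ (Unique.allFin⁺ r) (Unique.allFin⁺ r))

-- Vertices recorded while `q` pattern edges are replaced. An edge with `q` edges behind it takes 2
-- D′ tuples of `r` vertices, where D′ = `D₁ * (4 * D) ^ q` is the sparsity that the later edges
-- require.
#sampled : ℕ → ℕ → ℕ → ℕ → ℕ
#sampled r D D₁ zero    = 0
#sampled r D D₁ (suc q) = 2 * (D₁ * (4 * D) ^ q) * r + #sampled r D D₁ q

module Container {n r : ℕ} (G : Fin n → Fin n → Bool) (sym-G : Symm G) where
  private
    V = allFin n
    Vʳ = vecs V r

  Similar : List (Fin n) → Fin n → Fin n → Set
  Similar S x y = All (λ v → G v x ≡ G v y) S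

  similar-refl : ∀ S x → Similar S x x
  similar-refl S x = All.universal (λ _ → refl) S

  Measurable : ∀ {B : Set} → List (Fin n) → (Fin n → Fin n → B) → Set
  Measurable S C = ∀ {x x′ y y′} → Similar S x x′ → Similar S y y′ → C x y ≡ C x′ y′

  -- Copies of the pattern in a mixture of two relations, interpolating between the cliques of `G`
  -- and those of the container.
  #sat : (Fin n → Fin n → Bool) → Edges r → Edges r → ℕ
  #sat C P Q = ∑ Vʳ (λ z → 𝟙 (sat C P z ∧ sat G Q z))

  T-size : length Vʳ ≡ n ^ r
  T-size = trans (length-vecs V r) (cong (_^ r) (length-allFin n))

  module Step (C : Fin n → Fin n → Bool) (sym-C : Symm C) (P Q : Edges r)
              (a b : Fin r) (a<b : a Fin.< b) where

    a≢b : a ≢ b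
    a≢b = Fin.<⇒≢ a<b

    rest : Vec (Fin n) r → Bool
    rest z = sat C P z ∧ sat G Q z

    put : Vec (Fin n) r → Fin n → Fin n → Vec (Fin n) r
    put z x y = (z [ a ]≔ x) [ b ]≔ y

    put-a : ∀ z x y → lookup (put z x y) a ≡ x
    put-a z x y = trans (Vec.lookup∘update′ a≢b (z [ a ]≔ x) y) (Vec.lookup∘update a z x)

    put-b : ∀ z x y → lookup (put z x y) b ≡ y
    put-b z x y = Vec.lookup∘update b (z [ a ]≔ x) y

    put-other : ∀ z x y {c} → c ≢ a → c ≢ b → lookup (put z x y) c ≡ lookup z c
    put-other z x y c≢a c≢b = trans (Vec.lookup∘update′ c≢b (z [ a ]≔ x) y)
      (Vec.lookup∘update′ c≢a z x)

    ∑-put : ∀ (Φ : Fin n → Fin n → Vec (Fin n) r → ℕ) →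
      ∑ V (λ x → ∑ V (λ y → ∑ Vʳ (λ z → Φ x y (put z x y)))) ≡
      n * (n * ∑ Vʳ (λ z → Φ (lookup z a) (lookup z b) z))
    ∑-put Φ = begin
      ∑ V (λ x → ∑ V (λ y → ∑ Vʳ (λ z → Φ x y (put z x y))))
        ≡⟨ ∑-cong V (λ x → ∑-cong V (λ y → ∑-cong Vʳ (λ z →
             cong₂ (λ u v → Φ u v (put z x y)) (sym (put-a z x y)) (sym (put-b z x y))))) ⟩
      ∑ V (λ x → ∑ V (λ y → ∑ Vʳ (λ z → F (put z x y))))
        ≡⟨ ∑-swap V V _ ⟩
      ∑ V (λ y → ∑ V (λ x → ∑ Vʳ (λ z → F (put z x y))))
        ≡⟨ ∑-cong V (λ y → ∑-update V r a (λ z → F (z [ b ]≔ y))) ⟩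
      ∑ V (λ y → length V * ∑ Vʳ (λ z → F (z [ b ]≔ y)))
        ≡⟨ ∑-*ˡ V (length V) _ ⟩
      length V * ∑ V (λ y → ∑ Vʳ (λ z → F (z [ b ]≔ y)))
        ≡⟨ cong (length V *_) (∑-update V r b F) ⟩
      length V * (length V * ∑ Vʳ F)
        ≡⟨ cong (λ t → t * (t * ∑ Vʳ F)) (length-allFin n) ⟩
      n * (n * ∑ Vʳ F) ∎
      where
      open ≡-Reasoning
      F : Vec (Fin n) r → ℕ
      F z = Φ (lookup z a) (lookup z b) z

    hits : Vec (Fin n) r → Fin n → Fin n → Bool
    hits z x y = rest (put z x y)

    -- The pairs that no sampled tuple completes will form the new container. Most edges of `G` are
    -- among them because copies of the pattern are rare, while a pair with many completions is
    -- likely to be hit.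
    missed : ∀ {c} → Vec (Vec (Fin n) r) c → Fin n → Fin n → Bool
    missed ζ x y = allᵛ (λ z → not (hits z x y)) ζ

    #lost : ∀ {c} → Vec (Vec (Fin n) r) c → ℕ
    #lost ζ = #pairs (λ x y → G x y ∧ not (missed ζ x y))

    #left : ∀ {c} → Vec (Vec (Fin n) r) c → ℕ
    #left ζ = ∑ Vʳ (λ z → 𝟙 (missed ζ (lookup z a) (lookup z b) ∧ rest z))

    private
      N = #sat C P ((a , b) ∷ Q)

      hitG : Vec (Fin n) r → ℕ
      hitG z = #pairs (λ x y → G x y ∧ hits z x y)

      #lost≤ : ∀ {c} (ζ : Vec (Vec (Fin n) r) c) → #lost ζ ≤ ∑ᵛ hitG ζ
      #lost≤ []      = ≤-reflexive (trans (∑-cong V (λ x → trans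
        (∑-cong V (λ y → 𝟙-false (λ t → ∧-snd {G x y} t))) (∑-zero V))) (∑-zero V))
      #lost≤ (z ∷ ζ) = ≤-trans
        (∑-mono V (λ x → ≤-trans (∑-mono V (λ y → split (G x y) (hits z x y) (missed ζ x y)))
          (≤-reflexive (∑-+ V _ _))))
        (≤-trans (≤-reflexive (∑-+ V _ _)) (+-monoʳ-≤ (hitG z) (#lost≤ ζ)))
        where
        split : ∀ g h m → 𝟙 (g ∧ not (not h ∧ m)) ≤ 𝟙 (g ∧ h) + 𝟙 (g ∧ not m)
        split false h     m = z≤n
        split true  true  m = m≤m+n 1 _
        split true  false m = ≤-refl

      -- An edge of `G` with a tuple completing it is a copy of the whole pattern together with the
      -- two entries that `put` has overwritten, hence n².
      ∑-hitG : ∑ Vʳ hitG ≡ n * (n * N)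
      ∑-hitG = begin
        ∑ Vʳ hitG
          ≡⟨ ∑-swap Vʳ V _ ⟩
        ∑ V (λ x → ∑ Vʳ (λ z → ∑ V (λ y → 𝟙 (G x y ∧ hits z x y))))
          ≡⟨ ∑-cong V (λ x → ∑-swap Vʳ V _) ⟩
        ∑ V (λ x → ∑ V (λ y → ∑ Vʳ (λ z → 𝟙 (G x y ∧ rest (put z x y)))))
          ≡⟨ ∑-put (λ x y z → 𝟙 (G x y ∧ rest z)) ⟩
        n * (n * ∑ Vʳ (λ z → 𝟙 (G (lookup z a) (lookup z b) ∧ rest z)))
          ≡⟨ cong (λ t → n * (n * t)) (∑-cong Vʳ (λ z →
               cong 𝟙 (swap-∧ (G (lookup z a) (lookup z b)) (sat C P z) (sat G Q z)))) ⟩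
        n * (n * N) ∎
        where
        open ≡-Reasoning
        swap-∧ : ∀ g p q → g ∧ (p ∧ q) ≡ p ∧ (g ∧ q)
        swap-∧ g     true  q = refl
        swap-∧ true  false q = refl
        swap-∧ false false q = refl

      samples : ∀ c → List (Vec (Vec (Fin n) r) c)
      samples c = vecs Vʳ c

      ∑-#lost : ∀ c → n ^ r * ∑ (samples c) #lost ≤ c * ((n ^ r) ^ c * (n * (n * N)))
      ∑-#lost c = begin
        n ^ r * ∑ (samples c) #lost            ≤⟨ *-monoʳ-≤ (n ^ r) (∑-mono (samples c) #lost≤) ⟩
        n ^ r * ∑ (samples c) (∑ᵛ hitG)        ≡⟨ cong (_* ∑ (samples c) (∑ᵛ hitG)) (sym T-size) ⟩
        length Vʳ * ∑ (samples c) (∑ᵛ hitG)    ≡⟨ ∑-∑ᵛ Vʳ c hitG ⟩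
        c * (length Vʳ ^ c * ∑ Vʳ hitG)        ≡⟨ cong₂ (λ t u → c * (t ^ c * u)) T-size ∑-hitG ⟩
        c * ((n ^ r) ^ c * (n * (n * N)))      ∎
        where open ≤-Reasoning

      -- A tuple is left if it would hit its own pair while all samples miss that pair: `c` failures
      -- and a success, as in `bernoulli`.
      ∑-#left : ∀ c → suc c * (n * (n * ∑ (samples c) #left)) ≤ n * (n * (n ^ r) ^ suc c)
      ∑-#left c = begin
        suc c * (n * (n * ∑ (samples c) #left))
          ≡⟨ cong (suc c *_) (trans (cong (n *_) (sym (∑-*ˡ (samples c) n #left)))
               (sym (∑-*ˡ (samples c) n _))) ⟩
        suc c * ∑ (samples c) (λ ζ → n * (n * #left ζ))
          ≡⟨ cong (suc c *_) (∑-cong (samples c) (λ ζ →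
               sym (∑-put (λ x y z → 𝟙 (missed ζ x y ∧ rest z))))) ⟩
        suc c * ∑ (samples c) (λ ζ → ∑ V (λ x → ∑ V (λ y → ∑ Vʳ (λ z → 𝟙 (missed ζ x y ∧ hits z x y)))))
          ≡⟨ cong (suc c *_) (trans (∑-swap (samples c) V _) (∑-cong V (λ x →
               trans (∑-swap (samples c) V _) (∑-cong V (λ y → inner x y))))) ⟩
        suc c * ∑ V (λ x → ∑ V (λ y → d x y * e x y ^ c))
          ≡⟨ trans (sym (∑-*ˡ V (suc c) _)) (∑-cong V (λ x → sym (∑-*ˡ V (suc c) _))) ⟩
        ∑ V (λ x → ∑ V (λ y → suc c * (d x y * e x y ^ c)))
          ≤⟨ ∑-mono V (λ x → ∑-mono V (λ y → bound x y)) ⟩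
        ∑ V (λ x → ∑ V (λ y → (n ^ r) ^ suc c))
          ≡⟨ trans (∑-cong V (λ x → ∑-Fin-const n _)) (∑-Fin-const n _) ⟩
        n * (n * (n ^ r) ^ suc c) ∎
        where
        open ≤-Reasoning
        d e : Fin n → Fin n → ℕ
        d x y = ∑ Vʳ (λ z → 𝟙 (hits z x y))
        e x y = ∑ Vʳ (λ z → 𝟙 (not (hits z x y)))
        inner : ∀ x y → ∑ (samples c) (λ ζ → ∑ Vʳ (λ z → 𝟙 (missed ζ x y ∧ hits z x y))) ≡ d x y * e x y ^ c
        inner x y = begin-equality
          ∑ (samples c) (λ ζ → ∑ Vʳ (λ z → 𝟙 (missed ζ x y ∧ hits z x y)))
            ≡⟨ ∑-cong (samples c) (λ ζ → trans (∑-cong Vʳ (λ z → 𝟙-∧ (missed ζ x y) _))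
                 (trans (∑-*ˡ Vʳ (𝟙 (missed ζ x y)) _) (*-comm (𝟙 (missed ζ x y)) _))) ⟩
          ∑ (samples c) (λ ζ → d x y * 𝟙 (missed ζ x y))
            ≡⟨ ∑-*ˡ (samples c) (d x y) _ ⟩
          d x y * ∑ (samples c) (λ ζ → 𝟙 (missed ζ x y))
            ≡⟨ cong (d x y *_) (∑-allᵛ Vʳ c (λ z → not (hits z x y))) ⟩
          d x y * e x y ^ c ∎
        bound : ∀ x y → suc c * (d x y * e x y ^ c) ≤ (n ^ r) ^ suc c
        bound x y = begin
          suc c * (d x y * e x y ^ c)                        ≤⟨ m≤m+n _ _ ⟩
          suc c * (d x y * e x y ^ c) + e x y ^ suc c        ≤⟨ bernoulli (d x y) (e x y) c ⟩
          (d x y + e x y) ^ suc c                            ≡⟨ cong (_^ suc c) (trans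
                                                                 (complement Vʳ (λ z → hits z x y)) T-size) ⟩
          (n ^ r) ^ suc c                                    ∎

    -- First moment. For c = 2 D′ samples, the mean of `#lost` is at most n²/(2 D), by the
    -- hypothesis with its constant 4 = 2 · 2, and the mean of `#left` is at most n^r/(2 D′), since
    -- 2 D′ ≤ c + 1. Some sample keeps the sum of both normalised quantities at most 1.
    sample-exists : ∀ D D′ → 0 < n → N * (4 * (D′ * D)) ≤ n ^ r →
      ∃ λ (ζ : Vec (Vec (Fin n) r) (2 * D′)) → #lost ζ * D ≤ n * n × #left ζ * D′ ≤ n ^ r
    sample-exists D D′ 0<n few =
      proj₁ good ,
      *-cancelʳ-≤ _ _ (n ^ r) {{>-nonZero T>0}} (≤-trans (m≤m+n _ _) (proj₂ good)) ,
      *-cancelʳ-≤ _ _ (n * n) {{>-nonZero n²>0}} (≤-trans (m≤n+m _ _)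
        (≤-trans (proj₂ good) (≤-reflexive (*-comm (n * n) (n ^ r)))))
      where
      open ≤-Reasoning
      T>0 : 0 < n ^ r
      T>0 = m^n>0 n {{>-nonZero 0<n}} r
      n²>0 : 0 < n * n
      n²>0 = *-mono-≤ 0<n 0<n
      c = 2 * D′
      U = (n ^ r) ^ c
      len : length (samples c) ≡ U
      len = trans (length-vecs Vʳ c) (cong (_^ c) T-size)
      τ = n ^ r
      f : Vec (Vec (Fin n) r) c → ℕ
      f ζ = #lost ζ * D * τ + #left ζ * D′ * (n * n)
      X = ∑ (samples c) #lost
      Y = ∑ (samples c) #left
      e₁ : ∀ X D τ → 2 * (X * D * τ) ≡ 2 * D * (τ * X)
      e₁ = solve-∀
      e₂ : ∀ D D′ U n N → 2 * D * (2 * D′ * (U * (n * (n * N)))) ≡ (U * (n * n)) * (N * (4 * (D′ * D)))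
      e₂ = solve-∀
      lostBound : 2 * (X * D * τ) ≤ U * (n * n * τ)
      lostBound = begin
        2 * (X * D * τ)                               ≡⟨ e₁ X D τ ⟩
        2 * D * (τ * X)                               ≤⟨ *-monoʳ-≤ (2 * D) (∑-#lost c) ⟩
        2 * D * (2 * D′ * (U * (n * (n * N))))        ≡⟨ e₂ D D′ U n N ⟩
        (U * (n * n)) * (N * (4 * (D′ * D)))          ≤⟨ *-monoʳ-≤ (U * (n * n)) few ⟩
        (U * (n * n)) * τ                             ≡⟨ *-assoc U (n * n) τ ⟩
        U * (n * n * τ)                               ∎
      e₃ : ∀ Y D′ n → 2 * (Y * D′ * (n * n)) ≡ 2 * D′ * (n * (n * Y))
      e₃ = solve-∀
      e₄ : ∀ n τ U → n * (n * (τ * U)) ≡ U * (n * n * τ)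
      e₄ = solve-∀
      leftBound : 2 * (Y * D′ * (n * n)) ≤ U * (n * n * τ)
      leftBound = begin
        2 * (Y * D′ * (n * n))                        ≡⟨ e₃ Y D′ n ⟩
        2 * D′ * (n * (n * Y))                        ≤⟨ *-monoˡ-≤ (n * (n * Y)) (n≤1+n c) ⟩
        suc c * (n * (n * Y))                         ≤⟨ ∑-#left c ⟩
        n * (n * (τ * U))                             ≡⟨ e₄ n τ U ⟩
        U * (n * n * τ)                               ∎
      ∑f : ∑ (samples c) f ≡ X * D * τ + Y * D′ * (n * n)
      ∑f = trans (∑-+ (samples c) _ _) (cong₂ _+_
        (trans (∑-*ʳ (samples c) τ _) (cong (_* τ) (∑-*ʳ (samples c) D #lost)))
        (trans (∑-*ʳ (samples c) (n * n) _) (cong (_* (n * n)) (∑-*ʳ (samples c) D′ #left))))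
      e₅ : ∀ a b → 2 * (a + b) ≡ 2 * a + 2 * b
      e₅ = solve-∀
      e₆ : ∀ u → u + u ≡ 2 * u
      e₆ = solve-∀
      good : ∃ λ ζ → f ζ ≤ n * n * τ
      good = average≤ (samples c) f (n * n * τ)
        (subst (0 <_) (sym len) (m^n>0 τ {{>-nonZero T>0}} c))
        (*-cancelˡ-≤ 2 (begin
          2 * ∑ (samples c) f                                     ≡⟨ cong (2 *_) ∑f ⟩
          2 * (X * D * τ + Y * D′ * (n * n))                      ≡⟨ e₅ (X * D * τ) _ ⟩
          2 * (X * D * τ) + 2 * (Y * D′ * (n * n))                ≤⟨ +-mono-≤ lostBound leftBound ⟩
          U * (n * n * τ) + U * (n * n * τ)                       ≡⟨ e₆ (U * (n * n * τ)) ⟩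
          2 * (U * (n * n * τ))                                   ≡⟨ cong (λ t → 2 * (t * (n * n * τ))) (sym len) ⟩
          2 * (length (samples c) * (n * n * τ))                  ∎))

    extend : ∀ {c} → Vec (Vec (Fin n) r) c → List (Fin n) → List (Fin n)
    extend []      S = S
    extend (z ∷ ζ) S = Vec.toList z ++ extend ζ S

    length-extend : ∀ {c} (ζ : Vec (Vec (Fin n) r) c) S → length (extend ζ S) ≡ c * r + length S
    length-extend []                S = refl
    length-extend {suc c} (z ∷ ζ) S = begin
      length (Vec.toList z ++ extend ζ S)          ≡⟨ List.length-++ (Vec.toList z) ⟩
      length (Vec.toList z) + length (extend ζ S)  ≡⟨ cong₂ _+_ (Vec.length-toList z) (length-extend ζ S) ⟩
      r + (c * r + length S)                       ≡⟨ sym (+-assoc r (c * r) (length S)) ⟩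
      suc c * r + length S                         ∎
      where open ≡-Reasoning

    similar-extend : ∀ {c} (ζ : Vec (Vec (Fin n) r) c) S {x y} → Similar (extend ζ S) x y → Similar S x y
    similar-extend []      S h = h
    similar-extend (z ∷ ζ) S h = similar-extend ζ S (All.++⁻ʳ (Vec.toList z) h)

    module _ (S : List (Fin n)) (meas-C : Measurable S C)
             (incQ : All Increasing Q) (freshQ : All ((a , b) ≢_) Q) where

      module _ (z : Vec (Fin n) r) {x x′ y y′}
               (zx : Similar (Vec.toList z) x x′) (zy : Similar (Vec.toList z) y y′)
               (sx : Similar S x x′) (sy : Similar S y y′) where

        put-similar : ∀ S → Similar S x x′ → Similar S y y′ → ∀ c →
          Similar S (lookup (put z x y) c) (lookup (put z x′ y′) c)
        put-similar S hx hy c with c Fin.≟ b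
        ... | yes refl rewrite put-b z x y | put-b z x′ y′ = hy
        ... | no c≢b with c Fin.≟ a
        ...   | yes refl rewrite put-a z x y | put-a z x′ y′ = hx
        ...   | no c≢a rewrite put-other z x y c≢a c≢b | put-other z x′ y′ c≢a c≢b = similar-refl S _

        row : ∀ c {u v} → Similar (Vec.toList z) u v → G (lookup z c) u ≡ G (lookup z c) v
        row c h = go z h c
          where
          go : ∀ {m} (w : Vec (Fin n) m) {u v} → Similar (Vec.toList w) u v →
            ∀ c → G (lookup w c) u ≡ G (lookup w c) v
          go (_ ∷ w) (p ∷ _) zero    = p
          go (_ ∷ w) (_ ∷ h) (suc c) = go w h c

        left-other : ∀ c d → c ≢ a → c ≢ b →
          G (lookup (put z x y) c) (lookup (put z x y) d) ≡ G (lookup (put z x′ y′) c) (lookup (put z x′ y′) d)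
        left-other c d c≢a c≢b rewrite put-other z x y c≢a c≢b | put-other z x′ y′ c≢a c≢b =
          row c (put-similar (Vec.toList z) zx zy d)

        right-other : ∀ c d → d ≢ a → d ≢ b →
          G (lookup (put z x y) c) (lookup (put z x y) d) ≡ G (lookup (put z x′ y′) c) (lookup (put z x′ y′) d)
        right-other c d d≢a d≢b = trans (sym-G _ _) (trans (left-other d c d≢a d≢b) (sym-G _ _))

        -- An increasing pair other than (a , b) has an endpoint outside {a , b}. There `put` keeps
        -- the entry of `z`, and adjacency to an entry of `z` is constant on similarity classes.
        edge-similar : ∀ c d → c Fin.< d → (a , b) ≢ (c , d) →
          G (lookup (put z x y) c) (lookup (put z x y) d) ≡ G (lookup (put z x′ y′) c) (lookup (put z x′ y′) d)
        edge-similar c d c<d ≢ with c Fin.≟ a | c Fin.≟ b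
        ... | no c≢a   | no c≢b   = left-other c d c≢a c≢b
        ... | yes refl | _        = right-other c d (Fin.<⇒≢ c<d ∘ sym) (λ { refl → ≢ refl })
        ... | no _     | yes refl = right-other c d (Fin.<⇒≢ (Fin.<-trans a<b c<d) ∘ sym) (Fin.<⇒≢ c<d ∘ sym)

        satC-similar : ∀ es → sat C es (put z x y) ≡ sat C es (put z x′ y′)
        satC-similar []             = refl
        satC-similar ((c , d) ∷ es) = cong₂ _∧_
          (meas-C (put-similar S sx sy c) (put-similar S sx sy d)) (satC-similar es)

        satG-similar : ∀ es → All Increasing es → All ((a , b) ≢_) es →
          sat G es (put z x y) ≡ sat G es (put z x′ y′)
        satG-similar []             _              _             = refl
        satG-similar ((c , d) ∷ es) (c<d ∷ incs) (≢ ∷ fresh) = cong₂ _∧_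
          (edge-similar c d c<d ≢) (satG-similar es incs fresh)

        hits-similar : hits z x y ≡ hits z x′ y′
        hits-similar = cong₂ _∧_ (satC-similar P) (satG-similar Q incQ freshQ)

      missed-measurable : ∀ {c} (ζ : Vec (Vec (Fin n) r) c) → Measurable (extend ζ S) (missed ζ)
      missed-measurable []      hx hy = refl
      missed-measurable (z ∷ ζ) hx hy = cong₂ (λ p q → not p ∧ q)
        (hits-similar z (All.++⁻ˡ (Vec.toList z) hx) (All.++⁻ˡ (Vec.toList z) hy)
          (similar-extend (z ∷ ζ) S hx) (similar-extend (z ∷ ζ) S hy))
        (missed-measurable ζ (All.++⁻ʳ (Vec.toList z) hx) (All.++⁻ʳ (Vec.toList z) hy))

  -- `P` is the part of the pattern already tested in the container, `Q` the part still tested in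
  -- `G`. Each move from `Q` to `P` relaxes the density allowed for mixed copies by the factor 4 D,
  -- ending at 1/D₁, and loses at most 2 n²/D ordered pairs of `G`.
  replace-edges : ∀ D D₁ → 0 < n → ∀ (Q : Edges r) → All Increasing Q → Unique Q →
    ∀ C → Symm C → ∀ S → Measurable S C → ∀ P → All Increasing P →
    #sat C P Q * (D₁ * (4 * D) ^ length Q) ≤ n ^ r →
    ∃ λ C′ → Symm C′ × ∃ λ S′ → Measurable S′ C′ ×
      length S′ ≡ #sampled r D D₁ (length Q) + length S ×
      #cliques C′ r * D₁ ≤ n ^ r ×
      #pairs (λ x y → G x y ∧ not (C′ x y)) * D ≤
        #pairs (λ x y → G x y ∧ not (C x y)) * D + length Q * (2 * (n * n))
  replace-edges D D₁ 0<n [] _ _ C sym-C S meas P incP few =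
    C , sym-C , S , meas , refl ,
    ≤-trans (*-mono-≤ (∑-mono Vʳ (λ z → 𝟙-mono (λ t → ∧-intro (clique⇒sat P incP z t) _)))
      (≤-reflexive (sym (*-identityʳ D₁)))) few ,
    m≤m+n _ _
  replace-edges D D₁ 0<n ((a , b) ∷ Q) (a<b ∷ incQ) (fresh ∷ uniq) C sym-C S meas P incP few =
    let C″ , sym-C″ , S″ , meas″ , len″ , few″ , lost″ = recursive in
    C″ , sym-C″ , S″ , meas″ ,
    trans len″ (trans (cong (#sampled r D D₁ (length Q) +_) (length-extend ζ S))
      (e₁ (#sampled r D D₁ (length Q)) (2 * (D₁ * (4 * D) ^ length Q) * r) (length S))) ,
    few″ ,
    ≤-trans lost″ (≤-trans (+-monoˡ-≤ _ (*-monoˡ-≤ D lost≤C))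
      (≤-trans (≤-reflexive (e₂ (#pairs (λ x y → G x y ∧ not (C x y))) (#lost ζ) D (length Q) (n * n)))
      (≤-trans (+-monoˡ-≤ (length Q * (2 * (n * n)))
          (+-monoʳ-≤ (#pairs (λ x y → G x y ∧ not (C x y)) * D) (*-monoʳ-≤ 2 lost≤)))
        (≤-reflexive (+-assoc (#pairs (λ x y → G x y ∧ not (C x y)) * D) (2 * (n * n)) _)))))
    where
    open Step C sym-C P Q a b a<b
    e₀ : ∀ D₁ D u → D₁ * (4 * D * u) ≡ 4 * (D₁ * u * D)
    e₀ = solve-∀
    sampled = sample-exists D (D₁ * (4 * D) ^ length Q) 0<n
      (subst (λ t → #sat C P ((a , b) ∷ Q) * t ≤ n ^ r) (e₀ D₁ D ((4 * D) ^ length Q)) few)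
    ζ = proj₁ sampled
    lost≤ = proj₁ (proj₂ sampled)
    left≤ = proj₂ (proj₂ sampled)
    -- `missed` distinguishes the positions `a` and `b`; requiring both orders restores symmetry and
    -- doubles the loss.
    C′ : Fin n → Fin n → Bool
    C′ x y = C x y ∧ (missed ζ x y ∧ missed ζ y x)
    sym-C′ : Symm C′
    sym-C′ x y = cong₂ _∧_ (sym-C x y) (∧-comm (missed ζ x y) (missed ζ y x))
    S′ = extend ζ S
    meas′ : Measurable S′ C′
    meas′ hx hy = cong₂ _∧_ (meas (similar-extend ζ S hx) (similar-extend ζ S hy))
      (cong₂ _∧_ (missed-measurable S meas incQ fresh ζ hx hy)
                 (missed-measurable S meas incQ fresh ζ hy hx))
    sat≤ : #sat C′ ((a , b) ∷ P) Q ≤ #left ζ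
    sat≤ = ∑-mono Vʳ (λ z → 𝟙-mono (pick (C (lookup z a) (lookup z b))
      (missed ζ (lookup z a) (lookup z b)) (missed ζ (lookup z b) (lookup z a))
      (sat C′ P z) (sat C P z) (sat G Q z) (sat-mono (λ x y → ∧-fst {C x y}) P z)))
      where
      pick : ∀ c m m′ p′ p q → (T p′ → T p) → T (((c ∧ (m ∧ m′)) ∧ p′) ∧ q) → T (m ∧ (p ∧ q))
      pick true true true p′ p q h t = ∧-intro (h (∧-fst {p′} t)) (∧-snd {p′} t)
    recursive = replace-edges D D₁ 0<n Q incQ uniq C′ sym-C′ S′ meas′ ((a , b) ∷ P) (a<b ∷ incP)
      (≤-trans (*-monoˡ-≤ (D₁ * (4 * D) ^ length Q) sat≤) left≤)
    e₁ : ∀ s c l → s + (c + l) ≡ c + s + l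
    e₁ = solve-∀
    e₂ : ∀ o l D q m → (o + (l + l)) * D + q * (2 * m) ≡ o * D + 2 * (l * D) + q * (2 * m)
    e₂ = solve-∀
    split : ∀ {g g′} c m m′ → g ≡ g′ →
      𝟙 (g ∧ not (c ∧ (m ∧ m′))) ≤ 𝟙 (g ∧ not c) + (𝟙 (g ∧ not m) + 𝟙 (g′ ∧ not m′))
    split {false} c     m     m′    refl = z≤n
    split {true}  false m     m′    refl = s≤s z≤n
    split {true}  true  false m′    refl = s≤s z≤n
    split {true}  true  true  m′    refl = ≤-refl
    lost≤C : #pairs (λ x y → G x y ∧ not (C x y ∧ (missed ζ x y ∧ missed ζ y x))) ≤
      #pairs (λ x y → G x y ∧ not (C x y)) + (#lost ζ + #lost ζ)
    lost≤C = begin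
      ∑ V (λ x → ∑ V (λ y → 𝟙 (G x y ∧ not (C x y ∧ (missed ζ x y ∧ missed ζ y x)))))
        ≤⟨ ∑-mono V (λ x → ∑-mono V (λ y → split (C x y) (missed ζ x y) (missed ζ y x) (sym-G x y))) ⟩
      ∑ V (λ x → ∑ V (λ y → 𝟙 (G x y ∧ not (C x y)) +
        (𝟙 (G x y ∧ not (missed ζ x y)) + 𝟙 (G y x ∧ not (missed ζ y x)))))
        ≡⟨ ∑-cong V (λ x → trans (∑-+ V _ _) (cong (∑ V (λ y → 𝟙 (G x y ∧ not (C x y))) +_) (∑-+ V _ _))) ⟩
      ∑ V (λ x → ∑ V (λ y → 𝟙 (G x y ∧ not (C x y))) +
        (∑ V (λ y → 𝟙 (G x y ∧ not (missed ζ x y))) + ∑ V (λ y → 𝟙 (G y x ∧ not (missed ζ y x)))))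
        ≡⟨ trans (∑-+ V _ _) (cong (#pairs (λ x y → G x y ∧ not (C x y)) +_) (trans (∑-+ V _ _)
             (cong (#lost ζ +_) (∑-swap V V (λ x y → 𝟙 (G y x ∧ not (missed ζ y x))))))) ⟩
      #pairs (λ x y → G x y ∧ not (C x y)) + (#lost ζ + #lost ζ) ∎
      where open ≤-Reasoning

  -- Sample-based containers: the edges of the pattern K_r are replaced one at a
  -- time, an edge (a , b) becoming the set of those pairs xy which no random
  -- r-tuple, with xy put at positions a and b, completes to a copy of the
  -- remaining pattern.  A few tuples suffice, so that C is determined by the
  -- adjacencies of boundedly many vertices.
  container : ∀ D D₁ q → length (allEdges r) ≡ q → 0 < n →
    #cliques G r * (D₁ * (4 * D) ^ q) ≤ n ^ r →
    ∃ λ C → Symm C × ∃ λ S → Measurable S C ×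
      length S ≡ #sampled r D D₁ q ×
      #cliques C r * D₁ ≤ n ^ r ×
      #pairs (λ x y → G x y ∧ not (C x y)) * D ≤ q * (2 * (n * n))
  container D D₁ q refl 0<n few
    with replace-edges D D₁ 0<n (allEdges r) (allEdges-increasing r) (allEdges-unique r)
           (λ _ _ → true) (λ _ _ → refl) [] (λ _ _ → refl) [] []
           (≤-trans (*-monoˡ-≤ _ (∑-mono Vʳ (λ z → 𝟙-mono (λ t → clique-intro z
             (λ i j i<j → sat-∈ {es = allEdges r} z t (∈-allEdges i j i<j)))))) few)
  ... | C , sym-C , S , meas , len , few′ , lost = C , sym-C , S , meas ,
    trans len (+-identityʳ _) , few′ ,
    ≤-trans lost (≤-reflexive (cong (λ t → t * D + length (allEdges r) * (2 * (n * n))) none))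
    where
    none : #pairs (λ x y → G x y ∧ false) ≡ 0
    none = trans (∑-cong V (λ x → trans (∑-cong V (λ y → 𝟙-false (λ t → ∧-snd {G x y} t)))
      (∑-zero V))) (∑-zero V)

-- Many cliques force disjoint copies of L

∑-δ : ∀ {n} (x : Fin n) → ∑ (allFin n) (λ u → 𝟙 (does (x Fin.≟ u))) ≡ 1
∑-δ {suc n} zero    = trans (∑-allFin-suc n (λ u → 𝟙 (does (zero Fin.≟ u)))) (cong suc (∑-zero (allFin n)))
∑-δ {suc n} (suc x) = trans (∑-allFin-suc n (λ u → 𝟙 (does (suc x Fin.≟ u)))) (∑-δ x)

falling : ℕ → ℕ → ℕ
falling d zero    = 1
falling d (suc t) = d * falling (pred d) t

falling-mono : ∀ t {c d} → c ≤ d → falling c t ≤ falling d t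
falling-mono zero    c≤d = ≤-refl
falling-mono (suc t) c≤d = *-mono-≤ c≤d (falling-mono t (pred-mono-≤ c≤d))

-- Each of the `t` factors is at least d + 1 - t, and the hypothesis says that b (d + 1 - t) ≥ m.
falling-large : ∀ t b m d → m + b * t ≤ b * suc d → m ^ t ≤ b ^ t * falling d t
falling-large zero    b m d h = ≤-refl
falling-large (suc t) b m d h = begin
  m * m ^ t                            ≤⟨ *-mono-≤ (≤-trans (m≤m+n m (b * t)) h′) (falling-large t b m (pred d) (h″ d h′)) ⟩
  b * d * (b ^ t * falling (pred d) t) ≡⟨ e b d (b ^ t) (falling (pred d) t) ⟩
  b * b ^ t * (d * falling (pred d) t) ∎
  where
  open ≤-Reasoning
  e : ∀ b d u v → b * d * (u * v) ≡ b * u * (d * v)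
  e = solve-∀
  h′ : m + b * t ≤ b * d
  h′ = +-cancelˡ-≤ b _ _ (subst₂ _≤_ (trans (cong (m +_) (*-suc b t)) (move m b (b * t))) (*-suc b d) h)
    where
    move : ∀ m b u → m + (b + u) ≡ b + (m + u)
    move = solve-∀
  h″ : ∀ d → m + b * t ≤ b * d → m + b * t ≤ b * suc (pred d)
  h″ zero    h = ≤-trans h (≤-trans (≤-reflexive (*-zeroʳ b)) z≤n)
  h″ (suc d) h = h

degree : (Fin n → A → Bool) → A → ℕ
degree {n} f y = ∑ (allFin n) (λ x → 𝟙 (f x y))

degree≤ : ∀ (f : Fin n → A → Bool) y → degree f y ≤ n
degree≤ {n} f y = ≤-trans (∑-mono (allFin n) (λ x → 𝟙≤1 (f x y)))
  (≤-reflexive (trans (∑-Fin-const n 1) (*-identityʳ n)))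

Distinct : ∀ {t} → Vec A t → Set
Distinct v = ∀ {i j} → lookup v i ≡ lookup v j → i ≡ j

∷-distinct : ∀ {t} {x : A} {v : Vec A t} → (∀ i → x ≢ lookup v i) → Distinct v → Distinct (x ∷ v)
∷-distinct fresh dv {zero}  {zero}  eq = refl
∷-distinct fresh dv {zero}  {suc j} eq = contradiction eq (fresh j)
∷-distinct fresh dv {suc i} {zero}  eq = contradiction (sym eq) (fresh i)
∷-distinct fresh dv {suc i} {suc j} eq = cong suc (dv eq)

-- The falling factorials count, over all y, the ordered t-tuples of distinct
-- neighbours of y; a tuple is built one vertex at a time by averaging.
select : ∀ t (f : Fin n → A → Bool) (Y : List A) →
  0 < ∑ Y (λ y → falling (degree f y) t) →
  ∃ λ (τ : Vec (Fin n) t) → Distinct τ ×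
    ∑ Y (λ y → falling (degree f y) t) ≤ n ^ t * ∑ Y (λ y → 𝟙 (allᵛ (λ x → f x y) τ))
select zero f Y h = [] , (λ { {()} }) , ≤-reflexive (sym (+-identityʳ _))
select {n} {A} (suc t) f Y h =
  let τ , dτ , rec≤ = select t f′ Y′ (<-≤-trans inner>0 inner≤) in
  x ∷ τ ,
  -- Some `y` is joined under `f′` to all of `τ`, whereas `f′` joins `x` to nothing; so `x` is not
  -- in `τ`.
  ∷-distinct {v = τ} (λ i x≡ →
    let y , y>0 = ∑-pos Y′ _ (*-pos (n ^ t) _ (<-≤-trans (<-≤-trans inner>0 inner≤) rec≤))
        t′ = allᵛ-lookup {p = λ u → f′ u y} τ (𝟙-pos _ y>0) i
    in not-elim {does (x Fin.≟ lookup τ i)} (∧-snd {f (lookup τ i) y} t′) (⇒does (x Fin.≟ lookup τ i) x≡))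
    dτ ,
  (begin
    ∑ Y (λ y → falling (degree f y) (suc t))   ≡⟨ total ⟩
    ∑ V inner                                  ≤⟨ proj₂ best ⟩
    length V * inner x                         ≡⟨ cong (_* inner x) (length-allFin n) ⟩
    n * inner x                                ≤⟨ *-monoʳ-≤ n (≤-trans inner≤ rec≤) ⟩
    n * (n ^ t * ∑ Y′ (λ y → 𝟙 (allᵛ (λ u → f′ u y) τ)))
      ≡⟨ trans (sym (*-assoc n (n ^ t) _)) (cong (n * n ^ t *_) (∑-filter (f x) Y _)) ⟩
    n * n ^ t * ∑ Y (λ y → 𝟙 (f x y) * 𝟙 (allᵛ (λ u → f′ u y) τ))
      ≤⟨ *-monoʳ-≤ (n * n ^ t) (∑-mono Y (λ y → ≤-trans
           (≤-reflexive (sym (𝟙-∧ (f x y) _)))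
           (𝟙-mono (λ tt′ → ∧-intro (∧-fst {f x y} tt′) (allᵛ-intro τ (λ i →
             ∧-fst (allᵛ-lookup {p = λ u → f′ u y} τ (∧-snd {f x y} tt′) i))))))) ⟩
    n * n ^ t * ∑ Y (λ y → 𝟙 (allᵛ (λ u → f u y) (x ∷ τ))) ∎)
  where
  open ≤-Reasoning
  V = allFin n
  *-pos : ∀ a b → 0 < a * b → 0 < b
  *-pos a zero    0<ab = contradiction (subst (0 <_) (*-zeroʳ a) 0<ab) λ ()
  *-pos a (suc b) _    = z<s
  inner : Fin n → ℕ
  inner x = ∑ Y (λ y → 𝟙 (f x y) * falling (pred (degree f y)) t)
  total : ∑ Y (λ y → falling (degree f y) (suc t)) ≡ ∑ V inner
  total = trans (∑-cong Y (λ y → sym (∑-*ʳ V _ _))) (∑-swap Y V _)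
  best = average≥ V inner (subst (0 <_) total h)
  x = proj₁ best
  inner>0 : 0 < inner x
  inner>0 = *-pos (length V) (inner x) (<-≤-trans (subst (0 <_) total h) (proj₂ best))
  -- Deleting `x` keeps later choices distinct from it and lowers each degree by at most one, as the
  -- `pred` in `falling` allows.
  f′ : Fin n → A → Bool
  f′ u y = f u y ∧ not (does (x Fin.≟ u))
  Y′ = List.filter (T? ∘ f x) Y
  split : ∀ a b → 𝟙 a ≤ 𝟙 b + 𝟙 (a ∧ not b)
  split false b     = z≤n
  split true  true  = s≤s z≤n
  split true  false = ≤-refl
  shrink : ∀ y → pred (degree f y) ≤ degree f′ y
  shrink y = pred-mono-≤ {degree f y} {suc (degree f′ y)} (begin
    degree f y                                                   ≤⟨ ∑-mono V (λ u → split (f u y) (does (x Fin.≟ u))) ⟩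
    ∑ V (λ u → 𝟙 (does (x Fin.≟ u)) + 𝟙 (f′ u y))                ≡⟨ ∑-+ V _ _ ⟩
    ∑ V (λ u → 𝟙 (does (x Fin.≟ u))) + degree f′ y               ≡⟨ cong (_+ degree f′ y) (∑-δ x) ⟩
    suc (degree f′ y)                                            ∎)
  inner≤ : inner x ≤ ∑ Y′ (λ y → falling (degree f′ y) t)
  inner≤ = ≤-trans (∑-mono Y (λ y → *-monoʳ-≤ (𝟙 (f x y)) (falling-mono t (shrink y))))
    (≤-reflexive (sym (∑-filter (f x) Y _)))

-- Density 1/a gives at least the proportion 1/(2 a) of the `y` degree n/(2 a) or more. As 4 a t ≤
-- n, each of these has at least (n/(4 a))^t ordered tuples of distinct neighbours. The constant is
-- the product of the two losses.
select-dense : ∀ t a (f : Fin n → A → Bool) (Y : List A) → 0 < a → 0 < n → 0 < length Y →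
  4 * a * t ≤ n → n * length Y ≤ a * ∑ Y (degree f) →
  ∃ λ (τ : Vec (Fin n) t) → Distinct τ ×
    length Y ≤ 2 * a * (4 * a) ^ t * ∑ Y (λ y → 𝟙 (allᵛ (λ x → f x y) τ))
select-dense {n} {A} t a f Y 0<a 0<n 0<Y 4at≤n dense =
  let τ , dτ , h = select t f Y positive in
  τ , dτ , *-cancelˡ-≤ (n ^ t) {{>-nonZero nᵗ>0}} (≤-trans many (≤-trans
    (*-monoʳ-≤ (2 * a * (4 * a) ^ t) h) (≤-reflexive (e₁ (2 * a * (4 * a) ^ t) (n ^ t) _))))
  where
  open ≤-Reasoning
  nᵗ>0 : 0 < n ^ t
  nᵗ>0 = m^n>0 n {{>-nonZero 0<n}} t
  e₁ : ∀ u v w → u * (v * w) ≡ v * (u * w)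
  e₁ = solve-∀
  large : A → Bool
  large y = does (n ≤? 2 * a * degree f y)
  #large = ∑ Y (𝟙 ∘ large)
  pointwise : ∀ y → 2 * a * degree f y ≤ 2 * a * n * 𝟙 (large y) + n
  pointwise y = go (n ≤? 2 * a * degree f y)
    where
    go : (d : Dec (n ≤ 2 * a * degree f y)) → 2 * a * degree f y ≤ 2 * a * n * 𝟙 (does d) + n
    go (yes _) = ≤-trans (*-monoʳ-≤ (2 * a) (degree≤ f y))
      (≤-trans (≤-reflexive (sym (*-identityʳ (2 * a * n)))) (m≤m+n _ n))
    go (no ≰)  = ≤-trans (<⇒≤ (≰⇒> ≰)) (m≤n+m n _)
  e₂ : ∀ n y → n * y + n * y ≡ 2 * (n * y)
  e₂ = solve-∀
  e₃ : ∀ a s → 2 * (a * s) ≡ 2 * a * s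
  e₃ = solve-∀
  e₄ : ∀ a n z → 2 * a * n * z ≡ n * (2 * a * z)
  e₄ = solve-∀
  large≥ : length Y ≤ 2 * a * #large
  large≥ = *-cancelˡ-≤ n {{>-nonZero 0<n}} (+-cancelʳ-≤ (n * length Y) _ _ (begin
    n * length Y + n * length Y                    ≡⟨ e₂ n (length Y) ⟩
    2 * (n * length Y)                             ≤⟨ *-monoʳ-≤ 2 dense ⟩
    2 * (a * ∑ Y (degree f))                       ≡⟨ trans (e₃ a _) (sym (∑-*ˡ Y (2 * a) _)) ⟩
    ∑ Y (λ y → 2 * a * degree f y)                 ≤⟨ ∑-mono Y pointwise ⟩
    ∑ Y (λ y → 2 * a * n * 𝟙 (large y) + n)        ≡⟨ trans (∑-+ Y _ _) (cong₂ _+_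
                                                        (trans (∑-*ˡ Y (2 * a * n) _) (e₄ a n #large))
                                                        (trans (∑-const Y n) (*-comm (length Y) n))) ⟩
    n * (2 * a * #large) + n * length Y            ∎))
  e₅ : ∀ a d → 2 * (2 * a * d) ≡ 4 * a * d
  e₅ = solve-∀
  contribution : ∀ y → 𝟙 (large y) * n ^ t ≤ (4 * a) ^ t * falling (degree f y) t
  contribution y = go (n ≤? 2 * a * degree f y)
    where
    go : (d : Dec (n ≤ 2 * a * degree f y)) → 𝟙 (does d) * n ^ t ≤ (4 * a) ^ t * falling (degree f y) t
    go (no _)   = z≤n
    go (yes n≤) = ≤-trans (≤-reflexive (*-identityˡ (n ^ t))) (falling-large t (4 * a) n (degree f y) (begin
      n + 4 * a * t                  ≤⟨ +-monoʳ-≤ n 4at≤n ⟩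
      n + n                          ≡⟨ cong (n +_) (sym (+-identityʳ n)) ⟩
      2 * n                          ≤⟨ *-monoʳ-≤ 2 n≤ ⟩
      2 * (2 * a * degree f y)       ≡⟨ e₅ a (degree f y) ⟩
      4 * a * degree f y             ≤⟨ *-monoʳ-≤ (4 * a) (n≤1+n _) ⟩
      4 * a * suc (degree f y)       ∎))
  many : n ^ t * length Y ≤ 2 * a * (4 * a) ^ t * ∑ Y (λ y → falling (degree f y) t)
  many = begin
    n ^ t * length Y                                          ≤⟨ *-monoʳ-≤ (n ^ t) large≥ ⟩
    n ^ t * (2 * a * #large)                                  ≡⟨ e₆ (n ^ t) (2 * a) #large ⟩
    2 * a * (#large * n ^ t)                                  ≡⟨ cong (2 * a *_) (sym (∑-*ʳ Y _ _)) ⟩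
    2 * a * ∑ Y (λ y → 𝟙 (large y) * n ^ t)                   ≤⟨ *-monoʳ-≤ (2 * a) (∑-mono Y contribution) ⟩
    2 * a * ∑ Y (λ y → (4 * a) ^ t * falling (degree f y) t)  ≡⟨ cong (2 * a *_) (∑-*ˡ Y ((4 * a) ^ t) _) ⟩
    2 * a * ((4 * a) ^ t * ∑ Y (λ y → falling (degree f y) t)) ≡⟨ sym (*-assoc (2 * a) _ _) ⟩
    2 * a * (4 * a) ^ t * ∑ Y (λ y → falling (degree f y) t)  ∎
    where
    e₆ : ∀ u v w → u * (v * w) ≡ v * (w * u)
    e₆ = solve-∀
  positive : 0 < ∑ Y (λ y → falling (degree f y) t)
  positive = n≢0⇒n>0 (λ eq → contradiction (≤-trans (*-mono-≤ nᵗ>0 0<Y) (subst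
    (λ s → n ^ t * length Y ≤ 2 * a * (4 * a) ^ t * s) eq many))
    (subst (λ s → ¬ (1 ≤ s)) (sym (*-zeroʳ (2 * a * (4 * a) ^ t))) λ ()))

-- Each coordinate turns density 1/a into 1/(2 a (4 a)^t) and needs n ≥ 4 a t, by `select-dense`.
boxSize : ℕ → ℕ → ℕ → ℕ
boxSize t zero    a = 1
boxSize t (suc r) a = 4 * a * t ⊔ boxSize t r (2 * a * (4 * a) ^ t)

boxSize>0 : ∀ t r a → 0 < boxSize t r a
boxSize>0 t zero    a = z<s
boxSize>0 t (suc r) a = ≤-trans (boxSize>0 t r _) (m≤n⊔m (4 * a * t) _)

transversal : ∀ {r t} → (Fin r → Vec A t) → (Fin r → Fin t) → Vec A r
transversal τs ι = Vec.tabulate (λ c → lookup (τs c) (ι c))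

-- Erdős's theorem on complete r-partite r-uniform hypergraphs, for the
-- r-uniform "hypergraph" p.
box : ∀ t r a {n} → 0 < a → boxSize t r a ≤ n → (p : Vec (Fin n) r → Bool) →
  n ^ r ≤ a * ∑ (vecs (allFin n) r) (𝟙 ∘ p) →
  ∃ λ (τs : Fin r → Vec (Fin n) t) → (∀ c → Distinct (τs c)) ×
    (∀ (ι : Fin r → Fin t) → T (p (transversal τs ι)))
box t zero a 0<a _ p h = (λ ()) , (λ ()) , λ _ → true-[] (p []) h
  where
  true-[] : ∀ b → 1 ≤ a * (𝟙 b + 0) → T b
  true-[] true  _ = _
  true-[] false h = contradiction (subst (1 ≤_) (*-zeroʳ a) h) λ ()
box t (suc r) a {n} 0<a size p h =
  let τ , dτ , h₁ = select-dense t a (λ x y → p (x ∷ y)) Y 0<a 0<n 0<Y (≤-trans (m≤m⊔n _ _) size) dense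
      τs , dτs , h₂ = box t r (2 * a * (4 * a) ^ t) a′>0 (≤-trans (m≤n⊔m (4 * a * t) _) size)
        (λ y → allᵛ (λ x → p (x ∷ y)) τ) (≤-trans (≤-reflexive (sym lenY)) h₁)
  in (λ { zero → τ ; (suc c) → τs c }) ,
     (λ { zero → dτ ; (suc c) → dτs c }) ,
     λ ι → allᵛ-lookup τ (h₂ (ι ∘ suc)) (ι zero)
  where
  Y = vecs (allFin n) r
  lenY : length Y ≡ n ^ r
  lenY = trans (length-vecs (allFin n) r) (cong (_^ r) (length-allFin n))
  0<n : 0 < n
  0<n = ≤-trans (boxSize>0 t (suc r) a) size
  0<Y : 0 < length Y
  0<Y = subst (0 <_) (sym lenY) (m^n>0 n {{>-nonZero 0<n}} r)
  a′>0 : 0 < 2 * a * (4 * a) ^ t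
  a′>0 = *-mono-≤ {1} {2 * a} {1} (*-mono-≤ {1} {2} {1} (s≤s z≤n) 0<a)
    (m^n>0 (4 * a) {{>-nonZero (*-mono-≤ {1} {4} {1} (s≤s z≤n) 0<a)}} t)
  dense : n * length Y ≤ a * ∑ Y (degree (λ x y → p (x ∷ y)))
  dense = subst₂ (λ u v → n * u ≤ a * v) (sym lenY)
    (trans (∑-vecs-suc (allFin n) r _) (∑-swap (allFin n) Y _)) h

-- Union bound over the `r` positions of a bad vertex, multiplied by `n` to avoid an exponent r - 1.
∑-meets : ∀ (bad : Fin n → Bool) r →
  n * ∑ (vecs (allFin n) r) (λ x → 𝟙 (not (allᵛ (not ∘ bad) x))) ≤
  r * (∑ (allFin n) (𝟙 ∘ bad) * n ^ r)
∑-meets {n} bad zero    = ≤-reflexive (*-zeroʳ n)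
∑-meets {n} bad (suc r) = begin
  n * ∑ (vecs V (suc r)) (λ x → 𝟙 (not (allᵛ (not ∘ bad) x)))
    ≡⟨ cong (n *_) (∑-vecs-suc V r _) ⟩
  n * ∑ V (λ v → ∑ Vʳ (λ y → 𝟙 (not (not (bad v) ∧ allᵛ (not ∘ bad) y))))
    ≤⟨ *-monoʳ-≤ n (∑-mono V (λ v → ∑-mono Vʳ (λ y → split (bad v) (allᵛ (not ∘ bad) y)))) ⟩
  n * ∑ V (λ v → ∑ Vʳ (λ y → 𝟙 (bad v) + 𝟙 (not (allᵛ (not ∘ bad) y))))
    ≡⟨ cong (n *_) (∑-cong V (λ v → trans (∑-+ Vʳ _ _) (cong (_+ u) (trans (∑-const Vʳ _)
         (cong (_* 𝟙 (bad v)) lenY))))) ⟩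
  n * ∑ V (λ v → n ^ r * 𝟙 (bad v) + u)
    ≡⟨ cong (n *_) (trans (∑-+ V _ _) (cong₂ _+_ (∑-*ˡ V (n ^ r) _) (∑-Fin-const n u))) ⟩
  n * (n ^ r * β + n * u)
    ≤⟨ *-monoʳ-≤ n (+-monoʳ-≤ (n ^ r * β) (∑-meets bad r)) ⟩
  n * (n ^ r * β + r * (β * n ^ r))
    ≡⟨ e n (n ^ r) β r ⟩
  suc r * (β * (n * n ^ r)) ∎
  where
  open ≤-Reasoning
  V = allFin n
  Vʳ = vecs V r
  lenY : length Vʳ ≡ n ^ r
  lenY = trans (length-vecs V r) (cong (_^ r) (length-allFin n))
  β = ∑ V (𝟙 ∘ bad)
  u = ∑ Vʳ (λ y → 𝟙 (not (allᵛ (not ∘ bad) y)))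
  e : ∀ n w β r → n * (w * β + r * (β * w)) ≡ suc r * (β * (n * w))
  e = solve-∀
  split : ∀ b a → 𝟙 (not (not b ∧ a)) ≤ 𝟙 b + 𝟙 (not a)
  split true  a = s≤s z≤n
  split false a = ≤-refl

module Copies {l r : ℕ} (L : Graph l) (col : Fin l → Fin r)
              (proper : ∀ u v → Edge L u v → col u ≢ col v) {n} (G : Graph n) where
  private
    V = allFin n
    E = edge? G

  Used : ∀ {k} → (Fin k × Fin l → Fin n) → Fin n → Set
  Used f v = ∃ λ i → ∃ λ u → f (i , u) ≡ v

  used? : ∀ {k} (f : Fin k × Fin l → Fin n) v → Dec (Used f v)
  used? f v = Fin.any? (λ i → Fin.any? (λ u → f (i , u) Fin.≟ v))

  #used : ∀ {k} (f : Fin k × Fin l → Fin n) → ∑ V (λ v → 𝟙 (does (used? f v))) ≤ k * l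
  #used {k} f = begin
    ∑ V (λ v → 𝟙 (does (used? f v)))
      ≤⟨ ∑-mono V (λ v → go v (used? f v)) ⟩
    ∑ V (λ v → ∑ (allFin k) (λ i → ∑ (allFin l) (λ u → 𝟙 (does (f (i , u) Fin.≟ v)))))
      ≡⟨ trans (∑-swap V (allFin k) _) (∑-cong (allFin k) (λ i → ∑-swap V (allFin l) _)) ⟩
    ∑ (allFin k) (λ i → ∑ (allFin l) (λ u → ∑ V (λ v → 𝟙 (does (f (i , u) Fin.≟ v)))))
      ≡⟨ ∑-cong (allFin k) (λ i → ∑-cong (allFin l) (λ u → ∑-δ (f (i , u)))) ⟩
    ∑ (allFin k) (λ i → ∑ (allFin l) (λ u → 1))
      ≡⟨ trans (∑-cong (allFin k) (λ i → trans (∑-Fin-const l 1) (*-identityʳ l))) (∑-Fin-const k l) ⟩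
    k * l ∎
    where
    open ≤-Reasoning
    go : ∀ v (d : Dec (Used f v)) →
      𝟙 (does d) ≤ ∑ (allFin k) (λ i → ∑ (allFin l) (λ u → 𝟙 (does (f (i , u) Fin.≟ v))))
    go v (no _)             = z≤n
    go v (yes (i , u , eq)) = begin
      1                                                       ≡⟨ sym (𝟙-true (⇒does (f (i , u) Fin.≟ v) eq)) ⟩
      𝟙 (does (f (i , u) Fin.≟ v))                            ≤⟨ ≤∑ _ (∈.∈-allFin u) ⟩
      ∑ (allFin l) (λ u → 𝟙 (does (f (i , u) Fin.≟ v)))       ≤⟨ ≤∑ (λ i → ∑ (allFin l) (λ u → 𝟙 (does (f (i , u) Fin.≟ v)))) (∈.∈-allFin i) ⟩
      ∑ (allFin k) (λ i → ∑ (allFin l) (λ u → 𝟙 (does (f (i , u) Fin.≟ v)))) ∎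

  module _ {k} (f : Fin k × Fin l → Fin n) (τs : Fin r → Vec (Fin n) l)
           (distinct : ∀ c → Distinct (τs c))
           (good : ∀ (ι : Fin r → Fin l) →
             T (clique E (transversal τs ι) ∧ allᵛ (λ v → not (does (used? f v))) (transversal τs ι))) where

    adjacent : ∀ c d i j → c ≢ d → Edge G (lookup (τs c) i) (lookup (τs d) j)
    adjacent c d i j c≢d = subst₂ (Edge G)
      (trans (Vec.lookup∘tabulate _ c) (cong (lookup (τs c)) ιc))
      (trans (Vec.lookup∘tabulate _ d) (cong (lookup (τs d)) ιd))
      (clique-≢ (symm G) x (∧-fst (good ι)) c d c≢d)
      where
      -- Chosen so that the transversal passes through both prescribed vertices.
      ι : Fin r → Fin l
      ι e = if does (e Fin.≟ c) then i else j
      x = transversal τs ι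
      ιc : ι c ≡ i
      ιc rewrite T⇒≡true (⇒does (c Fin.≟ c) refl) = refl
      ιd : ι d ≡ j
      ιd with d Fin.≟ c
      ... | yes d≡c = contradiction (sym d≡c) c≢d
      ... | no  _   = refl

    unused : ∀ c i → ¬ Used f (lookup (τs c) i)
    unused c i h = not-elim {does (used? f (lookup (τs c) i))}
      (subst (λ v → T (not (does (used? f v)))) (Vec.lookup∘tabulate (λ c → lookup (τs c) i) c)
        (allᵛ-lookup {p = λ v → not (does (used? f v))} x (∧-snd {clique E x} (good (λ _ → i))) c))
      (⇒does (used? f (lookup (τs c) i)) h)
      where x = transversal τs (λ _ → i)

    add-copy : Fin (suc k) × Fin l → Fin n
    add-copy (zero  , u) = lookup (τs (col u)) u
    add-copy (suc i , u) = f (i , u)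

    -- Two vertices of the new copy in one part differ by `distinct`; in different parts they are
    -- adjacent in `G`, which has no loops.
    add-copy-injective : Injective _≡_ _≡_ f → Injective _≡_ _≡_ add-copy
    add-copy-injective inj {zero , u} {zero , v} eq with col u Fin.≟ col v
    ... | yes cu≡cv = cong (zero ,_) (distinct (col v)
            (subst (λ c → lookup (τs c) u ≡ lookup (τs (col v)) v) cu≡cv eq))
    ... | no cu≢cv  = ⊥-elim (subst T (irrefl G _)
            (subst (λ w → Edge G w (lookup (τs (col v)) v)) eq (adjacent (col u) (col v) u v cu≢cv)))
    add-copy-injective inj {zero , u}  {suc i , v} eq = contradiction (i , v , sym eq) (unused (col u) u)
    add-copy-injective inj {suc i , u} {zero , v}  eq = contradiction (i , u , eq) (unused (col v) v)
    add-copy-injective inj {suc i , u} {suc j , v} eq with inj {i , u} {j , v} eq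
    ... | refl = refl

  -- Greedy packing. The vertices of the earlier copies meet at most a proportion 1/(2 a) of all
  -- `r`-tuples, so the cliques avoiding them still have density 1/(2 a). A box of such cliques has
  -- `l` vertices in each part, and each vertex of `L` gets its own place in the part of its colour.
  dense⇒copies : ∀ a → 0 < a → boxSize l r (2 * a) ≤ n → n ^ r ≤ a * #cliques E r →
    ∀ k → 2 * a * r * (k * l) ≤ n → ContainsDisjointCopies k L G
  dense⇒copies a 0<a size dense zero    _    = (λ { (() , _) }) , (λ { {() , _} }) , λ ()
  dense⇒copies a 0<a size dense (suc k) few =
    let f , inj , copy = dense⇒copies a 0<a size dense k (≤-trans
          (*-monoʳ-≤ (2 * a * r) (m≤n+m (k * l) l)) few)
        τs , distinct , good = box l r (2 * a) (*-mono-≤ {1} {2} {1} (s≤s z≤n) 0<a) size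
          (λ x → clique E x ∧ allᵛ (λ v → not (does (used? f v))) x) (still-dense f)
    in add-copy f τs distinct good , add-copy-injective f τs distinct good inj ,
       λ { zero u v e → adjacent f τs distinct good (col u) (col v) u v (proper u v e)
         ; (suc i) u v e → copy i u v e }
    where
    still-dense : ∀ (f : Fin k × Fin l → Fin n) → n ^ r ≤ 2 * a *
      ∑ (vecs V r) (λ x → 𝟙 (clique E x ∧ allᵛ (λ v → not (does (used? f v))) x))
    still-dense f = *-cancelˡ-≤ n {{>-nonZero 0<n}} (+-cancelʳ-≤ (n * n ^ r) _ _ (begin
      n * n ^ r + n * n ^ r                     ≡⟨ e₁ n (n ^ r) ⟩
      2 * n * n ^ r                             ≤⟨ *-monoʳ-≤ (2 * n) dense ⟩
      2 * n * (a * #cliques E r)                ≤⟨ *-monoʳ-≤ (2 * n) (*-monoʳ-≤ a (≤-trans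
                                                     (∑-mono Vʳ (λ x → split (clique E x) _))
                                                     (≤-reflexive (∑-+ Vʳ _ _)))) ⟩
      2 * n * (a * (p + m))                     ≡⟨ e₂ n a p m ⟩
      n * (2 * a * p) + 2 * a * (n * m)         ≤⟨ +-monoʳ-≤ (n * (2 * a * p)) (begin
        2 * a * (n * m)                           ≤⟨ *-monoʳ-≤ (2 * a) (∑-meets bad r) ⟩
        2 * a * (r * (∑ V (𝟙 ∘ bad) * n ^ r))     ≤⟨ *-monoʳ-≤ (2 * a) (*-monoʳ-≤ r (*-monoˡ-≤ (n ^ r)
                                                       (≤-trans (#used f) (m≤n+m (k * l) l)))) ⟩
        2 * a * (r * (suc k * l * n ^ r))         ≡⟨ e₃ a r (suc k * l) (n ^ r) ⟩
        2 * a * r * (suc k * l) * n ^ r           ≤⟨ *-monoˡ-≤ (n ^ r) few ⟩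
        n * n ^ r                                 ∎) ⟩
      n * (2 * a * p) + n * n ^ r               ∎))
      where
      open ≤-Reasoning
      0<n : 0 < n
      0<n = ≤-trans (boxSize>0 l r (2 * a)) size
      Vʳ = vecs V r
      bad : Fin n → Bool
      bad v = does (used? f v)
      p = ∑ Vʳ (λ x → 𝟙 (clique E x ∧ allᵛ (not ∘ bad) x))
      m = ∑ Vʳ (λ x → 𝟙 (not (allᵛ (not ∘ bad) x)))
      split : ∀ c g → 𝟙 c ≤ 𝟙 (c ∧ g) + 𝟙 (not g)
      split false g     = z≤n
      split true  true  = s≤s z≤n
      split true  false = ≤-refl
      e₁ : ∀ n w → n * w + n * w ≡ 2 * n * w
      e₁ = solve-∀
      e₂ : ∀ n a p m → 2 * n * (a * (p + m)) ≡ n * (2 * a * p) + 2 * a * (n * m)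
      e₂ = solve-∀
      e₃ : ∀ a r s w → 2 * a * (r * (s * w)) ≡ 2 * a * r * s * w
      e₃ = solve-∀

-- Counting the graphs close to a step graph

bit : Bool → Fin 2
bit true  = suc zero
bit false = zero

bit-injective : ∀ {a b} → bit a ≡ bit b → a ≡ b
bit-injective {true}  {true}  _ = refl
bit-injective {false} {false} _ = refl

bits-injective : ∀ {k} {f g : Fin k → Bool} → funToFin (bit ∘ f) ≡ funToFin (bit ∘ g) → ∀ i → f i ≡ g i
bits-injective {k} {f} {g} eq i = bit-injective (begin
  bit (f i)                                  ≡⟨ sym (Fin.finToFun-funToFin (bit ∘ f) i) ⟩
  finToFun {2} {k} (funToFin (bit ∘ f)) i    ≡⟨ cong (λ c → finToFun {2} {k} c i) eq ⟩
  finToFun {2} {k} (funToFin (bit ∘ g)) i    ≡⟨ Fin.finToFun-funToFin (bit ∘ g) i ⟩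
  bit (g i)                                  ∎)
  where open ≡-Reasoning

step-graph : ∀ {m} → Vec (Fin m) n → Vec (Vec Bool m) m → Fin n → Fin n → Bool
step-graph π h x y = lookup (lookup h (lookup π x)) (lookup π y)

-- The class of a vertex is its adjacency vector to the sample. As σ is independent of `n`, a
-- container is described by σ n bits for `π` and a bounded number of bits for `h`.
measurable⇒step : ∀ {r} (G : Fin n → Fin n → Bool) (sym-G : Symm G) {σ} S C →
  Container.Measurable {r = r} G sym-G S C → length S ≡ σ →
  ∃ λ (π : Vec (Fin (2 ^ σ)) n) → ∃ λ h → ∀ x y → step-graph π h x y ≡ C x y
measurable⇒step {n} {r} G sym-G S C meas refl = Vec.tabulate type , Vec.tabulate (λ i → Vec.tabulate (h i)) , agree
  where
  open Container {r = r} G sym-G using (Similar)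
  m = 2 ^ length S
  type : Fin n → Fin m
  type x = funToFin (λ i → bit (G (List.lookup S i) x))
  type⇒Similar : ∀ {x y} → type x ≡ type y → Similar S x y
  type⇒Similar {x} {y} eq = subst (All (λ v → G v x ≡ G v y)) (List.tabulate-lookup S)
    (All.tabulate⁺ (bits-injective {f = λ i → G (List.lookup S i) x} eq))
  Witness : Fin m → Fin m → Set
  Witness i j = ∃ λ x → ∃ λ y → type x ≡ i × type y ≡ j × T (C x y)
  witness? : ∀ i j → Dec (Witness i j)
  witness? i j = Fin.any? (λ x → Fin.any? (λ y → (type x Fin.≟ i) ×-dec (type y Fin.≟ j) ×-dec T? (C x y)))
  -- Pairs of classes of which one is empty get the default `false`.
  h : Fin m → Fin m → Bool
  h i j = does (witness? i j)
  agree : ∀ x y → step-graph (Vec.tabulate type) (Vec.tabulate (λ i → Vec.tabulate (h i))) x y ≡ C x y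
  agree x y rewrite Vec.lookup∘tabulate type x | Vec.lookup∘tabulate type y
    | Vec.lookup∘tabulate (λ i → Vec.tabulate (h i)) (type x) | Vec.lookup∘tabulate (h (type x)) (type y) =
    T-ext (λ t → let x′ , y′ , ex , ey , c = does⇒ (witness? (type x) (type y)) t in
             subst T (meas (type⇒Similar ex) (type⇒Similar ey)) c)
          (λ c → ⇒does (witness? (type x) (type y)) (x , y , refl , refl , c))

-- Graphs as Boolean matrices, and their weighted count

infix 7 _<ᶠ_
_<ᶠ_ : Fin n → Fin n → Bool
u <ᶠ v = toℕ u <ᵇ toℕ v

bools : List Bool
bools = true ∷ false ∷ []

∈-bools : ∀ b → b ∈ bools
∈-bools true  = here refl
∈-bools false = there (here refl)

-- All Boolean matrices stand in for the graphs, `upper` reading only the entries above the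
-- diagonal. Independent entries let sums factorise, and the idle entries are counted as free in
-- `#inside`.
matrices : ∀ n → List (Vec (Vec Bool n) n)
matrices n = vecs (vecs bools n) n

length-matrices : ∀ n → length (matrices n) ≡ 2 ^ (n * n)
length-matrices n = trans (length-vecs (vecs bools n) n)
  (trans (cong (_^ n) (length-vecs bools n)) (^-*-assoc 2 n n))

upper : Vec (Vec Bool n) n → Graph n
upper g .edge? u v = (u <ᶠ v ∧ lookup (lookup g u) v) ∨ (v <ᶠ u ∧ lookup (lookup g v) u)
upper g .symm u v  = ∨-comm (u <ᶠ v ∧ lookup (lookup g u) v) _
upper g .irrefl v  with v <ᶠ v in eq
... | false = refl
... | true  = contradiction (<ᵇ⇒< (toℕ v) (toℕ v) (subst T (sym eq) _)) (<-irrefl refl)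

upper-edge : ∀ (g : Vec (Vec Bool n) n) u v → T (u <ᶠ v) → edge? (upper g) u v ≡ lookup (lookup g u) v
upper-edge g u v u<v with v <ᶠ u in eq
... | true  = contradiction (<ᵇ⇒< (toℕ v) (toℕ u) (subst T (sym eq) _)) (<-asym (<ᵇ⇒< (toℕ u) (toℕ v) u<v))
... | false rewrite T⇒≡true u<v = ∨-identityʳ _

∏-scale : ∀ b n (w e : Fin n → ℕ) → b ^ ∑ (allFin n) e * ∏ n w ≡ ∏ n (λ i → b ^ e i * w i)
∏-scale b n w e = trans (cong (_* ∏ n w) (sym (∏-base^ n b e))) (sym (∏-* n _ w))

module Close (F C : Fin n → Fin n → Bool) where
  private
    V = allFin n

  outside : Fin n → Fin n → Bool
  outside u v = u <ᶠ v ∧ not (C u v)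

  exception : Fin n → Fin n → Bool → Bool
  exception u v b = outside u v ∧ (F u v xor b)

  #exceptions : Vec (Vec Bool n) n → ℕ
  #exceptions g = ∑ V (λ u → ∑ V (λ v → 𝟙 (exception u v (lookup (lookup g u) v))))

  #inside : ℕ
  #inside = #pairs (λ u v → not (outside u v))

  close : ℕ → Vec (Vec Bool n) n → Bool
  close K g = does (#exceptions g ≤? K)

  #close : ℕ → ℕ
  #close K = ∑ (matrices n) (𝟙 ∘ close K)

  -- Matrices are counted with weight s ^ (n² ∸ number of exceptions), for which
  -- the sum over all matrices factorises.
  module _ (s : ℕ) where
    weight : Fin n → Fin n → Bool → ℕ
    weight u v b = if exception u v b then 1 else s

    total : Fin n → Fin n → ℕ
    total u v = ∑ bools (weight u v)

    ∑-weights : ∑ (matrices n) (λ g → ∏ n (λ u → ∏ n (λ v → weight u v (lookup (lookup g u) v)))) ≡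
      ∏ n (λ u → ∏ n (total u))
    ∑-weights = trans (∑-∏ (vecs bools n) n (λ u row → ∏ n (λ v → weight u v (lookup row v))))
      (∏-cong n (λ u → ∑-∏ bools n (weight u)))

    weight-exceptions : ∀ g → s ^ #exceptions g * ∏ n (λ u → ∏ n (λ v → weight u v (lookup (lookup g u) v))) ≡
      s ^ (n * n)
    weight-exceptions g = begin
      s ^ #exceptions g * ∏ n (λ u → ∏ n (λ v → weight u v (lookup (lookup g u) v)))
        ≡⟨ trans (∏-scale s n _ _) (∏-cong n (λ u → ∏-scale s n _ _)) ⟩
      ∏ n (λ u → ∏ n (λ v → s ^ 𝟙 (exception u v (entry u v)) * weight u v (entry u v)))
        ≡⟨ ∏-cong n (λ u → trans (∏-cong n (λ v → pay (exception u v (entry u v)))) (∏-const n s)) ⟩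
      ∏ n (λ u → s ^ n)
        ≡⟨ trans (∏-const n (s ^ n)) (^-*-assoc s n n) ⟩
      s ^ (n * n) ∎
      where
      open ≡-Reasoning
      entry : Fin n → Fin n → Bool
      entry u v = lookup (lookup g u) v
      pay : ∀ b → s ^ 𝟙 b * (if b then 1 else s) ≡ s
      pay true  = trans (*-identityʳ _) (*-identityʳ s)
      pay false = *-identityˡ s

    #close-weighted : 0 < s → ∀ K → #close K * s ^ (n * n) ≤ s ^ K * ∏ n (λ u → ∏ n (total u))
    #close-weighted 0<s K = begin
      #close K * s ^ (n * n)
        ≡⟨ sym (∑-*ʳ (matrices n) _ _) ⟩
      ∑ (matrices n) (λ g → 𝟙 (close K g) * s ^ (n * n))
        ≤⟨ ∑-mono (matrices n) (λ g → pointwise g (#exceptions g ≤? K)) ⟩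
      ∑ (matrices n) (λ g → s ^ K * ∏ n (λ u → ∏ n (λ v → weight u v (lookup (lookup g u) v))))
        ≡⟨ trans (∑-*ˡ (matrices n) (s ^ K) _) (cong (s ^ K *_) ∑-weights) ⟩
      s ^ K * ∏ n (λ u → ∏ n (total u)) ∎
      where
      open ≤-Reasoning
      pointwise : ∀ g (d : Dec (#exceptions g ≤ K)) → 𝟙 (does d) * s ^ (n * n) ≤
        s ^ K * ∏ n (λ u → ∏ n (λ v → weight u v (lookup (lookup g u) v)))
      pointwise g (no _)   = z≤n
      pointwise g (yes ≤K) = begin
        1 * s ^ (n * n)            ≡⟨ *-identityˡ (s ^ (n * n)) ⟩
        s ^ (n * n)                ≡⟨ sym (weight-exceptions g) ⟩
        s ^ #exceptions g * _      ≤⟨ *-monoˡ-≤ _ (^-monoʳ-≤ s {{>-nonZero 0<s}} ≤K) ⟩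
        s ^ K * _                  ∎

    -- An outside entry has total weight s + 1, an inside entry 2 s. In `j`-th powers, relative to
    -- s^j, the former costs one bit by the root condition and the latter `j` bits; the exponent
    -- covers both cases.
    total-power : ∀ j → suc s ^ j ≤ 2 * s ^ j → ∀ u v →
      total u v ^ j ≤ 2 ^ (1 + j * 𝟙 (not (outside u v))) * s ^ j
    total-power j root u v = go (outside u v) (F u v)
      where
      go : ∀ b f → (∑ bools (λ x → if b ∧ (f xor x) then 1 else s)) ^ j ≤ 2 ^ (1 + j * 𝟙 (not b)) * s ^ j
      go true  true  = subst₂ (λ x y → x ^ j ≤ 2 ^ (1 + y) * s ^ j)
        (sym (trans (cong (s +_) (+-identityʳ 1)) (+-comm s 1))) (sym (*-zeroʳ j)) root
      go true  false = subst₂ (λ x y → x ^ j ≤ 2 ^ (1 + y) * s ^ j)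
        (sym (cong suc (+-identityʳ s))) (sym (*-zeroʳ j)) root
      go false f     = ≤-trans (≤-reflexive (^-distribʳ-* 2 s j))
        (*-monoˡ-≤ (s ^ j) (^-monoʳ-≤ 2 (≤-trans (≤-reflexive (sym (*-identityʳ j))) (n≤1+n _))))

    ∏-total-power : ∀ j → suc s ^ j ≤ 2 * s ^ j →
      ∏ n (λ u → ∏ n (total u)) ^ j ≤ 2 ^ (n * n + j * #inside) * s ^ (n * n * j)
    ∏-total-power j root = begin
      ∏ n (λ u → ∏ n (total u)) ^ j
        ≡⟨ trans (∏-^ n _ j) (∏-cong n (λ u → ∏-^ n (total u) j)) ⟩
      ∏ n (λ u → ∏ n (λ v → total u v ^ j))
        ≤⟨ ∏-mono n (λ u → ∏-mono n (total-power j root u)) ⟩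
      ∏ n (λ u → ∏ n (λ v → 2 ^ (1 + j * 𝟙 (not (outside u v))) * s ^ j))
        ≡⟨ ∏-cong n (λ u → trans (∏-* n _ _) (cong₂ _*_ (∏-base^ n 2 _) (∏-const n (s ^ j)))) ⟩
      ∏ n (λ u → 2 ^ ∑ V (λ v → 1 + j * 𝟙 (not (outside u v))) * (s ^ j) ^ n)
        ≡⟨ trans (∏-* n _ _) (cong₂ _*_ (∏-base^ n 2 _) (∏-const n ((s ^ j) ^ n))) ⟩
      2 ^ ∑ V (λ u → ∑ V (λ v → 1 + j * 𝟙 (not (outside u v)))) * ((s ^ j) ^ n) ^ n
        ≡⟨ cong₂ (λ x y → 2 ^ x * y) exponent power ⟩
      2 ^ (n * n + j * #inside) * s ^ (n * n * j) ∎
      where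
      open ≤-Reasoning
      exponent : ∑ V (λ u → ∑ V (λ v → 1 + j * 𝟙 (not (outside u v)))) ≡ n * n + j * #inside
      exponent = trans (∑-cong V (λ u → trans (∑-+ V (λ _ → 1) _) (cong₂ _+_
          (trans (∑-Fin-const n 1) (*-identityʳ n)) (∑-*ˡ V j _))))
        (trans (∑-+ V (λ _ → n) _) (cong₂ _+_ (∑-Fin-const n n) (∑-*ˡ V j _)))
      power : ((s ^ j) ^ n) ^ n ≡ s ^ (n * n * j)
      power = trans (^-*-assoc (s ^ j) n n) (trans (^-*-assoc s j (n * n)) (cong (s ^_) (*-comm j (n * n))))

  -- In place of an entropy estimate: beyond one bit for each inside entry, the count costs K log s
  -- + n²/j bits.
  #close-bound : ∀ s j K → 0 < s → suc s ^ j ≤ 2 * s ^ j →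
    #close K ^ j ≤ s ^ (K * j) * 2 ^ (n * n + j * #inside)
  #close-bound s j K 0<s root = *-cancelʳ-≤ _ _ (s ^ (n * n * j)) {{m^n≢0 s (n * n * j) {{>-nonZero 0<s}}}} (begin
    #close K ^ j * s ^ (n * n * j)          ≡⟨ cong (#close K ^ j *_) (sym (^-*-assoc s (n * n) j)) ⟩
    #close K ^ j * (s ^ (n * n)) ^ j        ≡⟨ sym (^-distribʳ-* (#close K) _ j) ⟩
    (#close K * s ^ (n * n)) ^ j            ≤⟨ ^-monoˡ-≤ j (#close-weighted s 0<s K) ⟩
    (s ^ K * ∏ n (λ u → ∏ n (total s u))) ^ j ≡⟨ trans (^-distribʳ-* (s ^ K) _ j) (cong (_* _) (^-*-assoc s K j)) ⟩
    s ^ (K * j) * ∏ n (λ u → ∏ n (total s u)) ^ j ≤⟨ *-monoʳ-≤ (s ^ (K * j)) (∏-total-power s j root) ⟩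
    s ^ (K * j) * (2 ^ (n * n + j * #inside) * s ^ (n * n * j)) ≡⟨ sym (*-assoc (s ^ (K * j)) _ _) ⟩
    s ^ (K * j) * 2 ^ (n * n + j * #inside) * s ^ (n * n * j) ∎)
    where open ≤-Reasoning

-- (1 + 1/s)ʲ ≤ 2 for s = 2j, since (1 − 1/(s+1))ʲ ≥ 1 − j/(s+1).
root-of-2 : ∀ j → suc (2 * j) ^ j ≤ 2 * (2 * j) ^ j
root-of-2 zero        = s≤s z≤n
root-of-2 j@(suc _) = *-cancelˡ-≤ j (begin
  j * suc (2 * j) ^ j          ≡⟨ cong (λ t → j * suc (j + t) ^ j) (+-identityʳ j) ⟩
  j * suc (j + j) ^ j          ≤⟨ go j j ⟩
  (j + j) * (j + j) ^ j        ≡⟨ cong (λ t → (j + t) * (j + t) ^ j) (sym (+-identityʳ j)) ⟩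
  2 * j * (2 * j) ^ j          ≡⟨ e j ((2 * j) ^ j) ⟩
  j * (2 * (2 * j) ^ j)        ∎)
  where
  open ≤-Reasoning
  e : ∀ j u → 2 * j * u ≡ j * (2 * u)
  e = solve-∀
  go : ∀ d i → d * suc (d + i) ^ i ≤ (d + i) * (d + i) ^ i
  go d zero    = ≤-reflexive (cong (_* 1) (sym (+-identityʳ d)))
  go d (suc i) rewrite +-suc d i = begin
    d * (suc (suc (d + i)) * suc (suc (d + i)) ^ i)       ≡⟨ sym (*-assoc d _ _) ⟩
    d * suc (suc (d + i)) * suc (suc (d + i)) ^ i         ≤⟨ *-monoˡ-≤ (suc (suc (d + i)) ^ i) (begin
      d * suc (suc (d + i))                                 ≤⟨ m≤m+n _ (suc i) ⟩
      d * suc (suc (d + i)) + suc i                         ≡⟨ e₂ d i ⟩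
      suc (d + i) * suc d                                   ∎) ⟩
    suc (d + i) * suc d * suc (suc (d + i)) ^ i           ≡⟨ *-assoc (suc (d + i)) (suc d) _ ⟩
    suc (d + i) * (suc d * suc (suc (d + i)) ^ i)         ≤⟨ *-monoʳ-≤ (suc (d + i)) (go (suc d) i) ⟩
    suc (d + i) * (suc (d + i) * suc (d + i) ^ i)         ∎
    where
    e₂ : ∀ d i → d * suc (suc (d + i)) + suc i ≡ suc (d + i) * suc d
    e₂ = solve-∀

#upper : (Fin n → Fin n → Bool) → ℕ
#upper C = #pairs (λ u v → u <ᶠ v ∧ C u v)

<ᶠ-asym : ∀ (u v : Fin n) → T (u <ᶠ v) → ¬ T (v <ᶠ u)
<ᶠ-asym u v u<v v<u = <-asym (<ᵇ⇒< (toℕ u) (toℕ v) u<v) (<ᵇ⇒< (toℕ v) (toℕ u) v<u)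

2*#upper≤#pairs : ∀ (C : Fin n → Fin n → Bool) → Symm C → 2 * #upper C ≤ #pairs C
2*#upper≤#pairs {n} C sym-C = begin
  2 * #upper C
    ≡⟨ cong (#upper C +_) (trans (+-identityʳ _) (∑-swap V V _)) ⟩
  #upper C + ∑ V (λ u → ∑ V (λ v → 𝟙 (v <ᶠ u ∧ C v u)))
    ≡⟨ trans (sym (∑-+ V _ _)) (∑-cong V (λ u → sym (∑-+ V _ _))) ⟩
  ∑ V (λ u → ∑ V (λ v → 𝟙 (u <ᶠ v ∧ C u v) + 𝟙 (v <ᶠ u ∧ C v u)))
    ≤⟨ ∑-mono V (λ u → ∑-mono V (λ v → one (u <ᶠ v) (v <ᶠ u) (<ᶠ-asym u v) (sym-C u v))) ⟩
  #pairs C ∎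
  where
  open ≤-Reasoning
  V = allFin n
  one : ∀ a b {c d} → (T a → ¬ T b) → c ≡ d → 𝟙 (a ∧ c) + 𝟙 (b ∧ d) ≤ 𝟙 c
  one false false _ refl = z≤n
  one false true  _ refl = ≤-refl
  one true  false _ refl = ≤-reflexive (+-identityʳ _)
  one true  true  h _    = ⊥-elim (h _ _)

#<ᶠ : ∀ n → #pairs {n} _<ᶠ_ ≡ binomial n 2
#<ᶠ zero    = refl
#<ᶠ (suc n) = begin
  #pairs {suc n} _<ᶠ_
    ≡⟨ ∑-allFin-suc n (λ u → ∑ (allFin (suc n)) (λ v → 𝟙 (u <ᶠ v))) ⟩
  ∑ (allFin (suc n)) (λ v → 𝟙 (zero <ᶠ v)) +
  ∑ (allFin n) (λ u → ∑ (allFin (suc n)) (λ v → 𝟙 (suc u <ᶠ v)))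
    ≡⟨ cong₂ _+_ (trans (∑-allFin-suc n (λ v → 𝟙 (zero {n} <ᶠ v))) (trans (∑-Fin-const n 1) (*-identityʳ n)))
         (∑-cong (allFin n) (λ u → ∑-allFin-suc n (λ v → 𝟙 (suc u <ᶠ v)))) ⟩
  n + #pairs {n} _<ᶠ_
    ≡⟨ cong₂ _+_ (sym (nC1≡n n)) (#<ᶠ n) ⟩
  binomial n 1 + binomial n 2
    ≡⟨ nCk+nC[k+1]≡[n+1]C[k+1] n 1 ⟩
  binomial (suc n) 2 ∎
  where open ≡-Reasoning

2*binomial+n : ∀ n → 2 * binomial n 2 + n ≡ n * n
2*binomial+n zero    = refl
2*binomial+n (suc n) = begin
  2 * binomial (suc n) 2 + suc n     ≡⟨ cong (λ t → 2 * t + suc n)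
                                          (trans (sym (nCk+nC[k+1]≡[n+1]C[k+1] n 1)) (cong (_+ binomial n 2) (nC1≡n n))) ⟩
  2 * (n + binomial n 2) + suc n     ≡⟨ e₁ n (binomial n 2) ⟩
  (2 * binomial n 2 + n) + (2 * n + 1) ≡⟨ cong (_+ (2 * n + 1)) (2*binomial+n n) ⟩
  n * n + (2 * n + 1)                ≡⟨ e₂ n ⟩
  suc n * suc n                      ∎
  where
  open ≡-Reasoning
  e₁ : ∀ n c → 2 * (n + c) + suc n ≡ (2 * c + n) + (2 * n + 1)
  e₁ = solve-∀
  e₂ : ∀ n → n * n + (2 * n + 1) ≡ suc n * suc n
  e₂ = solve-∀

#inside+binomial : ∀ (F C : Fin n → Fin n → Bool) →
  Close.#inside F C + binomial n 2 ≡ n * n + #upper C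
#inside+binomial {n} F C = begin
  Close.#inside F C + binomial n 2
    ≡⟨ cong (Close.#inside F C +_) (sym (#<ᶠ n)) ⟩
  Close.#inside F C + #pairs {n} _<ᶠ_
    ≡⟨ trans (sym (∑-+ V _ _)) (∑-cong V (λ u → sym (∑-+ V _ _))) ⟩
  ∑ V (λ u → ∑ V (λ v → 𝟙 (not (u <ᶠ v ∧ not (C u v))) + 𝟙 (u <ᶠ v)))
    ≡⟨ ∑-cong V (λ u → ∑-cong V (λ v → pointwise (u <ᶠ v) (C u v))) ⟩
  ∑ V (λ u → ∑ V (λ v → 1 + 𝟙 (u <ᶠ v ∧ C u v)))
    ≡⟨ trans (∑-cong V (λ u → trans (∑-+ V (λ _ → 1) _) (cong (_+ ∑ V (λ v → 𝟙 (u <ᶠ v ∧ C u v)))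
         (trans (∑-Fin-const n 1) (*-identityʳ n)))))
         (trans (∑-+ V (λ _ → n) _) (cong (_+ #upper C) (∑-Fin-const n n))) ⟩
  n * n + #upper C ∎
  where
  open ≡-Reasoning
  V = allFin n
  pointwise : ∀ a c → 𝟙 (not (a ∧ not c)) + 𝟙 a ≡ 1 + 𝟙 (a ∧ c)
  pointwise false c     = refl
  pointwise true  false = refl
  pointwise true  true  = refl

-- The Gilbert-Varshamov count

∈-matrices : ∀ {n k} (g : Vec (Vec Bool n) k) → g ∈ vecs (vecs bools n) k
∈-matrices = ∈-vecs (∈-vecs ∈-bools)

-- Every matrix is close to some member of the family relative to some step graph. Averaging singles
-- out one triple (`i` , `π` , `h`) that accounts for at least the proportion 1/`#codes` of all
-- matrices; `I` is the number of entries this triple leaves free.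
gilbert-varshamov : ∀ {n M m} (𝒢 : Fin M → Graph n) t U K j → 0 < j →
  (∀ (Γ : Graph n) → ∃ λ i → ∃ λ (π : Vec (Fin m) n) → ∃ λ h →
    2 * t * #upper (step-graph π h) ≤ U ×
    #pairs (λ x y → edge? (𝒢 i ⊕ Γ) x y ∧ not (step-graph π h x y)) ≤ K) →
  ∃ λ I → 2 * t * (I + binomial n 2) ≤ 2 * t * (n * n) + U ×
    2 ^ (n * n * j) ≤ (M * (m ^ n * (2 ^ m) ^ m)) ^ j * ((2 * j) ^ (K * j) * 2 ^ (n * n + j * I))
gilbert-varshamov {n} {M} {m} 𝒢 t U K j 0<j cover = I , sizeI , bound
  where
  open ≤-Reasoning
  V = allFin n
  Is = allFin M
  Πs = vecs (allFin m) n
  Hs = vecs (vecs bools m) m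
  -- The edge bound is part of the counted event, so that the triple found by averaging inherits it
  -- from any matrix it covers.
  okay : (Fin n → Fin n → Bool) → Bool
  okay C = does (2 * t * #upper C ≤? U)
  covers : Fin M → Vec (Fin m) n → Vec (Vec Bool m) m → Vec (Vec Bool n) n → Bool
  covers i π h g = okay (step-graph π h) ∧ Close.close (edge? (𝒢 i)) (step-graph π h) K g
  covered : Vec (Vec Bool n) n → ℕ
  covered g = ∑ Is (λ i → ∑ Πs (λ π → ∑ Hs (λ h → 𝟙 (covers i π h g))))
  1≤covered : ∀ g → 1 ≤ covered g
  1≤covered g = let i , π , h , few , close = cover (upper g) in begin
    1
      ≡⟨ sym (𝟙-true (∧-intro (⇒does (2 * t * #upper (step-graph π h) ≤? U) few)
           (⇒does (Close.#exceptions (edge? (𝒢 i)) (step-graph π h) g ≤? K)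
             (≤-trans (exceptions≤ i (step-graph π h) g) close)))) ⟩
    𝟙 (covers i π h g)
      ≤⟨ ≤∑ (λ h → 𝟙 (covers i π h g)) (∈-matrices h) ⟩
    ∑ Hs (λ h → 𝟙 (covers i π h g))
      ≤⟨ ≤∑ (λ π → ∑ Hs (λ h → 𝟙 (covers i π h g))) (∈-vecs ∈.∈-allFin π) ⟩
    ∑ Πs (λ π → ∑ Hs (λ h → 𝟙 (covers i π h g)))
      ≤⟨ ≤∑ (λ i → ∑ Πs (λ π → ∑ Hs (λ h → 𝟙 (covers i π h g)))) (∈.∈-allFin i) ⟩
    covered g ∎
    where
    exceptions≤ : ∀ i C g → Close.#exceptions (edge? (𝒢 i)) C g ≤
      #pairs (λ x y → edge? (𝒢 i ⊕ upper g) x y ∧ not (C x y))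
    exceptions≤ i C g = ∑-mono V (λ u → ∑-mono V (λ v → 𝟙-mono (go u v)))
      where
      shuffle : ∀ a b c {b′} → (T a → b′ ≡ b) → T ((a ∧ c) ∧ b) → T (b′ ∧ c)
      shuffle true true true eq _ = subst (λ z → T (z ∧ true)) (sym (eq _)) _
      go : ∀ u v → T (Close.exception (edge? (𝒢 i)) C u v (lookup (lookup g u) v)) →
        T (edge? (𝒢 i ⊕ upper g) u v ∧ not (C u v))
      go u v = shuffle (u <ᶠ v) (edge? (𝒢 i) u v xor lookup (lookup g u) v) (not (C u v))
        (λ u<v → cong (edge? (𝒢 i) u v xor_) (upper-edge g u v u<v))
  part : Fin M → Vec (Fin m) n → Vec (Vec Bool m) m → ℕ
  part i π h = ∑ (matrices n) (λ g → 𝟙 (covers i π h g))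
  all≤ : 2 ^ (n * n) ≤ ∑ Is (λ i → ∑ Πs (λ π → ∑ Hs (part i π)))
  all≤ = begin
    2 ^ (n * n)                    ≡⟨ sym (trans (∑1≡length (matrices n)) (length-matrices n)) ⟩
    ∑ (matrices n) (λ _ → 1)       ≤⟨ ∑-mono (matrices n) 1≤covered ⟩
    ∑ (matrices n) covered
      ≡⟨ trans (∑-swap (matrices n) Is _) (∑-cong Is (λ i → trans (∑-swap (matrices n) Πs _)
           (∑-cong Πs (λ π → ∑-swap (matrices n) Hs _)))) ⟩
    ∑ Is (λ i → ∑ Πs (λ π → ∑ Hs (part i π))) ∎
  *-pos : ∀ a b → 0 < a * b → 0 < b
  *-pos a zero    0<ab = contradiction (subst (0 <_) (*-zeroʳ a) 0<ab) λ ()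
  *-pos a (suc b) _    = z<s
  step₁ = average≥ Is (λ i → ∑ Πs (λ π → ∑ Hs (part i π))) (<-≤-trans (m^n>0 2 (n * n)) all≤)
  i = proj₁ step₁
  pos₁ = *-pos (length Is) _ (<-≤-trans (<-≤-trans (m^n>0 2 (n * n)) all≤) (proj₂ step₁))
  step₂ = average≥ Πs (λ π → ∑ Hs (part i π)) pos₁
  π = proj₁ step₂
  pos₂ = *-pos (length Πs) _ (<-≤-trans pos₁ (proj₂ step₂))
  step₃ = average≥ Hs (part i π) pos₂
  h = proj₁ step₃
  pos₃ : 0 < part i π h
  pos₃ = *-pos (length Hs) _ (<-≤-trans pos₂ (proj₂ step₃))
  C = step-graph π h
  I = Close.#inside (edge? (𝒢 i)) C
  few : 2 * t * #upper C ≤ U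
  few = let g , g>0 = ∑-pos (matrices n) _ pos₃
        in does⇒ (2 * t * #upper C ≤? U) (∧-fst (𝟙-pos (covers i π h g) g>0))
  sizeI : 2 * t * (I + binomial n 2) ≤ 2 * t * (n * n) + U
  sizeI = begin
    2 * t * (I + binomial n 2)                ≡⟨ cong (2 * t *_) (#inside+binomial (edge? (𝒢 i)) C) ⟩
    2 * t * (n * n + #upper C)                ≡⟨ *-distribˡ-+ (2 * t) (n * n) _ ⟩
    2 * t * (n * n) + 2 * t * #upper C        ≤⟨ +-monoʳ-≤ (2 * t * (n * n)) few ⟩
    2 * t * (n * n) + U                       ∎
  #codes = M * (m ^ n * (2 ^ m) ^ m)
  lenΠ : length Πs ≡ m ^ n
  lenΠ = trans (length-vecs (allFin m) n) (cong (_^ n) (length-allFin m))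
  lenH : length Hs ≡ (2 ^ m) ^ m
  lenH = trans (length-vecs (vecs bools m) m) (cong (_^ m) (length-vecs bools m))
  all≤part : 2 ^ (n * n) ≤ #codes * part i π h
  all≤part = begin
    2 ^ (n * n)                                             ≤⟨ all≤ ⟩
    ∑ Is (λ i → ∑ Πs (λ π → ∑ Hs (part i π)))               ≤⟨ proj₂ step₁ ⟩
    length Is * ∑ Πs (λ π → ∑ Hs (part i π))                ≤⟨ *-monoʳ-≤ (length Is) (proj₂ step₂) ⟩
    length Is * (length Πs * ∑ Hs (part i π))               ≤⟨ *-monoʳ-≤ (length Is) (*-monoʳ-≤ (length Πs) (proj₂ step₃)) ⟩
    length Is * (length Πs * (length Hs * part i π h))      ≡⟨ reassoc (length Is) (length Πs) (length Hs) (part i π h) ⟩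
    length Is * (length Πs * length Hs) * part i π h        ≡⟨ cong (_* part i π h) (cong₂ _*_ (length-allFin M) (cong₂ _*_ lenΠ lenH)) ⟩
    #codes * part i π h                                     ∎
    where
    reassoc : ∀ a b c d → a * (b * (c * d)) ≡ a * (b * c) * d
    reassoc = solve-∀
  part≤ : part i π h ≤ Close.#close (edge? (𝒢 i)) C K
  part≤ = ∑-mono (matrices n) (λ g → 𝟙-mono (∧-snd {okay C}))
  bound : 2 ^ (n * n * j) ≤ #codes ^ j * ((2 * j) ^ (K * j) * 2 ^ (n * n + j * I))
  bound = begin
    2 ^ (n * n * j)                        ≡⟨ sym (^-*-assoc 2 (n * n) j) ⟩
    (2 ^ (n * n)) ^ j                      ≤⟨ ^-monoˡ-≤ j (≤-trans all≤part (*-monoʳ-≤ #codes part≤)) ⟩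
    (#codes * Close.#close (edge? (𝒢 i)) C K) ^ j
      ≡⟨ ^-distribʳ-* #codes _ j ⟩
    #codes ^ j * Close.#close (edge? (𝒢 i)) C K ^ j
      ≤⟨ *-monoʳ-≤ (#codes ^ j) (Close.#close-bound (edge? (𝒢 i)) C (2 * j) j K (≤-trans 0<j (m≤m+n j _)) (root-of-2 j)) ⟩
    #codes ^ j * ((2 * j) ^ (K * j) * 2 ^ (n * n + j * I)) ∎

-- Lower bound

-- t = (p + 1) j + 1 is the least integer above (p + 1) j, as `many-cliques` demands: a symmetric
-- relation missing at most j n²/t pairs has at least n^r/t^(p + 1) cliques, and the 2 in `D₁` turns
-- this into a contradiction. `D` brings the loss 2 q n²/D below n²/κ, with `suc q` keeping it
-- positive. κ = 2 j² lets all exceptions cost n² bits before division by `j`. 1/a is the density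
-- that `container` asks for.
module Parameters (p j q : ℕ) (0<j : 0 < j) (#edges≡q : length (allEdges (suc (suc p))) ≡ q) where
  r t′ t κ D D₁ a σ m : ℕ
  r  = suc (suc p)
  t′ = p * j + 1
  t  = j + t′
  κ  = 2 * (j * j)
  D  = 2 * suc q * κ
  D₁ = 2 * t ^ suc p
  a  = D₁ * (4 * D) ^ q
  σ  = #sampled r D D₁ q
  m  = 2 ^ σ

  t>0 : 0 < t
  t>0 = ≤-trans 0<j (m≤m+n j t′)

  κ>0 : 0 < κ
  κ>0 = *-mono-≤ {1} {2} {1} (s≤s z≤n) (*-mono-≤ 0<j 0<j)

  D>0 : 0 < D
  D>0 = *-mono-≤ {1} {2 * suc q} {1} (s≤s z≤n) κ>0

  a>0 : 0 < a
  a>0 = *-mono-≤ {1} {D₁} {1} (*-mono-≤ {1} {2} {1} (s≤s z≤n) (m^n>0 t {{>-nonZero t>0}} (suc p)))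
    (m^n>0 (4 * D) {{>-nonZero (*-mono-≤ {1} {4} {1} (s≤s z≤n) D>0)}} q)

  instance
    κ-nonZero : NonZero κ
    κ-nonZero = >-nonZero κ>0

  sparse⇒step : ∀ {n} → 0 < n → (G : Graph n) → #cliques (edge? G) r * a ≤ n ^ r →
    ∃ λ (π : Vec (Fin m) n) → ∃ λ h → 2 * t * #upper (step-graph π h) ≤ t′ * (n * n) ×
      #pairs (λ x y → edge? G x y ∧ not (step-graph π h x y)) ≤ n * n / κ
  sparse⇒step {n} 0<n G sparse =
    let C , sym-C , S , meas , len , few , lost = Container.container {r = r} (edge? G) (symm G) D D₁ q #edges≡q 0<n sparse
        π , h , agree = measurable⇒step {r = r} (edge? G) (symm G) S C meas len
    in π , h ,
       subst (λ s → 2 * t * s ≤ t′ * (n * n))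
         (∑-cong V (λ u → ∑-cong V (λ v → cong (λ c → 𝟙 (u <ᶠ v ∧ c)) (sym (agree u v)))))
         (begin
           2 * t * #upper C       ≡⟨ e₁ t (#upper C) ⟩
           t * (2 * #upper C)     ≤⟨ *-monoʳ-≤ t (2*#upper≤#pairs C sym-C) ⟩
           t * #pairs C           ≤⟨ few-edges C sym-C few ⟩
           t′ * (n * n)           ∎) ,
       subst (_≤ n * n / κ)
         (∑-cong V (λ u → ∑-cong V (λ v → cong (λ c → 𝟙 (edge? G u v ∧ not c)) (sym (agree u v)))))
         (subst (_≤ n * n / κ) (m*n/n≡m _ κ) (/-monoˡ-≤ κ (*-cancelˡ-≤ (2 * suc q) (begin
           2 * suc q * (#lost C * κ)        ≡⟨ e₂ (2 * suc q) (#lost C) κ ⟩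
           #lost C * D                      ≤⟨ lost ⟩
           q * (2 * (n * n))                ≤⟨ *-monoˡ-≤ (2 * (n * n)) (n≤1+n q) ⟩
           suc q * (2 * (n * n))            ≡⟨ e₃ (suc q) (n * n) ⟩
           2 * suc q * (n * n)              ∎))))
    where
    open ≤-Reasoning
    V = allFin n
    #lost : (Fin n → Fin n → Bool) → ℕ
    #lost C = #pairs (λ x y → edge? G x y ∧ not (C x y))
    e₁ : ∀ t u → 2 * t * u ≡ t * (2 * u)
    e₁ = solve-∀
    e₂ : ∀ u l κ → u * (l * κ) ≡ l * (u * κ)
    e₂ = solve-∀
    e₃ : ∀ u v → u * (2 * v) ≡ 2 * u * v
    e₃ = solve-∀
    e₄ : ∀ c t u → t * c + t * c ≡ c * (2 * t)
    e₄ = solve-∀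
    few-edges : ∀ C → Symm C → #cliques C r * D₁ ≤ n ^ r → t * #pairs C ≤ t′ * (n * n)
    few-edges C sym-C few with t * (n * n) ≤? t * #pairs C + j * (n * n)
    ... | no ≰ = +-cancelʳ-≤ (j * (n * n)) _ _ (≤-trans (<⇒≤ (≰⇒> ≰))
      (≤-reflexive (trans (*-distribʳ-+ (n * n) j t′) (+-comm (j * (n * n)) _))))
    ... | yes full = contradiction doubled (<⇒≱ (m<m+n (n ^ r) (m^n>0 n {{>-nonZero 0<n}} r)))
      where
      pj<t : suc p * j < t
      pj<t = ≤-reflexive (trans (+-comm 1 _) (+-assoc j (p * j) 1))
      many : n ^ r ≤ t ^ suc p * #cliques C r
      many = many-cliques C sym-C (suc p) j t pj<t full (suc p) ≤-refl
      doubled : n ^ r + n ^ r ≤ n ^ r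
      doubled = ≤-trans (+-mono-≤ many many)
        (≤-trans (≤-reflexive (e₄ (#cliques C r) (t ^ suc p) 0)) few)

module _ {l} (L : Graph l) (has-edge : HasEdge L) where

  no-copies-of-itself : ∀ {n k} → 1 ≤ k → (G H : Graph n) → ContainsDisjointCopies k L (G ⊕ H) → ¬ G ≈ᴳ H
  no-copies-of-itself {k = suc k} _ G H (f , _ , copy) G≈H =
    let u , v , e = has-edge in
    subst T (trans (cong (_xor edge? H (f (zero , u)) (f (zero , v))) (G≈H (f (zero , u)) (f (zero , v)))) (xor-same (edge? H (f (zero , u)) (f (zero , v)))))
      (copy zero u v e)

  copies-sym : ∀ {n k} (G H : Graph n) → ContainsDisjointCopies k L (G ⊕ H) → ContainsDisjointCopies k L (H ⊕ G)
  copies-sym G H (f , inj , copy) = f , inj , λ i u v e →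
    subst T (xor-comm (edge? G (f (i , u)) (f (i , v))) _) (copy i u v e)

  -- Otherwise Γ could be added to the family. `Sparse` is a decidable consequence of the lack of
  -- `k` disjoint copies. Distinctness from Γ follows from the copies, as k ≥ 1 and `L` has an edge.
  maximal⇒covering : ∀ {n k M} → 1 ≤ k → ((𝒢 , _) : IsMaxCodeSize k L n M) →
    (Sparse : Graph n → Set) (sparse? : ∀ G → Dec (Sparse G)) →
    (∀ G → ¬ Sparse G → ContainsDisjointCopies k L G) →
    ∀ Γ → ∃ λ i → Sparse (proj₁ 𝒢 i ⊕ Γ)
  maximal⇒covering {n} {k} {M} 1≤k ((𝒢 , distinct , copies) , max) Sparse sparse? dense⇒copies Γ
    with Fin.any? (λ i → sparse? (𝒢 i ⊕ Γ))
  ... | yes h  = h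
  ... | no  ¬h = contradiction (max (suc M) (𝒢′ , distinct′ , copies′)) 1+n≰n
    where
    new : ∀ i → ContainsDisjointCopies k L (𝒢 i ⊕ Γ)
    new i = dense⇒copies (𝒢 i ⊕ Γ) (λ s → ¬h (i , s))
    𝒢′ : Fin (suc M) → Graph n
    𝒢′ zero    = Γ
    𝒢′ (suc i) = 𝒢 i
    copies′ : ∀ i j → i ≢ j → ContainsDisjointCopies k L (𝒢′ i ⊕ 𝒢′ j)
    copies′ zero    zero    i≢j = contradiction refl i≢j
    copies′ zero    (suc j) _   = copies-sym (𝒢 j) Γ (new j)
    copies′ (suc i) zero    _   = new i
    copies′ (suc i) (suc j) i≢j = copies i j (i≢j ∘ cong suc)
    distinct′ : ∀ i j → i ≢ j → ¬ 𝒢′ i ≈ᴳ 𝒢′ j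
    distinct′ i j i≢j = no-copies-of-itself 1≤k (𝒢′ i) (𝒢′ j) (copies′ i j i≢j)

-- From the count to a lower bound for the logarithm

n<2^n : ∀ n → n < 2 ^ n
n<2^n zero    = z<s
n<2^n (suc n) = ≤-trans (+-mono-≤ (m^n>0 2 n) (n<2^n n))
  (≤-reflexive (cong (2 ^ n +_) (sym (+-identityʳ (2 ^ n)))))

module Exponents (j t′ σ m : ℕ) (m≡2^σ : m ≡ 2 ^ σ) where
  t = j + t′

  -- The counting bound is raised to the power i + 1 because `⌊log₂ M ^ suc i ⌋` is the numerator of
  -- the `i`-th approximation to log M. Of the 2 n², one n² pays for the exceptions, the other for
  -- the slack in `total-power`.
  exponents : ∀ n M I i K → K * (2 * (j * j)) ≤ n * n →
    2 ^ (n * n * j) ≤ (M * (m ^ n * (2 ^ m) ^ m)) ^ j * ((2 * j) ^ (K * j) * 2 ^ (n * n + j * I)) →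
    n * n * j * suc i ≤ suc ⌊log₂ M ^ suc i ⌋ * j + ((σ * n + m * m) * j + 2 * (n * n) + j * I) * suc i
  exponents n M I i K hK h = 2^-cancel (begin
    2 ^ (n * n * j * e)
      ≡⟨ sym (^-*-assoc 2 (n * n * j) e) ⟩
    (2 ^ (n * n * j)) ^ e
      ≤⟨ ^-monoˡ-≤ e h ⟩
    ((M * codes) ^ j * (rest₁ * rest₂)) ^ e
      ≡⟨ trans (^-distribʳ-* ((M * codes) ^ j) (rest₁ * rest₂) e)
           (cong (λ z → z * (rest₁ * rest₂) ^ e) (trans (cong (_^ e) (^-distribʳ-* M codes j))
             (^-distribʳ-* (M ^ j) (codes ^ j) e))) ⟩
    (M ^ j) ^ e * (codes ^ j) ^ e * (rest₁ * rest₂) ^ e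
      ≤⟨ *-mono-≤ (*-mono-≤ M≤ (≤-reflexive codes≡)) (^-monoˡ-≤ e (*-monoˡ-≤ rest₂ rest≤)) ⟩
    2 ^ (suc b * j) * 2 ^ ((σ * n + m * m) * j * e) * (2 ^ (n * n) * rest₂) ^ e
      ≡⟨ cong (2 ^ (suc b * j) * 2 ^ ((σ * n + m * m) * j * e) *_) (trans
           (cong (_^ e) (sym (^-distribˡ-+-* 2 (n * n) (n * n + j * I)))) (^-*-assoc 2 (n * n + (n * n + j * I)) e)) ⟩
    2 ^ (suc b * j) * 2 ^ ((σ * n + m * m) * j * e) * 2 ^ ((n * n + (n * n + j * I)) * e)
      ≡⟨ trans (cong (_* 2 ^ ((n * n + (n * n + j * I)) * e)) (sym (^-distribˡ-+-* 2 (suc b * j) ((σ * n + m * m) * j * e))))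
           (sym (^-distribˡ-+-* 2 (suc b * j + (σ * n + m * m) * j * e) ((n * n + (n * n + j * I)) * e))) ⟩
    2 ^ (suc b * j + (σ * n + m * m) * j * e + (n * n + (n * n + j * I)) * e)
      ≡⟨ cong (2 ^_) (collect (suc b * j) ((σ * n + m * m) * j) (n * n) (j * I) e) ⟩
    2 ^ (suc b * j + ((σ * n + m * m) * j + 2 * (n * n) + j * I) * e) ∎)
    where
    open ≤-Reasoning
    e = suc i
    b = ⌊log₂ M ^ suc i ⌋
    codes = m ^ n * (2 ^ m) ^ m
    rest₁ = (2 * j) ^ (K * j)
    rest₂ = 2 ^ (n * n + j * I)
    collect : ∀ x y z w e → x + y * e + (z + (z + w)) * e ≡ x + (y + 2 * z + w) * e
    collect = solve-∀
    M≤ : (M ^ j) ^ e ≤ 2 ^ (suc b * j)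
    M≤ = begin
      (M ^ j) ^ e      ≡⟨ trans (^-*-assoc M j e) (trans (cong (M ^_) (*-comm j e)) (sym (^-*-assoc M e j))) ⟩
      (M ^ e) ^ j      ≤⟨ ^-monoˡ-≤ j (<⇒≤ (<2^1+⌊log₂⌋ (M ^ e))) ⟩
      (2 ^ suc b) ^ j  ≡⟨ ^-*-assoc 2 (suc b) j ⟩
      2 ^ (suc b * j)  ∎
    codes≡ : (codes ^ j) ^ e ≡ 2 ^ ((σ * n + m * m) * j * e)
    codes≡ = begin-equality
      (codes ^ j) ^ e                           ≡⟨ ^-*-assoc codes j e ⟩
      codes ^ (j * e)                           ≡⟨ cong (_^ (j * e)) (trans (cong₂ _*_ (trans (cong (_^ n) m≡2^σ) (^-*-assoc 2 σ n)) (^-*-assoc 2 m m))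
                                                     (sym (^-distribˡ-+-* 2 (σ * n) (m * m)))) ⟩
      (2 ^ (σ * n + m * m)) ^ (j * e)           ≡⟨ trans (^-*-assoc 2 (σ * n + m * m) (j * e)) (cong (2 ^_) (sym (*-assoc (σ * n + m * m) j e))) ⟩
      2 ^ ((σ * n + m * m) * j * e)             ∎
    -- The crude 2 j < 2^(2 j) suffices: the exponent 2 j² K is at most n² by the choice of κ.
    rest≤ : rest₁ ≤ 2 ^ (n * n)
    rest≤ = begin
      (2 * j) ^ (K * j)                 ≤⟨ ^-monoˡ-≤ (K * j) (<⇒≤ (n<2^n (2 * j))) ⟩
      (2 ^ (2 * j)) ^ (K * j)           ≡⟨ ^-*-assoc 2 (2 * j) _ ⟩
      2 ^ (2 * j * (K * j))             ≤⟨ ^-monoʳ-≤ 2 (≤-trans (≤-reflexive (e₁ j K)) hK) ⟩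
      2 ^ (n * n)                               ∎
      where
      e₁ : ∀ j k → 2 * j * (k * j) ≡ k * (2 * (j * j))
      e₁ = solve-∀

  -- After division, the rate is at least j/t - 6/j. Of the six errors t n², one is the rounding of
  -- the logarithm, one absorbs the containers and the term `n` in n² = 2 `binomial n 2` + n, and
  -- four come from the 2 n² in `exponents`.
  combine : ∀ n I i b → j * (1 + 2 * σ + 2 * (m * m)) + 2 * j ≤ n → 0 < n →
    2 * t * (I + binomial n 2) ≤ 2 * t * (n * n) + t′ * (n * n) →
    n * n * j * suc i ≤ suc b * j + ((σ * n + m * m) * j + 2 * (n * n) + j * I) * suc i →
    j * j * (binomial n 2 * suc i) ≤ t * j * b + 6 * t * (binomial n 2 * suc i)
  -- Replacing n² by 2 `binomial n 2` in `main` goes the right way if the coefficient j² - 6 t is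
  -- nonnegative; otherwise the claim is trivial.
  combine n I i b large 0<n hI hE with j * j ≤? 6 * t
  ... | yes jj≤6t = ≤-trans (*-monoˡ-≤ _ jj≤6t) (m≤n+m _ (t * j * b))
  ... | no jj≰6t with m≤n⇒∃[o]m+o≡n (<⇒≤ (≰⇒> jj≰6t))
  ...   | d , 6t+d≡jj = subst (λ z → z * (N * e) ≤ t * j * b + 6 * t * (N * e)) 6t+d≡jj
    (subst₂ _≤_ (sym (trans (*-distribʳ-+ (N * e) (6 * t) d) (+-comm (6 * t * (N * e)) _))) refl
      (+-monoˡ-≤ (6 * t * (N * e)) (*-cancelˡ-≤ 2 (begin
        2 * (d * (N * e))            ≡⟨ s₁ d N e ⟩
        d * (2 * N * e)              ≤⟨ *-monoʳ-≤ d (*-monoˡ-≤ e 2N≤nn) ⟩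
        d * (nn * e)                 ≤⟨ +-cancelʳ-≤ (6 * t * (nn * e)) _ _ (begin
          d * (nn * e) + 6 * t * (nn * e)    ≡⟨ trans (+-comm (d * (nn * e)) _) (trans (sym (*-distribʳ-+ (nn * e) (6 * t) d)) (cong (_* (nn * e)) 6t+d≡jj)) ⟩
          j * j * (nn * e)                   ≤⟨ main ⟩
          2 * (t * j * b) + 6 * t * (nn * e) ∎) ⟩
        2 * (t * j * b)              ∎))))
    where
    open ≤-Reasoning
    e = suc i
    N = binomial n 2
    nn = n * n
    s₁ : ∀ d N e → 2 * (d * (N * e)) ≡ d * (2 * N * e)
    s₁ = solve-∀
    2N≤nn : 2 * N ≤ nn
    2N≤nn = ≤-trans (m≤m+n (2 * N) n) (≤-reflexive (2*binomial+n n))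
    x = σ * n + m * m
    n≤nn : n ≤ nn
    n≤nn = m≤m*n n n {{>-nonZero 0<n}}
    small₁ : j * (n + 2 * x) ≤ nn
    small₁ = begin
      j * (n + 2 * (σ * n + m * m))             ≤⟨ *-monoʳ-≤ j (+-monoʳ-≤ n (*-monoʳ-≤ 2 (+-monoʳ-≤ (σ * n)
                                                     (m≤m*n (m * m) n {{>-nonZero 0<n}})))) ⟩
      j * (n + 2 * (σ * n + m * m * n))         ≡⟨ s₂ j n σ (m * m) ⟩
      j * (1 + 2 * σ + 2 * (m * m)) * n         ≤⟨ *-monoˡ-≤ n (≤-trans (m≤m+n (j * (1 + 2 * σ + 2 * (m * m))) (2 * j)) large) ⟩
      n * n                                     ∎
      where
      s₂ : ∀ j n σ w → j * (n + 2 * (σ * n + w * n)) ≡ j * (1 + 2 * σ + 2 * w) * n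
      s₂ = solve-∀
    small₂ : 2 * j ≤ nn * e
    small₂ = ≤-trans (≤-trans (m≤n+m (2 * j) (j * (1 + 2 * σ + 2 * (m * m)))) large) (≤-trans n≤nn (m≤m*n nn e))
    main : j * j * (nn * e) ≤ 2 * (t * j * b) + 6 * t * (nn * e)
    main = +-cancelʳ-≤ (j * t′ * (nn * e) + 2 * t * (nn * j * e)) _ _ (begin
      j * j * (nn * e) + (j * t′ * (nn * e) + 2 * t * (nn * j * e))
        ≡⟨ s₃ j t′ (nn * e) (2 * t * (nn * j * e)) ⟩
      t * j * (nn * e) + 2 * t * (nn * j * e)
        ≡⟨ cong (λ z → t * j * (z * e) + 2 * t * (nn * j * e)) (sym (2*binomial+n n)) ⟩
      t * j * ((2 * N + n) * e) + 2 * t * (nn * j * e)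
        ≤⟨ +-monoʳ-≤ (t * j * ((2 * N + n) * e)) (*-monoʳ-≤ (2 * t) hE) ⟩
      t * j * ((2 * N + n) * e) + 2 * t * (suc b * j + (x * j + 2 * nn + j * I) * e)
        ≡⟨ s₄ t j N n e b x nn I ⟩
      2 * (t * j * b) + t * (2 * j) + t * (j * (n + 2 * x)) * e + 4 * t * (nn * e) + j * e * (2 * t * (I + N))
        ≤⟨ +-mono-≤ (+-monoˡ-≤ (4 * t * (nn * e)) (+-mono-≤
             (+-monoʳ-≤ (2 * (t * j * b)) (*-monoʳ-≤ t small₂))
             (*-monoˡ-≤ e (*-monoʳ-≤ t small₁)))) (*-monoʳ-≤ (j * e) hI) ⟩
      2 * (t * j * b) + t * (nn * e) + t * nn * e + 4 * t * (nn * e) + j * e * (2 * t * nn + t′ * nn)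
        ≡⟨ s₅ t t′ j b nn e ⟩
      2 * (t * j * b) + 6 * t * (nn * e) + (j * t′ * (nn * e) + 2 * t * (nn * j * e)) ∎)
      where
      s₃ : ∀ j t′ u v → j * j * u + (j * t′ * u + v) ≡ (j + t′) * j * u + v
      s₃ = solve-∀
      s₄ : ∀ t j N n e b x nn I →
        t * j * ((2 * N + n) * e) + 2 * t * (suc b * j + (x * j + 2 * nn + j * I) * e) ≡
        2 * (t * j * b) + t * (2 * j) + t * (j * (n + 2 * x)) * e + 4 * t * (nn * e) + j * e * (2 * t * (I + N))
      s₄ = solve-∀
      s₅ : ∀ t t′ j b nn e →
        2 * (t * j * b) + t * (nn * e) + t * nn * e + 4 * t * (nn * e) + j * e * (2 * t * nn + t′ * nn) ≡
        2 * (t * j * b) + 6 * t * (nn * e) + (j * t′ * (nn * e) + 2 * t * (nn * j * e))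
      s₅ = solve-∀

module LowerBound (p j q : ℕ) (0<j : 0 < j) (#edges≡q : length (allEdges (suc (suc p))) ≡ q) where
  open Parameters p j q 0<j #edges≡q
  open Exponents j t′ σ m refl using (exponents; combine)

  threshold : ℕ → ℕ
  threshold l = boxSize l r (2 * a) + (j * (1 + 2 * σ + 2 * (m * m)) + 2 * j)

  lower-bound : ∀ {l} (L : Graph l) → HasEdge L → Colorable L r → ∀ n k M → threshold l ≤ n →
    1 ≤ k → 2 * a * r * l * k ≤ n → IsMaxCodeSize k L n M → ∀ i →
    j * j * (binomial n 2 * suc i) ≤ t * j * ⌊log₂ M ^ suc i ⌋ + 6 * t * (binomial n 2 * suc i)
  lower-bound {l} L has-edge (col , proper) n k M n-large 1≤k k-small isMax i =
    let I , sizeI , bound = gilbert-varshamov (proj₁ (proj₁ isMax)) t (t′ * (n * n)) (n * n / κ) j 0<j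
          (λ Γ → let i , sparse = covering Γ in i , sparse⇒step 0<n (proj₁ (proj₁ isMax) i ⊕ Γ) sparse)
    in combine n I i ⌊log₂ M ^ suc i ⌋ (≤-trans (m≤n+m _ (boxSize l r (2 * a))) n-large) 0<n sizeI
         (exponents n M I i (n * n / κ) (m/n*n≤m (n * n) κ) bound)
    where
    box-small : boxSize l r (2 * a) ≤ n
    box-small = ≤-trans (m≤m+n _ _) n-large
    0<n : 0 < n
    0<n = ≤-trans (boxSize>0 l r (2 * a)) box-small
    e : ∀ u l k → u * (k * l) ≡ u * l * k
    e = solve-∀
    covering : ∀ Γ → ∃ λ i → #cliques (edge? (proj₁ (proj₁ isMax) i ⊕ Γ)) r * a ≤ n ^ r
    covering = maximal⇒covering L has-edge 1≤k isMax (λ G → #cliques (edge? G) r * a ≤ n ^ r)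
      (λ G → #cliques (edge? G) r * a ≤? n ^ r)
      (λ G dense → Copies.dense⇒copies L col proper G a a>0 box-small
        (≤-trans (<⇒≤ (≰⇒> dense)) (≤-reflexive (*-comm (#cliques (edge? G) r) a))) k
        (≤-trans (≤-reflexive (e (2 * a * r) l k)) k-small))

-- What matters for the limit is that `N` and `κ` depend on `p`, `j` and `L`, but not on `n`, `k` or
-- `M`; their enormous values stay hidden.
eventual-lower-bound : ∀ p j → 0 < j → ∀ {l} (L : Graph l) → HasEdge L → Colorable L (suc (suc p)) →
  ∃ λ N → ∃ λ κ → ∀ n k M → N ≤ n → 1 ≤ k → κ * k ≤ n → IsMaxCodeSize k L n M → ∀ i →
  let t = j + (p * j + 1) in
  j * j * (binomial n 2 * suc i) ≤ t * j * ⌊log₂ M ^ suc i ⌋ + 6 * t * (binomial n 2 * suc i)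
eventual-lower-bound p j 0<j {l} L has-edge colorable = threshold l , 2 * a * r * l ,
  lower-bound L has-edge colorable
  where
  q = length (allEdges (suc (suc p)))
  open Parameters p j q 0<j refl using (a; r)
  open LowerBound p j q 0<j refl

-- Upper bound

-- `nothing` marks the special vertices. They are joined to everything in H, so `same`, which
-- describes non-adjacency in H, is false on them.
same : ∀ {c} → Maybe (Fin c) → Maybe (Fin c) → Bool
same (just a) (just b) = does (b Fin.≟ a)
same _        _        = false

special : Maybe A → Bool
special nothing  = true
special (just _) = false

#mono : ∀ {c} → Vec (Maybe (Fin c)) n → ℕ
#mono κ = #pairs (λ u v → u <ᶠ v ∧ same (lookup κ u) (lookup κ v))

#mono-∷ : ∀ {c} x (κ : Vec (Maybe (Fin c)) n) →
  #mono (x ∷ κ) ≡ ∑ (allFin n) (λ v → 𝟙 (same x (lookup κ v))) + #mono κ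
#mono-∷ {n} x κ = trans (∑-allFin-suc n (λ u → ∑ (allFin (suc n)) (λ v → 𝟙 (u <ᶠ v ∧ same (lookup (x ∷ κ) u) (lookup (x ∷ κ) v)))))
  (cong₂ _+_ (∑-allFin-suc n (λ v → 𝟙 (zero {n} <ᶠ v ∧ same x (lookup (x ∷ κ) v))))
    (∑-cong (allFin n) (λ u → ∑-allFin-suc n (λ v → 𝟙 (suc u <ᶠ v ∧ same (lookup κ u) (lookup (x ∷ κ) v))))))

-- After s special vertices, each vertex gets a colour that is used least so far.
balanced-colouring : ∀ c n s → ∃ λ (κ : Vec (Maybe (Fin (suc c))) n) →
  ∑ (allFin n) (λ u → 𝟙 (special (lookup κ u))) ≤ s ×
  2 * suc c * #mono κ ≤ (n ∸ s) * (n ∸ s ∸ 1)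
balanced-colouring c zero    s = [] , z≤n , ≤-trans (≤-reflexive (*-zeroʳ (2 * suc c))) z≤n
balanced-colouring c (suc n) (suc s) with balanced-colouring c n s
... | κ , few , mono = nothing ∷ κ ,
  ≤-trans (≤-reflexive (∑-allFin-suc n (λ u → 𝟙 (special (lookup (nothing ∷ κ) u))))) (s≤s few) ,
  subst (λ z → 2 * suc c * z ≤ (n ∸ s) * (n ∸ s ∸ 1))
    (sym (trans (#mono-∷ nothing κ) (cong (_+ #mono κ) (∑-zero (allFin n))))) mono
balanced-colouring c (suc n) zero with balanced-colouring c n zero
... | κ , few , mono = just (proj₁ least) ∷ κ ,
  ≤-trans (≤-reflexive (∑-allFin-suc n (λ u → 𝟙 (special (lookup (just (proj₁ least) ∷ κ) u))))) few ,
  (begin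
    2 * suc c * #mono (just (proj₁ least) ∷ κ)    ≡⟨ cong (2 * suc c *_) (#mono-∷ _ κ) ⟩
    2 * suc c * (usage (proj₁ least) + #mono κ)   ≡⟨ e₁ (suc c) (usage (proj₁ least)) (#mono κ) ⟩
    2 * (suc c * usage (proj₁ least)) + 2 * suc c * #mono κ ≤⟨ +-mono-≤ (*-monoʳ-≤ 2 (proj₂ least)) mono ⟩
    2 * n + n * (n ∸ 1)                           ≡⟨ e₂ n ⟩
    suc n * n                                     ∎)
  where
  open ≤-Reasoning
  e₁ : ∀ c u m → 2 * c * (u + m) ≡ 2 * (c * u) + 2 * c * m
  e₁ = solve-∀
  e₂ : ∀ n → 2 * n + n * (n ∸ 1) ≡ suc n * n
  e₂ zero    = refl
  e₂ (suc n) = e₃ n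
    where
    e₃ : ∀ n → 2 * suc n + suc n * n ≡ suc (suc n) * suc n
    e₃ = solve-∀
  usage : Fin (suc c) → ℕ
  usage x = ∑ (allFin n) (λ v → 𝟙 (same (just x) (lookup κ v)))
  once : ∀ y → ∑ (allFin (suc c)) (λ x → 𝟙 (same (just x) y)) ≤ 1
  once (just a) = ≤-reflexive (∑-δ a)
  once nothing  = ≤-trans (≤-reflexive (∑-zero (allFin (suc c)))) z≤n
  least : ∃ λ x → suc c * usage x ≤ n
  least = average≤ (allFin (suc c)) (λ x → suc c * usage x) n (subst (0 <_) (sym (length-allFin (suc c))) z<s) (begin
    ∑ (allFin (suc c)) (λ x → suc c * usage x)
      ≡⟨ trans (∑-*ˡ (allFin (suc c)) (suc c) usage) (cong (suc c *_) (∑-swap (allFin (suc c)) (allFin n) _)) ⟩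
    suc c * ∑ (allFin n) (λ v → ∑ (allFin (suc c)) (λ x → 𝟙 (same (just x) (lookup κ v))))
      ≤⟨ *-monoʳ-≤ (suc c) (≤-trans (∑-mono (allFin n) (λ v → once (lookup κ v)))
           (≤-reflexive (trans (∑-Fin-const n 1) (*-identityʳ n)))) ⟩
    suc c * n
      ≡⟨ cong (_* n) (sym (length-allFin (suc c))) ⟩
    length (allFin (suc c)) * n ∎)

∑-cartesianProduct : ∀ {A B : Set} (xs : List A) (ys : List B) f →
  ∑ (List.cartesianProduct xs ys) f ≡ ∑ xs (λ x → ∑ ys (λ y → f (x , y)))
∑-cartesianProduct []       ys f = refl
∑-cartesianProduct (x ∷ xs) ys f = trans (∑-++ (List.map (x ,_) ys) _ f)
  (cong₂ _+_ (∑-map (x ,_) ys f) (∑-cartesianProduct xs ys f))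

injective⇒≤# : ∀ {k} (g : Fin k → Fin n) → Injective _≡_ _≡_ g → (p : Fin n → Bool) →
  (∀ i → T (p (g i))) → k ≤ ∑ (allFin n) (𝟙 ∘ p)
injective⇒≤# {n} {k} g inj p all-p = begin
  k
    ≡⟨ sym (trans (∑-Fin-const k 1) (*-identityʳ k)) ⟩
  ∑ (allFin k) (λ _ → 1)
    ≡⟨ ∑-cong (allFin k) (λ i → sym (∑-δ (g i))) ⟩
  ∑ (allFin k) (λ i → ∑ (allFin n) (λ v → 𝟙 (does (g i Fin.≟ v))))
    ≡⟨ ∑-swap (allFin k) (allFin n) _ ⟩
  ∑ (allFin n) (λ v → ∑ (allFin k) (λ i → 𝟙 (does (g i Fin.≟ v))))
    ≤⟨ ∑-mono (allFin n) (λ v → fibre v (Fin.any? (λ i → g i Fin.≟ v))) ⟩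
  ∑ (allFin n) (𝟙 ∘ p) ∎
  where
  open ≤-Reasoning
  fibre : ∀ v → Dec (∃ λ i → g i ≡ v) → ∑ (allFin k) (λ i → 𝟙 (does (g i Fin.≟ v))) ≤ 𝟙 (p v)
  fibre v (no ∄) = ≤-trans (≤-reflexive (trans (∑-cong (allFin k) (λ i →
    𝟙-false (λ t → ∄ (i , does⇒ (g i Fin.≟ v) t)))) (∑-zero (allFin k)))) z≤n
  fibre v (yes (i , refl)) = begin
    ∑ (allFin k) (λ j → 𝟙 (does (g j Fin.≟ g i)))  ≤⟨ ∑-mono (allFin k) (λ j → 𝟙-mono (λ t →
                                                      ⇒does (i Fin.≟ j) (sym (inj (does⇒ (g j Fin.≟ g i) t))))) ⟩
    ∑ (allFin k) (λ j → 𝟙 (does (i Fin.≟ j)))      ≡⟨ ∑-δ i ⟩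
    1                                              ≡⟨ sym (𝟙-true (all-p i)) ⟩
    𝟙 (p (g i))                                    ∎

-- Two members of the family that agree on the non-edges of H, the join of s
-- vertices and a complete (c + 1)-partite graph, differ by a subgraph of H, but
-- each copy of L in H uses one of the s special vertices.
code-upper-bound : ∀ {l} (L : Graph l) c → ¬ Colorable L (suc c) → ∀ s n M → HasCodeOfSize (suc s) L n M →
  ∃ λ e → M ≤ 2 ^ e × 2 * suc c * e ≤ (n ∸ s) * (n ∸ s ∸ 1)
code-upper-bound {l} L c uncolorable s n M (𝒢 , _ , copies) with balanced-colouring c n s
... | κ , few , mono = length nonEdges , small , subst (λ z → 2 * suc c * z ≤ (n ∸ s) * (n ∸ s ∸ 1)) (sym size) mono
  where
  nonEdge : Fin n × Fin n → Bool
  nonEdge (u , v) = u <ᶠ v ∧ same (lookup κ u) (lookup κ v)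
  nonEdges : List (Fin n × Fin n)
  nonEdges = List.filter (T? ∘ nonEdge) (List.cartesianProduct (allFin n) (allFin n))
  size : length nonEdges ≡ #mono κ
  size = trans (length-filter nonEdge (List.cartesianProduct (allFin n) (allFin n)))
    (∑-cartesianProduct (allFin n) (allFin n) (𝟙 ∘ nonEdge))
  word : Fin M → Fin (length nonEdges) → Bool
  word i e = edge? (𝒢 i) (proj₁ (List.lookup nonEdges e)) (proj₂ (List.lookup nonEdges e))

  module _ (i j : Fin M) (i≢j : i ≢ j) (agree : ∀ e → word i e ≡ word j e) where
    f = proj₁ (copies i j i≢j)
    f-injective = proj₁ (proj₂ (copies i j i≢j))

    agree-on : ∀ u v → T (u <ᶠ v) → T (same (lookup κ u) (lookup κ v)) → ¬ Edge (𝒢 i ⊕ 𝒢 j) u v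
    agree-on u v u<v t e = subst T (trans (cong (_xor edge? (𝒢 j) u v) eq) (xor-same (edge? (𝒢 j) u v))) e
      where
      uv∈ : (u , v) ∈ nonEdges
      uv∈ = ∈.∈-filter⁺ (T? ∘ nonEdge) (∈.∈-cartesianProduct⁺ (∈.∈-allFin u) (∈.∈-allFin v)) (∧-intro u<v t)
      eq : edge? (𝒢 i) u v ≡ edge? (𝒢 j) u v
      eq = subst (λ w → edge? (𝒢 i) (proj₁ w) (proj₂ w) ≡ edge? (𝒢 j) (proj₁ w) (proj₂ w))
        (sym (Any.lookup-index uv∈)) (agree (Any.index uv∈))

    proper : ∀ u v → Edge (𝒢 i ⊕ 𝒢 j) u v → ∀ {a b} → lookup κ u ≡ just a → lookup κ v ≡ just b → a ≢ b
    proper u v e {a} eu ev refl with Fin.<-cmp u v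
    ... | tri< u<v _ _ = agree-on u v (<⇒<ᵇ u<v) same-uv e
      where
      same-uv : T (same (lookup κ u) (lookup κ v))
      same-uv rewrite eu | ev = ⇒does (a Fin.≟ a) refl
    ... | tri≈ _ refl _ = subst T (irrefl (𝒢 i ⊕ 𝒢 j) u) e
    ... | tri> _ _ v<u = agree-on v u (<⇒<ᵇ v<u) same-vu (subst T (symm (𝒢 i ⊕ 𝒢 j) u v) e)
      where
      same-vu : T (same (lookup κ v) (lookup κ u))
      same-vu rewrite eu | ev = ⇒does (a Fin.≟ a) refl

    -- A copy without special vertices would inherit a proper (c + 1)-colouring from `κ`, as the
    -- difference has no edge within a colour class.
    has-special : ∀ x → ∃ λ u → T (special (lookup κ (f (x , u))))
    has-special x with Fin.any? (λ u → T? (special (lookup κ (f (x , u)))))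
    ... | yes h = h
    ... | no ¬h = contradiction (colour , λ u v e →
            proper (f (x , u)) (f (x , v)) (proj₂ (proj₂ (copies i j i≢j)) x u v e)
              (is-just u) (is-just v)) uncolorable
      where
      decide : ∀ u → ∃ λ a → lookup κ (f (x , u)) ≡ just a
      decide u with lookup κ (f (x , u)) in eq
      ... | just a  = a , refl
      ... | nothing = contradiction (u , subst (T ∘ special) (sym eq) _) ¬h
      colour : Fin l → Fin (suc c)
      colour u = proj₁ (decide u)
      is-just : ∀ u → lookup κ (f (x , u)) ≡ just (colour u)
      is-just u = proj₂ (decide u)

    impossible : ⊥
    -- Special vertices chosen in disjoint copies are distinct: s + 1 of them, where at most s
    -- exist.
    impossible = 1+n≰n (≤-trans (injective⇒≤# (λ x → f (x , proj₁ (has-special x)))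
      (λ {x} {y} eq → cong proj₁ (f-injective eq)) (special ∘ lookup κ) (proj₂ ∘ has-special)) few)

  small : M ≤ 2 ^ length nonEdges
  -- Pigeonhole on the restrictions of the members to the non-edges of H.
  small with M ≤? 2 ^ length nonEdges
  ... | yes M≤2^e = M≤2^e
  ... | no ≰ = let i , j , i<j , eq = Fin.pigeonhole (≰⇒> ≰) (λ i → funToFin (bit ∘ word i))
    in ⊥-elim (impossible i j (Fin.<⇒≢ i<j) (bits-injective {f = word i} eq))

log-upper : ∀ M e → M ≤ 2 ^ e → ∀ i → ⌊log₂ M ^ suc i ⌋ ≤ e * suc i
log-upper M e M≤ i = subst (⌊log₂ M ^ suc i ⌋ ≤_) (⌊log₂[2^n]⌋≡n (e * suc i))
  (⌊log₂⌋-mono-≤ (≤-trans (^-monoˡ-≤ (suc i) M≤) (≤-reflexive (^-*-assoc 2 e (suc i)))))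

-- Passage to real numbers


-- Abstract, lest every comparison of fractions normalise gcds.
abstract
  frac : ℕ → ℕ → ℚ
  frac a b = pos a ℚ./ suc b

  private
    toℚᵘ-frac : ∀ a b → ℚ.toℚᵘ (frac a b) ℚᵘ.≃ ℚᵘ.mkℚᵘ (pos a) b
    toℚᵘ-frac a b = ℚ.toℚᵘ-fromℚᵘ (ℚᵘ.mkℚᵘ (pos a) b)

  frac-mono-≤ : ∀ a b c d → a * suc d ≤ c * suc b → frac a b ℚ.≤ frac c d
  frac-mono-≤ = /-mono

  frac-cancel-≤ : ∀ a b c d → frac a b ℚ.≤ frac c d → a * suc d ≤ c * suc b
  frac-cancel-≤ a b c d h = ℤ.drop‿+≤+ (subst₂ ℤ._≤_ (sym (ℤ.pos-* a (suc d))) (sym (ℤ.pos-* c (suc b)))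
    (ℚᵘ.drop-*≤* (ℚᵘ.≤-respˡ-≃ (toℚᵘ-frac a b) (ℚᵘ.≤-respʳ-≃ (toℚᵘ-frac c d) (ℚ.toℚᵘ-mono-≤ h)))))

  -- `frac a b` has denominator b + 1, and `d + b * suc d` is the predecessor of `suc b * suc d`.
  frac-* : ∀ a b c d → frac a b ℚ.* frac c d ≡ frac (a * c) (d + b * suc d)
  frac-* a b c d = ℚ.toℚᵘ-injective (ℚᵘ.≃-trans (ℚ.toℚᵘ-homo-* (frac a b) (frac c d))
    (ℚᵘ.≃-trans (ℚᵘ.*-cong (toℚᵘ-frac a b) (toℚᵘ-frac c d))
    (ℚᵘ.≃-trans (ℚᵘ.*≡* (cong (ℤ._* pos (suc (d + b * suc d))) (sym (ℤ.pos-* a c))))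
    (ℚᵘ.≃-sym (toℚᵘ-frac (a * c) (d + b * suc d))))))

  frac-+ : ∀ a b c d → frac a b ℚ.+ frac c d ≡ frac (a * suc d + c * suc b) (d + b * suc d)
  frac-+ a b c d = ℚ.toℚᵘ-injective (ℚᵘ.≃-trans (ℚ.toℚᵘ-homo-+ (frac a b) (frac c d))
    (ℚᵘ.≃-trans (ℚᵘ.+-cong (toℚᵘ-frac a b) (toℚᵘ-frac c d))
    (ℚᵘ.≃-trans (ℚᵘ.*≡* (cong (ℤ._* pos (suc (d + b * suc d))) (sym (trans (ℤ.pos-+ (a * suc d) (c * suc b))
      (cong₂ ℤ._+_ (ℤ.pos-* a (suc d)) (ℤ.pos-* c (suc b)))))))
    (ℚᵘ.≃-sym (toℚᵘ-frac (a * suc d + c * suc b) (d + b * suc d))))))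

  0≤frac : ∀ a b → 0ℚ ℚ.≤ frac a b
  0≤frac a b = /-mono 0 0 a b z≤n

  0<frac : ∀ b → 0ℚ ℚ.< frac 1 b
  0<frac b = ℚ.≰⇒> (λ h → contradiction (frac-cancel-≤ 1 b 0 0 h) λ ())

  frac-0 : frac 0 0 ≡ 0ℚ
  frac-0 = refl

  frac-1 : frac 1 0 ≡ 1ℚ
  frac-1 = refl

  archimedean-frac : ∀ ε → 0ℚ ℚ.< ε → ∃ λ N → ∀ n → N ≤ n → frac 1 n ℚ.≤ ε
  archimedean-frac = archimedean

  fromℕ-seq : ∀ m i → seq (fromℕ m) i ≡ frac m 0
  fromℕ-seq m i = refl

  ÷ʳ-seq : ∀ x {N d} → N ≡ suc d → ∀ i → seq (x ÷ʳ N) i ≡ seq x i ℚ.* frac 1 d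
  ÷ʳ-seq x refl i = refl

  log₂-seq : ∀ m i → seq (log₂ m) i ≡ frac ⌊log₂ m ^ suc i ⌋ i
  log₂-seq m i = refl

frac-≡ : ∀ a b c d → a * suc d ≡ c * suc b → frac a b ≡ frac c d
frac-≡ a b c d eq = ℚ.≤-antisym (frac-mono-≤ a b c d (≤-reflexive eq)) (frac-mono-≤ c d a b (≤-reflexive (sym eq)))

frac-≤-+ : ∀ a b c d e f → a * (suc d * suc f) ≤ (c * suc f + e * suc d) * suc b →
  frac a b ℚ.≤ frac c d ℚ.+ frac e f
frac-≤-+ a b c d e f h = subst (frac a b ℚ.≤_) (sym (frac-+ c d e f))
  (frac-mono-≤ a b (c * suc f + e * suc d) (f + d * suc f) h)

frac-÷ : ∀ a b c → frac a b ℚ.* frac 1 c ≡ frac a (c + b * suc c)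
frac-÷ a b c = trans (frac-* a b 1 c) (cong (λ z → frac z (c + b * suc c)) (*-identityʳ a))

p≤p+q : ∀ {p q} → 0ℚ ℚ.< q → p ℚ.≤ p ℚ.+ q
p≤p+q {p} {q} 0<q = subst (ℚ._≤ p ℚ.+ q) (ℚ.+-identityʳ p) (ℚ.+-monoʳ-≤ p (ℚ.<⇒≤ 0<q))

rate-seq : ∀ (M : ℕ → ℕ) n {d} → binomial n 2 ≡ suc d → ∀ i →
  seq (rate M n) i ≡ frac ⌊log₂ M n ^ suc i ⌋ (d + i * suc d)
rate-seq M n {d} eq i = trans (÷ʳ-seq (log₂ (M n)) eq i)
  (trans (cong (ℚ._* frac 1 d) (log₂-seq (M n) i)) (frac-÷ ⌊log₂ M n ^ suc i ⌋ i d))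

binomial-pos : ∀ n → 2 ≤ n → ∃ λ d → binomial n 2 ≡ suc d
binomial-pos (suc (suc n)) (s≤s (s≤s _)) = n + binomial (suc n) 2 ,
  trans (sym (nCk+nC[k+1]≡[n+1]C[k+1] (suc n) 1)) (cong (_+ binomial (suc n) 2) (nC1≡n (suc n)))

-- 1/(2 κ + 1) serves twice, as accuracy of the limit and as slack of `_≤ʳ_`; then k/n ≤ 2/(2 κ + 1)
-- yields κ k ≤ n.
littleO⇒ : ∀ k → k isLittleO[n] → ∀ κ → ∃ λ N → ∀ n → 0 < n → N ≤ n → κ * k n ≤ n
littleO⇒ k h κ with h (frac 1 (2 * κ)) (0<frac (2 * κ))
... | N , H = N , bound
  where
  bound : ∀ n → 0 < n → N ≤ n → κ * k n ≤ n
  bound n@(suc n′) _ N≤n with proj₁ (H n N≤n) (frac 1 (2 * κ)) (0<frac (2 * κ))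
  ... | N′ , H′ = *-cancelˡ-≤ 2 (begin
    2 * (κ * k n)                  ≡⟨ e₁ κ (k n) ⟩
    k n * (2 * κ)              ≤⟨ *-monoʳ-≤ (k n) (n≤1+n (2 * κ)) ⟩
    k n * suc (2 * κ)              ≤⟨ frac-cancel-≤ (k n) n′ 2 (2 * κ) (begin′) ⟩
    2 * suc n′                     ∎)
    where
    open ≤-Reasoning
    e₁ : ∀ κ k → 2 * (κ * k) ≡ k * (2 * κ)
    e₁ = solve-∀
    two : frac 1 (2 * κ) ℚ.+ frac 1 (2 * κ) ≡ frac 2 (2 * κ)
    two = trans (frac-+ 1 (2 * κ) 1 (2 * κ)) (frac-≡ (1 * suc (2 * κ) + 1 * suc (2 * κ)) (2 * κ + 2 * κ * suc (2 * κ)) 2 (2 * κ) (e₂ (2 * κ)))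
      where
      e₂ : ∀ x → (1 * suc x + 1 * suc x) * suc x ≡ 2 * suc (x + x * suc x)
      e₂ = solve-∀
    begin′ : frac (k n) n′ ℚ.≤ frac 2 (2 * κ)
    begin′ = subst₂ ℚ._≤_ (trans (÷ʳ-seq (fromℕ (k n)) {suc n′} refl N′) (trans (cong (ℚ._* frac 1 n′) (fromℕ-seq (k n) N′))
        (trans (frac-÷ (k n) 0 n′) (cong (frac (k n)) (+-identityʳ n′)))))
      (trans (cong (ℚ._+ frac 1 (2 * κ)) (ℚ.+-identityˡ (frac 1 (2 * κ)))) two)
      (H′ N′ ≤-refl)

approx-≤ : ∀ {x y ε} N → (∀ i → N ≤ i → seq x i ℚ.≤ seq y i ℚ.+ ε) → x ≤ʳ y +ʳ fromℚ ε
approx-≤ N h ε′ 0<ε′ = N , λ i N≤i → ℚ.≤-trans (h i N≤i) (p≤p+q 0<ε′)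

reciprocal-seq : ∀ p i → seq (fromℕ 1 ÷ʳ suc p) i ≡ frac 1 p
reciprocal-seq p i = trans (÷ʳ-seq (fromℕ 1) {suc p} refl i)
  (trans (cong (ℚ._* frac 1 p) (fromℕ-seq 1 i)) (trans (frac-÷ 1 0 p) (cong (frac 1) (+-identityʳ p))))

-- Through j/t: 1/(p + 1) exceeds it by 1/((p + 1) t) < 1/j, and the hypothesis bounds it by the
-- rate plus 6/j.
reciprocal-below : ∀ p j′ b d i → let j = suc j′ ; t = j + (p * j + 1) in
  j * j * (suc d * suc i) ≤ t * j * b + 6 * t * (suc d * suc i) →
  frac 1 p ℚ.≤ frac b (d + i * suc d) ℚ.+ (frac 6 j′ ℚ.+ frac 1 j′)
reciprocal-below p j′ b d i h =
  ℚ.≤-trans (frac-≤-+ 1 p j (j′ + t′) 1 j′ p-bound)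
    (ℚ.≤-trans (ℚ.+-monoˡ-≤ (frac 1 j′) (frac-≤-+ j (j′ + t′) b (d + i * suc d) 6 j′ t-bound))
      (ℚ.≤-reflexive (ℚ.+-assoc (frac b (d + i * suc d)) (frac 6 j′) (frac 1 j′))))
  where
  j = suc j′
  t′ = p * j + 1
  p-bound : 1 * (suc (j′ + t′) * j) ≤ (j * j + 1 * suc (j′ + t′)) * suc p
  p-bound = ≤-trans (≤-reflexive (e₁ p j′)) (≤-trans (m≤m+n _ _) (≤-reflexive (e₂ p j′)))
    where
    e₁ : ∀ p j′ → 1 * (suc (j′ + (p * suc j′ + 1)) * suc j′) ≡
      suc p * suc j′ * suc j′ + suc j′
    e₁ = solve-∀
    e₂ : ∀ p j′ → suc p * suc j′ * suc j′ + suc j′ +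
      (p * suc (j′ + (p * suc j′ + 1)) + (p * suc j′ + 1)) ≡
      (suc j′ * suc j′ + 1 * suc (j′ + (p * suc j′ + 1))) * suc p
    e₂ = solve-∀
  t-bound : j * (suc (d + i * suc d) * j) ≤ (b * j + 6 * suc (d + i * suc d)) * suc (j′ + t′)
  t-bound = ≤-trans (≤-reflexive (e₁ j (suc i) (suc d))) (≤-trans h (≤-reflexive (e₂ (j + t′) j b (suc i) (suc d))))
    where
    e₁ : ∀ j I D → j * (I * D * j) ≡ j * j * (D * I)
    e₁ = solve-∀
    e₂ : ∀ t j b I D → t * j * b + 6 * t * (D * I) ≡ (b * j + 6 * (I * D)) * t
    e₂ = solve-∀

-- Here j = 6 (n₀ + 1), so that 6/j is 1/(n₀ + 1), at most ε/2.
small-fractions : ∀ n₀ ε → (∀ n → n₀ ≤ n → frac 1 n ℚ.≤ ½ ℚ.* ε) →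
  let j′ = n₀ + 5 * suc n₀ in frac 6 j′ ℚ.+ frac 1 j′ ℚ.≤ ε
small-fractions n₀ ε arch = subst (frac 6 j′ ℚ.+ frac 1 j′ ℚ.≤_) (halves ε)
  (ℚ.+-mono-≤ (ℚ.≤-trans (frac-mono-≤ 6 j′ 1 n₀ (≤-reflexive (e n₀))) (arch n₀ ≤-refl)) (arch j′ (m≤m+n n₀ _)))
  where
  j′ = n₀ + 5 * suc n₀
  e : ∀ n → 6 * suc n ≡ 1 * suc (n + 5 * suc n)
  e = solve-∀

-- Upper estimates of the rate, and the limit for sublinear `k`

module UpperLimits {l} (L : Graph l) (p : ℕ) (uncolorable : ¬ Colorable L (suc p))
                   (k M : ℕ → ℕ) (isMax : ∀ n → IsMaxCodeSize (k n) L n (M n)) where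

  upper-fraction : ∀ n {d s} → k n ≡ suc s → binomial n 2 ≡ suc d → ∃ λ e →
    2 * suc p * e ≤ (n ∸ s) * (n ∸ s ∸ 1) × (∀ i → seq (rate M n) i ℚ.≤ frac e d)
  upper-fraction n {d} {s} k≡ N≡ with code-upper-bound L p uncolorable s n (M n)
    (subst (λ κ → HasCodeOfSize κ L n (M n)) k≡ (proj₁ (isMax n)))
  ... | e , M≤ , few = e , few , λ i → subst (ℚ._≤ frac e d) (sym (rate-seq M n N≡ i))
    (frac-mono-≤ ⌊log₂ M n ^ suc i ⌋ (d + i * suc d) e d (≤-trans (*-monoˡ-≤ (suc d) (log-upper (M n) e M≤ i))
      (≤-reflexive (*-assoc e (suc i) (suc d)))))

  sub-1 : ∀ m n → m ≤ n → (m ∸ 1) * n ≤ m * (n ∸ 1)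
  sub-1 zero    n       _         = z≤n
  sub-1 (suc m) (suc n) (s≤s m≤n) = ≤-trans (≤-reflexive (*-suc m n)) (+-monoˡ-≤ (m * n) m≤n)

  2*binomial : ∀ n → 2 * binomial n 2 ≡ n * (n ∸ 1)
  2*binomial zero    = refl
  2*binomial (suc n) = +-cancelʳ-≡ (suc n) _ _ (trans (2*binomial+n (suc n)) (e n))
    where
    e : ∀ n → suc n * suc n ≡ suc n * n + suc n
    e = solve-∀

  -- For m ≤ n the quotient of m (m - 1) by n (n - 1) is at most (m/n)², so the lower-order terms
  -- disappear without an error.
  squares : ∀ n m e → m ≤ n → 2 * suc p * e ≤ m * (m ∸ 1) →
    e * (suc p * (n * n)) ≤ m * m * binomial n 2
  squares n m e m≤n few = *-cancelˡ-≤ 2 (begin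
    2 * (e * (suc p * (n * n)))       ≡⟨ e₁ e (suc p) (n * n) ⟩
    2 * suc p * e * (n * n)           ≤⟨ *-monoˡ-≤ (n * n) few ⟩
    m * (m ∸ 1) * (n * n)             ≡⟨ e₂ m (m ∸ 1) n ⟩
    m * n * ((m ∸ 1) * n)             ≤⟨ *-monoʳ-≤ (m * n) (sub-1 m n m≤n) ⟩
    m * n * (m * (n ∸ 1))             ≡⟨ e₃ m n (n ∸ 1) ⟩
    m * m * (n * (n ∸ 1))             ≡⟨ cong (m * m *_) (sym (2*binomial n)) ⟩
    m * m * (2 * binomial n 2)        ≡⟨ e₄ (m * m) (binomial n 2) ⟩
    2 * (m * m * binomial n 2)        ∎)
    where
    open ≤-Reasoning
    e₁ : ∀ e p nn → 2 * (e * (p * nn)) ≡ 2 * p * e * nn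
    e₁ = solve-∀
    e₂ : ∀ m m′ n → m * m′ * (n * n) ≡ m * n * (m′ * n)
    e₂ = solve-∀
    e₃ : ∀ m n n′ → m * n * (m * n′) ≡ m * m * (n * n′)
    e₃ = solve-∀
    e₄ : ∀ mm N → mm * (2 * N) ≡ 2 * (mm * N)
    e₄ = solve-∀

  rate-above : ∀ n {d s} → 0 < n → k n ≡ suc s → binomial n 2 ≡ suc d → ∀ i → seq (rate M n) i ℚ.≤ frac 1 p
  rate-above n {d} {s} 0<n k≡ N≡ i with upper-fraction n k≡ N≡
  ... | e , few , rate≤ = ℚ.≤-trans (rate≤ i) (frac-mono-≤ e d 1 p (*-cancelʳ-≤ _ _ (n * n)
      {{>-nonZero (*-mono-≤ 0<n 0<n)}} (begin
        e * suc p * (n * n)                    ≡⟨ *-assoc e (suc p) (n * n) ⟩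
        e * (suc p * (n * n))                  ≤⟨ squares n (n ∸ s) e (m∸n≤m n s) few ⟩
        (n ∸ s) * (n ∸ s) * binomial n 2       ≤⟨ *-mono-≤ (*-mono-≤ (m∸n≤m n s) (m∸n≤m n s)) (≤-reflexive N≡) ⟩
        n * n * suc d                          ≡⟨ trans (*-comm (n * n) (suc d)) (cong (_* (n * n)) (sym (*-identityˡ (suc d)))) ⟩
        1 * suc d * (n * n)                    ∎)))
    where open ≤-Reasoning

module Limits {l} (L : Graph l) (has-edge : HasEdge L) (p : ℕ)
              (colorable : Colorable L (suc (suc p))) (uncolorable : ¬ Colorable L (suc p))
              (k M : ℕ → ℕ) (isMax : ∀ n → IsMaxCodeSize (k n) L n (M n)) where
  open UpperLimits L p uncolorable k M isMax

  LowerBoundFor : ℕ → Set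
  LowerBoundFor j = ∃ λ N → ∃ λ κ → ∀ n k M → N ≤ n → 1 ≤ k → κ * k ≤ n → IsMaxCodeSize k L n M → ∀ i →
    let t = j + (p * j + 1) in
    j * j * (binomial n 2 * suc i) ≤ t * j * ⌊log₂ M ^ suc i ⌋ + 6 * t * (binomial n 2 * suc i)

  rate-below : (∀ n → 1 ≤ n → 1 ≤ k n) → k isLittleO[n] → ∀ j′ → LowerBoundFor (suc j′) →
    ∃ λ N → ∀ n {d} → binomial n 2 ≡ suc d → 0 < n → N ≤ n → ∀ i →
      frac 1 p ℚ.≤ frac ⌊log₂ M n ^ suc i ⌋ (d + i * suc d) ℚ.+ (frac 6 j′ ℚ.+ frac 1 j′)
  rate-below k≥1 k-small j′ (N₁ , κ , lower) = N₁ ⊔ N₂ , λ n {d} N≡ 0<n N≤n i →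
    reciprocal-below p j′ ⌊log₂ M n ^ suc i ⌋ d i
      (subst (λ z → j * j * (z * suc i) ≤ t * j * ⌊log₂ M n ^ suc i ⌋ + 6 * t * (z * suc i)) N≡
        (lower n (k n) (M n) (m⊔n≤o⇒m≤o N₁ N₂ N≤n) (k≥1 n 0<n)
          (small n 0<n (m⊔n≤o⇒n≤o N₁ N₂ N≤n)) (isMax n) i))
    where
    j = suc j′
    t = j + (p * j + 1)
    small-k = littleO⇒ k k-small κ
    N₂ = proj₁ small-k
    small = proj₂ small-k

  limit : (∀ n → 1 ≤ n → 1 ≤ k n) → k isLittleO[n] → rate M ⟶ fromℕ 1 ÷ʳ suc p
  limit k≥1 k-small ε 0<ε = go (archimedean-frac (½ ℚ.* ε) (halve-pos 0<ε))
    where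
    Goal : Set
    Goal = ∃ λ N → ∀ n → N ≤ n →
      rate M n ≤ʳ fromℕ 1 ÷ʳ suc p +ʳ fromℚ ε × fromℕ 1 ÷ʳ suc p ≤ʳ rate M n +ʳ fromℚ ε
    conclude : ∀ {δ} → δ ℚ.≤ ε → (∃ λ N → ∀ n {d} → binomial n 2 ≡ suc d → 0 < n → N ≤ n → ∀ i →
      frac 1 p ℚ.≤ frac ⌊log₂ M n ^ suc i ⌋ (d + i * suc d) ℚ.+ δ) → Goal
    conclude {δ} δ≤ε (N , lower) = 2 ⊔ N , λ n N≤n →
      bounds n (m⊔n≤o⇒n≤o 2 N N≤n) (≤-trans (s≤s z≤n) (m⊔n≤o⇒m≤o 2 N N≤n))
        (binomial-pos n (m⊔n≤o⇒m≤o 2 N N≤n))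
      where
      bounds : ∀ n → N ≤ n → 0 < n → (∃ λ d → binomial n 2 ≡ suc d) →
        rate M n ≤ʳ fromℕ 1 ÷ʳ suc p +ʳ fromℚ ε × fromℕ 1 ÷ʳ suc p ≤ʳ rate M n +ʳ fromℚ ε
      bounds n N≤n 0<n (d , N≡) =
        approx-≤ {rate M n} {fromℕ 1 ÷ʳ suc p} 0 (λ i _ →
          subst (λ z → seq (rate M n) i ℚ.≤ z ℚ.+ ε) (sym (reciprocal-seq p i))
            (ℚ.≤-trans (rate-above n 0<n (sym (suc-pred (k n) {{>-nonZero (k≥1 n 0<n)}})) N≡ i) (p≤p+q 0<ε))) ,
        approx-≤ {fromℕ 1 ÷ʳ suc p} {rate M n} 0 (λ i _ →
          subst₂ (λ y z → y ℚ.≤ z ℚ.+ ε) (sym (reciprocal-seq p i)) (sym (rate-seq M n N≡ i))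
            (ℚ.≤-trans (lower n N≡ 0<n N≤n i)
              (ℚ.+-monoʳ-≤ (frac ⌊log₂ M n ^ suc i ⌋ (d + i * suc d)) δ≤ε)))
    go : (∃ λ n₀ → ∀ n → n₀ ≤ n → frac 1 n ℚ.≤ ½ ℚ.* ε) → Goal
    go (n₀ , arch) = conclude (small-fractions n₀ ε arch)
      (rate-below k≥1 k-small (n₀ + 5 * suc n₀)
        (eventual-lower-bound p (suc (n₀ + 5 * suc n₀)) z<s L has-edge colorable))

-- The upper limit for linear `k`

0≤p*p : ∀ p → 0ℚ ℚ.≤ p ℚ.* p
0≤p*p p with ℚ.≤-total 0ℚ p
... | inj₁ 0≤p = ℚ.nonNegative⁻¹ (p ℚ.* p) {{ℚ.nonNeg*nonNeg⇒nonNeg p {{ℚ.nonNegative 0≤p}} p {{ℚ.nonNegative 0≤p}}}}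
... | inj₂ p≤0 = subst (0ℚ ℚ.≤_) (S.solve 1 (λ p → (S.:- p) S.:* (S.:- p) S.:= p S.:* p) refl p)
  (ℚ.nonNegative⁻¹ (ℚ.- p ℚ.* ℚ.- p) {{ℚ.nonNeg*nonNeg⇒nonNeg (ℚ.- p) {{neg≥0}} (ℚ.- p) {{neg≥0}}}})
  where
  neg≥0 = ℚ.nonNegative (ℚ.neg-antimono-≤ p≤0)

ℚ-+-cancelˡ-≤ : ∀ p {q r} → p ℚ.+ q ℚ.≤ p ℚ.+ r → q ℚ.≤ r
ℚ-+-cancelˡ-≤ p {q} {r} h = subst₂ ℚ._≤_ (e p q) (e p r) (ℚ.+-monoʳ-≤ (ℚ.- p) h)
  where
  e : ∀ p q → ℚ.- p ℚ.+ (p ℚ.+ q) ≡ q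
  e = S.solve 2 (λ p q → S.:- p S.:+ (p S.:+ q) S.:= q) refl

-- 2 μ y ≤ μ² + y² spares a case distinction on the sign of y.
square-≤ : ∀ μ y η → 0ℚ ℚ.≤ μ → μ ℚ.≤ 1ℚ → 0ℚ ℚ.≤ η → μ ℚ.≤ y ℚ.+ η →
  μ ℚ.* μ ℚ.≤ y ℚ.* y ℚ.+ (η ℚ.+ η)
square-≤ μ y η 0≤μ μ≤1 0≤η μ≤y+η = ℚ-+-cancelˡ-≤ (μ ℚ.* μ) (begin
  μ ℚ.* μ ℚ.+ μ ℚ.* μ
    ≤⟨ ℚ.+-mono-≤ once once ⟩
  (μ ℚ.* y ℚ.+ η) ℚ.+ (μ ℚ.* y ℚ.+ η)
    ≤⟨ p≤p+q′ (0≤p*p (μ ℚ.- y)) ⟩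
  (μ ℚ.* y ℚ.+ η) ℚ.+ (μ ℚ.* y ℚ.+ η) ℚ.+ (μ ℚ.- y) ℚ.* (μ ℚ.- y)
    ≡⟨ S.solve 3 (λ μ y η → (μ S.:* y S.:+ η) S.:+ (μ S.:* y S.:+ η) S.:+ (μ S.:- y) S.:* (μ S.:- y)
         S.:= μ S.:* μ S.:+ (y S.:* y S.:+ (η S.:+ η))) refl μ y η ⟩
  μ ℚ.* μ ℚ.+ (y ℚ.* y ℚ.+ (η ℚ.+ η)) ∎)
  where
  open ℚ.≤-Reasoning
  p≤p+q′ : ∀ {p q} → 0ℚ ℚ.≤ q → p ℚ.≤ p ℚ.+ q
  p≤p+q′ {p} {q} 0≤q = subst (ℚ._≤ p ℚ.+ q) (ℚ.+-identityʳ p) (ℚ.+-monoʳ-≤ p 0≤q)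
  once : μ ℚ.* μ ℚ.≤ μ ℚ.* y ℚ.+ η
  once = begin
    μ ℚ.* μ                  ≤⟨ ℚ.*-monoˡ-≤-nonNeg μ {{ℚ.nonNegative 0≤μ}} μ≤y+η ⟩
    μ ℚ.* (y ℚ.+ η)          ≡⟨ ℚ.*-distribˡ-+ μ y η ⟩
    μ ℚ.* y ℚ.+ μ ℚ.* η      ≤⟨ ℚ.+-monoʳ-≤ (μ ℚ.* y) (ℚ.*-monoʳ-≤-nonNeg η {{ℚ.nonNegative 0≤η}} μ≤1) ⟩
    μ ℚ.* y ℚ.+ 1ℚ ℚ.* η     ≡⟨ cong (μ ℚ.* y ℚ.+_) (ℚ.*-identityˡ η) ⟩
    μ ℚ.* y ℚ.+ η            ∎

frac≤1 : ∀ m n′ → m ≤ suc n′ → frac m n′ ℚ.≤ 1ℚ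
frac≤1 m n′ m≤n = subst (frac m n′ ℚ.≤_) frac-1 (frac-mono-≤ m n′ 1 0
  (≤-trans (≤-reflexive (*-identityʳ m)) (≤-trans m≤n (≤-reflexive (sym (*-identityˡ (suc n′)))))))

frac-cancelˡ : ∀ x n′ k → x ℚ.* frac (suc n′) 0 ℚ.≤ frac k 0 → x ℚ.≤ frac k n′
frac-cancelˡ x n′ k h = subst₂ ℚ._≤_ left right (ℚ.*-monoʳ-≤-nonNeg (frac 1 n′) {{ℚ.nonNegative (0≤frac 1 n′)}} h)
  where
  one : frac (suc n′) 0 ℚ.* frac 1 n′ ≡ 1ℚ
  one = trans (frac-÷ (suc n′) 0 n′) (trans (frac-≡ (suc n′) (n′ + 0) 1 0 (e n′)) frac-1)
    where
    e : ∀ n → suc n * 1 ≡ 1 * suc (n + 0)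
    e = solve-∀
  left : x ℚ.* frac (suc n′) 0 ℚ.* frac 1 n′ ≡ x
  left = trans (ℚ.*-assoc x (frac (suc n′) 0) (frac 1 n′)) (trans (cong (x ℚ.*_) one) (ℚ.*-identityʳ x))
  right : frac k 0 ℚ.* frac 1 n′ ≡ frac k n′
  right = trans (frac-÷ k 0 n′) (cong (frac k) (+-identityʳ n′))

frac-sum : ∀ a b → frac a 0 ℚ.+ frac b 0 ≡ frac (a + b) 0
frac-sum a b = trans (frac-+ a 0 b 0) (cong (λ z → frac z 0) (cong₂ _+_ (*-identityʳ a) (*-identityʳ b)))

-- With s = k - 1, rounding gives c n ≤ k + 1 = s + 2; this is the origin of 2/n.
remaining-≤ : ∀ n′ s c → c ℚ.≤ frac (suc (suc s)) n′ → (n′<s : s ≤ suc n′) →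
  frac (suc n′ ∸ s) n′ ℚ.≤ 1ℚ ℚ.- c ℚ.+ frac 2 n′
remaining-≤ n′ s c c≤ s≤n = subst₂ ℚ._≤_ (e₁ (frac m n′) q) (e₂ (frac 2 n′) c)
  (ℚ.≤-trans (ℚ.≤-reflexive (cong (ℚ._+ (ℚ.- q)) sum)) (ℚ.+-monoʳ-≤ (1ℚ ℚ.+ frac 2 n′) (ℚ.neg-antimono-≤ c≤)))
  where
  m = suc n′ ∸ s
  q = frac (suc (suc s)) n′
  e₁ : ∀ μ q → μ ℚ.+ q ℚ.+ (ℚ.- q) ≡ μ
  e₁ = S.solve 2 (λ μ q → μ S.:+ q S.:+ (S.:- q) S.:= μ) refl
  e₂ : ∀ η c → 1ℚ ℚ.+ η ℚ.+ (ℚ.- c) ≡ 1ℚ ℚ.- c ℚ.+ η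
  e₂ = S.solve 2 (λ η c → S.con 1ℚ S.:+ η S.:+ (S.:- c) S.:= S.con 1ℚ S.:- c S.:+ η) refl
  sum : frac m n′ ℚ.+ q ≡ 1ℚ ℚ.+ frac 2 n′
  sum = trans (frac-+ m n′ (suc (suc s)) n′) (trans
    (frac-≡ (m * suc n′ + suc (suc s) * suc n′) (n′ + n′ * suc n′) (1 * suc n′ + 2 * 1) (n′ + 0 * suc n′)
      (trans (e₃ m s n′) (trans (cong (λ z → (z + 2) * suc n′ * suc n′) (m∸n+n≡m s≤n)) (e₄ n′))))
    (trans (sym (frac-+ 1 0 2 n′)) (cong (ℚ._+ frac 2 n′) frac-1)))
    where
    e₃ : ∀ m s n → (m * suc n + suc (suc s) * suc n) * suc (n + 0 * suc n) ≡ (m + s + 2) * suc n * suc n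
    e₃ = solve-∀
    e₄ : ∀ n → (suc n + 2) * suc n * suc n ≡ (1 * suc n + 2 * 1) * suc (n + n * suc n)
    e₄ = solve-∀

remaining-square : ∀ n′ s c → c ℚ.≤ frac (suc (suc s)) n′ →
  let y = 1ℚ ℚ.- c ; μ = frac (suc n′ ∸ s) n′ in
  μ ℚ.* μ ℚ.≤ y ℚ.* y ℚ.+ (frac 2 n′ ℚ.+ frac 2 n′)
remaining-square n′ s c c≤ with s ≤? suc n′
... | yes s≤n = square-≤ _ (1ℚ ℚ.- c) (frac 2 n′) (0≤frac (suc n′ ∸ s) n′)
  (frac≤1 (suc n′ ∸ s) n′ (m∸n≤m (suc n′) s)) (0≤frac 2 n′) (remaining-≤ n′ s c c≤ s≤n)
-- Truncated subtraction makes `suc n′ ∸ s` zero, and the right-hand side is nonnegative.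
... | no s≰n = ℚ.≤-trans (ℚ.≤-trans
    (ℚ.≤-reflexive (trans (cong (λ z → frac z n′ ℚ.* frac z n′) (m≤n⇒m∸n≡0 (<⇒≤ (≰⇒> s≰n)))) null))
    (0≤p*p (1ℚ ℚ.- c)))
  (subst (ℚ._≤ (1ℚ ℚ.- c) ℚ.* (1ℚ ℚ.- c) ℚ.+ (frac 2 n′ ℚ.+ frac 2 n′)) (ℚ.+-identityʳ _)
    (ℚ.+-monoʳ-≤ ((1ℚ ℚ.- c) ℚ.* (1ℚ ℚ.- c)) (ℚ.+-mono-≤ (0≤frac 2 n′) (0≤frac 2 n′))))
  where
  zero-frac : frac 0 n′ ≡ 0ℚ
  zero-frac = ℚ.≤-antisym (subst (frac 0 n′ ℚ.≤_) frac-0 (frac-mono-≤ 0 n′ 0 0 z≤n)) (0≤frac 0 n′)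
  null : frac 0 n′ ℚ.* frac 0 n′ ≡ 0ℚ
  null = trans (cong (ℚ._* frac 0 n′) zero-frac) (ℚ.*-zeroˡ (frac 0 n′))

-- `n₀` stems from the positivity of `c` and serves every `n`, whereas the index `I` may depend on
-- `n`.
rounding-bounds : ∀ k c → fromℕ 0 <ʳ c → k isRoundingOf c ·n →
  ∃ λ n₀ → ∀ n → ∃ λ I → ∀ i → I ≤ i →
    frac 1 n₀ ℚ.≤ seq c i × seq c i ℚ.* frac n 0 ℚ.≤ frac (k n + 1) 0
rounding-bounds k c (ε , 0<ε , N₀ , positive) rounding = n₀ , λ n → go n (proj₂ (rounding n))
  where
  small = archimedean-frac ε 0<ε
  n₀ = proj₁ small
  go : ∀ n → c *ʳ fromℕ n <ʳ fromℕ (k n) +ʳ fromℕ 1 → ∃ λ I → ∀ i → I ≤ i →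
    frac 1 n₀ ℚ.≤ seq c i × seq c i ℚ.* frac n 0 ℚ.≤ frac (k n + 1) 0
  go n (δ , 0<δ , N₁ , close) = N₀ ⊔ N₁ , λ i I≤i →
    ℚ.≤-trans (proj₂ small n₀ ≤-refl)
      (subst (ℚ._≤ seq c i) (trans (cong (ℚ._+ ε) (trans (fromℕ-seq 0 i) frac-0)) (ℚ.+-identityˡ ε))
        (positive i (m⊔n≤o⇒m≤o N₀ N₁ I≤i))) ,
    subst₂ ℚ._≤_ (cong (seq c i ℚ.*_) (fromℕ-seq n i))
      (trans (cong₂ ℚ._+_ (fromℕ-seq (k n) i) (fromℕ-seq 1 i)) (frac-sum (k n) 1))
      (ℚ.≤-trans (p≤p+q 0<δ) (close i (m⊔n≤o⇒n≤o N₀ N₁ I≤i)))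

-- k + 1 ≥ x n ≥ 2. A positive `k` is what allows s = k - 1 special vertices.
rounding-positive : ∀ n₀ n k x → 2 * suc n₀ ≤ n → frac 1 n₀ ℚ.≤ x → x ℚ.* frac n 0 ℚ.≤ frac (k + 1) 0 → 1 ≤ k
rounding-positive n₀ n k x large x≥ x≤ = +-cancelʳ-≤ 1 1 k (subst₂ _≤_ (*-identityʳ 2) (*-identityʳ (k + 1))
  (frac-cancel-≤ 2 0 (k + 1) 0 (ℚ.≤-trans two (ℚ.≤-trans
    (ℚ.*-monoʳ-≤-nonNeg (frac n 0) {{ℚ.nonNegative (0≤frac n 0)}} x≥) x≤))))
  where
  two : frac 2 0 ℚ.≤ frac 1 n₀ ℚ.* frac n 0
  two = subst (frac 2 0 ℚ.≤_) (sym (frac-* 1 n₀ n 0)) (frac-mono-≤ 2 0 (1 * n) (0 + n₀ * 1)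
    (≤-trans (≤-reflexive (e₁ n₀)) (≤-trans large (≤-reflexive (e₂ n)))))
    where
    e₁ : ∀ x → 2 * suc (0 + x * 1) ≡ 2 * suc x
    e₁ = solve-∀
    e₂ : ∀ n → n ≡ 1 * n * 1
    e₂ = solve-∀

-- The error 4/n is the 2/n of `remaining-≤`, doubled by squaring.
small-error : ∀ n₁ n′ ε → frac 1 n₁ ℚ.≤ ε → 4 * suc n₁ ≤ suc n′ → frac 2 n′ ℚ.+ frac 2 n′ ℚ.≤ ε
small-error n₁ n′ ε n₁≤ε large = ℚ.≤-trans (subst (ℚ._≤ frac 1 n₁) (sym (frac-+ 2 n′ 2 n′))
  (frac-mono-≤ (2 * suc n′ + 2 * suc n′) (n′ + n′ * suc n′) 1 n₁
    (≤-trans (≤-reflexive (e₁ (suc n′) n₁)) (≤-trans (*-monoʳ-≤ (suc n′) large) (≤-reflexive (e₂ n′)))))) n₁≤ε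
  where
  e₁ : ∀ n x → (2 * n + 2 * n) * suc x ≡ n * (4 * suc x)
  e₁ = solve-∀
  e₂ : ∀ n → suc n * suc n ≡ 1 * suc (n + n * suc n)
  e₂ = solve-∀

complement-square-seq : ∀ c p i → seq ((fromℕ 1 -ʳ c) *ʳ (fromℕ 1 -ʳ c) ÷ʳ suc p) i ≡
  (1ℚ ℚ.- seq c i) ℚ.* (1ℚ ℚ.- seq c i) ℚ.* frac 1 p
complement-square-seq c p i = trans (÷ʳ-seq ((fromℕ 1 -ʳ c) *ʳ (fromℕ 1 -ʳ c)) {suc p} refl i)
  (cong (λ y → y ℚ.* y ℚ.* frac 1 p) (cong (ℚ._- seq c i) (trans (fromℕ-seq 1 i) frac-1)))

scaled-square : ∀ y μ² η ε p → μ² ℚ.≤ y ℚ.* y ℚ.+ η → 0ℚ ℚ.≤ η → η ℚ.≤ ε →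
  μ² ℚ.* frac 1 p ℚ.≤ y ℚ.* y ℚ.* frac 1 p ℚ.+ ε
scaled-square y μ² η ε p h 0≤η η≤ε = begin
  μ² ℚ.* u                       ≤⟨ ℚ.*-monoʳ-≤-nonNeg u {{ℚ.nonNegative (0≤frac 1 p)}} h ⟩
  (y ℚ.* y ℚ.+ η) ℚ.* u          ≡⟨ ℚ.*-distribʳ-+ u (y ℚ.* y) η ⟩
  y ℚ.* y ℚ.* u ℚ.+ η ℚ.* u      ≤⟨ ℚ.+-monoʳ-≤ (y ℚ.* y ℚ.* u) (ℚ.≤-trans
                                     (ℚ.*-monoˡ-≤-nonNeg η {{ℚ.nonNegative 0≤η}} (frac≤1 1 p (s≤s z≤n)))
                                     (ℚ.≤-trans (ℚ.≤-reflexive (ℚ.*-identityʳ η)) η≤ε)) ⟩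
  y ℚ.* y ℚ.* u ℚ.+ ε            ∎
  where
  open ℚ.≤-Reasoning
  u = frac 1 p

module LimSup {l} (L : Graph l) (p : ℕ) (uncolorable : ¬ Colorable L (suc p))
              (k M : ℕ → ℕ) (isMax : ∀ n → IsMaxCodeSize (k n) L n (M n)) where
  open UpperLimits L p uncolorable k M isMax

  rate-≤ : ∀ n′ {d s} → k (suc n′) ≡ suc s → binomial (suc n′) 2 ≡ suc d → ∀ i →
    let μ = frac (suc n′ ∸ s) n′ in seq (rate M (suc n′)) i ℚ.≤ μ ℚ.* μ ℚ.* frac 1 p
  rate-≤ n′ {d} {s} k≡ N≡ i with upper-fraction (suc n′) k≡ N≡
  ... | e , few , rate≤ = ℚ.≤-trans (rate≤ i) (subst (frac e d ℚ.≤_) product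
      (frac-mono-≤ e d (m * m) (p + x * suc p) (begin
        e * suc (p + x * suc p)               ≡⟨ cong (e *_) (e₁ n′ p) ⟩
        e * (suc p * (suc n′ * suc n′))       ≤⟨ squares (suc n′) m e (m∸n≤m (suc n′) s) few ⟩
        m * m * binomial (suc n′) 2           ≡⟨ cong (m * m *_) N≡ ⟩
        m * m * suc d                         ∎)))
    where
    open ≤-Reasoning
    m = suc n′ ∸ s
    x = n′ + n′ * suc n′
    e₁ : ∀ n p → suc (p + (n + n * suc n) * suc p) ≡ suc p * (suc n * suc n)
    e₁ = solve-∀
    product : frac (m * m) (p + x * suc p) ≡ frac m n′ ℚ.* frac m n′ ℚ.* frac 1 p
    product = sym (trans (cong (ℚ._* frac 1 p) (frac-* m n′ m n′)) (frac-÷ (m * m) x p))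

  limsup : ∀ c → fromℕ 0 <ʳ c → k isRoundingOf c ·n →
    LimSup≤ (rate M) ((fromℕ 1 -ʳ c) *ʳ (fromℕ 1 -ʳ c) ÷ʳ suc p)
  limsup c 0<c rounding ε 0<ε = go (rounding-bounds k c 0<c rounding) (archimedean-frac ε 0<ε)
    where
    limit : ℝ
    limit = (fromℕ 1 -ʳ c) *ʳ (fromℕ 1 -ʳ c) ÷ʳ suc p
    Bounds : ℕ → ℕ → Set
    Bounds n₀ n = ∃ λ I → ∀ i → I ≤ i →
      frac 1 n₀ ℚ.≤ seq c i × seq c i ℚ.* frac n 0 ℚ.≤ frac (k n + 1) 0
    at : ∀ n₀ n₁ → frac 1 n₁ ℚ.≤ ε → ∀ n → 2 * suc n₀ + 4 * suc n₁ ≤ n → Bounds n₀ n →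
      (∃ λ d → binomial n 2 ≡ suc d) → rate M n ≤ʳ limit +ʳ fromℚ ε
    at n₀ n₁ n₁≤ε (suc n′) large (I , bounds) (d , N≡) =
      approx-≤ {rate M (suc n′)} {limit} I (λ i I≤i →
        subst (λ z → seq (rate M (suc n′)) i ℚ.≤ z ℚ.+ ε) (sym (complement-square-seq c p i))
          (ℚ.≤-trans (rate-≤ n′ k≡ N≡ i)
            (scaled-square (1ℚ ℚ.- seq c i) _ (frac 2 n′ ℚ.+ frac 2 n′) ε p
              (remaining-square n′ s (seq c i) (c≤ i (proj₂ (bounds i I≤i))))
              (ℚ.+-mono-≤ (0≤frac 2 n′) (0≤frac 2 n′))
              (small-error n₁ n′ ε n₁≤ε (≤-trans (m≤n+m (4 * suc n₁) (2 * suc n₀)) large)))))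
      where
      s = pred (k (suc n′))
      k≡ : k (suc n′) ≡ suc s
      k≡ = sym (suc-pred (k (suc n′)) {{>-nonZero (rounding-positive n₀ (suc n′) (k (suc n′)) (seq c I)
        (≤-trans (m≤m+n (2 * suc n₀) (4 * suc n₁)) large) (proj₁ (bounds I ≤-refl)) (proj₂ (bounds I ≤-refl)))}})
      c≤ : ∀ i → seq c i ℚ.* frac (suc n′) 0 ℚ.≤ frac (k (suc n′) + 1) 0 → seq c i ℚ.≤ frac (suc (suc s)) n′
      c≤ i h = frac-cancelˡ (seq c i) n′ (suc (suc s))
        (subst (λ z → seq c i ℚ.* frac (suc n′) 0 ℚ.≤ frac z 0) (trans (+-comm (k (suc n′)) 1) (cong suc k≡)) h)
    at n₀ n₁ _ zero () _ _
    go : (∃ λ n₀ → ∀ n → Bounds n₀ n) → (∃ λ n₁ → ∀ n → n₁ ≤ n → frac 1 n ℚ.≤ ε) →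
      ∃ λ N → ∀ n → N ≤ n → rate M n ≤ʳ limit +ʳ fromℚ ε
    go (n₀ , bounds) (n₁ , arch) = 2 * suc n₀ + 4 * suc n₁ , λ n N≤n →
      at n₀ n₁ (arch n₁ ≤-refl) n N≤n (bounds n)
        (binomial-pos n (≤-trans (≤-trans (*-monoʳ-≤ 2 (s≤s z≤n)) (m≤m+n (2 * suc n₀) (4 * suc n₁))) N≤n))

theorem1p4 : ∀ {l} (L : Graph l) → HasEdge L →
    (χ : ℕ) → IsChromaticNumber L χ →
    (k M : ℕ → ℕ) → (∀ n → IsMaxCodeSize (k n) L n (M n)) →
    ((∀ n → 1 ≤ n → 1 ≤ k n) → k isLittleO[n] →
    rate M ⟶ fromℕ 1 ÷ʳ (χ ∸ 1))
    ×
    ((c : ℝ) → fromℕ 0 <ʳ c → k isRoundingOf c ·n →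
    LimSup≤ (rate M) ((fromℕ 1 -ʳ c) *ʳ (fromℕ 1 -ʳ c) ÷ʳ (χ ∸ 1)))
-- An edge of `L` excludes χ = 0 and χ = 1, so that the divisor χ - 1 = p + 1 is positive.
theorem1p4 L (u , _ , _) zero ((col , _) , _) k M isMax with col u
... | ()
theorem1p4 L (u , v , e) (suc zero) ((col , proper) , _) k M isMax with col u in eu | col v in ev
... | zero | zero = contradiction (trans eu (sym ev)) (proper u v e)
theorem1p4 L has-edge (suc (suc p)) (colorable , minimal) k M isMax =
  Limits.limit L has-edge p colorable uncolorable k M isMax ,
  LimSup.limsup L p uncolorable k M isMax
  where
  uncolorable : ¬ Colorable L (suc p)
  uncolorable h = 1+n≰n (minimal (suc p) h)
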